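{- Let $S$ be a sparse family of boolean databases. The decision problem $\langle I,T,\mathrm{sup},k,s\rangle$, restricted to inputs in which $T\in S$ is a database on the attribute set $I$, $1\le k\le |I|$ is a natural and $0<s\le 1$ is a rational, is in L (deterministic logarithmic space).
   Context: An attribute is an identifier $A$ with a domain $\mathrm{dom}(A)$. The domain of a categorical attribute is an unordered set of values; that of a numeric attribute is a set of integers or rationals; both kinds of domain also include a special null value $\epsilon$. An attribute $A$ is boolean if $\mathrm{dom}(A)=\{\epsilon,c(A)\}$ for a constant $c(A)$. A database $T$ on a finite attribute set $I$ is a relation with duplicates (a finite multiset of tuples) having attribute set $I$; $t[A]$ is the value of $A$ in tuple $t$, and $|t|=|\{A\in I: t[A]\neq\epsilon\}|$. $T$ is boolean if every attribute in $I$ is boolean. A family $S$ of boolean databases is sparse if, for $T\in S$ defined on $I$, the largest tuple size $\max_{t\in T}|t|$ is $\mathcal{O}(\log|I|)$. An atomic condition on a categorical attribute $A$ is $A=u$ or $A\neq u$ with $u\in \mathrm{dom}(A)\setminus\{\epsilon\}$; on a numeric attribute $A$ it is $A\in[l,u]$ or $A\notin[l,u]$ with numeric values $l\le u$ not necessarily distinct ($A=u$, $A\ne u$ abbreviate the case $[u,u]$). A tuple $t$ satisfies an atomic condition on $A$ iff $t[A]\neq\epsilon$ and $t[A]$ fulfils the stated relation (so a null value satisfies no condition). A condition is a conjunction $C=C_1\wedge\dots\wedge C_n$ of atomic conditions on distinct attributes; its size is $|C|=n$; $t$ satisfies $C$ iff it satisfies every $C_i$; $T_C$ is the (multi)set of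 tuples of $T$ satisfying $C$, with $|T_C|$ counted with duplicates. An association rule on $I$ is $B\Rightarrow H$ with $B,H$ conditions on attribute sets $I_B,I_H$ with $\emptyset\subset I_B,I_H\subset I$ and $I_B\cap I_H=\emptyset$; its size is $|B\Rightarrow H|=|B|+|H|$. It is trivial (w.r.t. $T$) if $B\wedge H$ contains at least one atomic condition $C_a$ with $T_{C_a}=T$. The support is $\mathrm{sup}(B\Rightarrow H,T)=|T_{B\wedge H}|/|T|$. The problem $\langle I,T,\rho,k,s\rangle$ for an index $\rho$ asks: is there a non-trivial association rule $R$ on $I$ with $|R|\ge k$ and $\rho(R,T)\ge s$? -}

module Defs where

open import Level using (Level; 0ℓ) renaming (suc to lsuc; _⊔_ to _⊔ˡ_)
open import Data.Bool using (Bool; true; if_then_else_)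
import Data.Bool.Properties as Bool
open import Data.Nat using (ℕ; zero; suc; _+_; _*_; _≤_)
open import Data.Nat.Logarithm using (⌊log₂_⌋)
open import Data.Integer using (ℤ; +_; -[1+_])
open import Data.Rational using (ℚ; 0ℚ; 1ℚ; ↥_; ↧ₙ_) renaming (_≤_ to _≤ℚ_; _<_ to _<ℚ_; _/_ to _/ℚ_)
import Data.Rational.Properties as ℚ
open import Data.Digit using (Bit; toDigits)
open import Data.Empty using (⊥)
open import Data.Fin using (Fin; zero; suc; #_)
import Data.Fin.Properties as Fin
open import Data.List using (List; []; _∷_; [_]; _++_; map; concatMap; length; filter; filterᵇ; allFin)
import Data.List.Properties as List
open import Data.List.Extrema.Nat using (max)
open import Data.List.Relation.Unary.All using (All; all?)
open import Data.List.Relation.Unary.Any using (Any)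
open import Data.List.Relation.Unary.Unique.Propositional using (Unique)
open import Data.List.Relation.Binary.Disjoint.Propositional using (Disjoint)
open import Data.List.Relation.Binary.Permutation.Propositional using (_↭_)
open import Data.Maybe using (Maybe; just; nothing; is-just)
open import Data.Product using (Σ; ∃-syntax; _×_; _,_; proj₁; proj₂)
open import Data.Vec as Vec using (Vec)
open import Function using (_∘_; _↔_; _⇔_; mk↔ₛ′; Injective)
open import Relation.Binary.Definitions using (DecidableEquality)
open import Relation.Binary.PropositionalEquality using (_≡_; _≢_; refl)
open import Relation.Nullary using (¬_; Dec; yes; no)
open import Relation.Nullary.Decidable using (_×-dec_; ¬?; toWitness)
open import Relation.Unary using (Pred; _∈_)

------------------------------------------------------------------------
-- Attributes and databases

-- Identifiers and categorical values are binary words; of the latter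
-- only equality is ever used.
Word : Set
Word = List Bool

data Kind : Set where
  categorical numeric : Kind

Constant : Kind → Set
Constant categorical = Word
Constant numeric     = ℚ

-- `dom` holds the non-null part of the domain; the null value is
-- adjoined in `Value`, where it is `nothing`.
record Attribute : Set₁ where
  field
    name : Word
    kind : Kind
    dom  : Pred (Constant kind) 0ℓ

  Value : Set
  Value = Maybe (Σ (Constant kind) dom)

open Attribute public

IsBoolean : Attribute → Set
IsBoolean A = ∃[ c ] (∀ v → v ∈ dom A ⇔ v ≡ c)

-- A finite set of attributes, presented by an enumeration without
-- repetition.
record AttributeSet : Set₁ where
  field
    size      : ℕ
    attribute : Fin size → Attribute
    distinct  : Injective _≡_ _≡_ (name ∘ attribute)

open AttributeSet public renaming (size to ∣_∣ᴬ)

Tuple : AttributeSet → Set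
Tuple I = (i : Fin ∣ I ∣ᴬ) → Value (attribute I i)

-- A finite multiset of tuples; equality of multisets is `_↭_`.
Database : AttributeSet → Set
Database I = List (Tuple I)

tupleSize : ∀ I → Tuple I → ℕ
tupleSize I t = length (filterᵇ (λ i → is-just (t i)) (allFin ∣ I ∣ᴬ))

maxTupleSize : ∀ I → Database I → ℕ
maxTupleSize I T = max 0 (map (tupleSize I) T)

record BooleanDatabase : Set₁ where
  field
    attributes : AttributeSet
    boolean    : ∀ i → IsBoolean (attribute attributes i)
    tuples     : Database attributes

open BooleanDatabase public

Family : (ℓ : Level) → Set (lsuc 0ℓ ⊔ˡ lsuc ℓ)
Family ℓ = Pred BooleanDatabase ℓ

-- f(n) = O(log n).  Rounding the logarithm down changes it by at most
-- a factor of 2 once n ≥ 2.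
_∈O[log] : (ℕ → ℕ) → Set
f ∈O[log] = ∃[ c ] ∃[ n₀ ] (∀ n → n₀ ≤ n → f n ≤ c * ⌊log₂ n ⌋)

Sparse : ∀ {ℓ} → Family ℓ → Set (lsuc 0ℓ ⊔ˡ ℓ)
Sparse S = ∃[ f ] (f ∈O[log] ×
  (∀ T → T ∈ S → maxTupleSize (attributes T) (tuples T) ≤ f ∣ attributes T ∣ᴬ))

------------------------------------------------------------------------
-- Conditions and association rules

data CategoricalComparison (D : Pred Word 0ℓ) : Set where
  equal unequal : ∀ u → u ∈ D → CategoricalComparison D

-- The bounds need not belong to the domain.
data NumericComparison : Set where
  within outside : ∀ l u → l ≤ℚ u → NumericComparison

Comparison : Attribute → Set
Comparison record { kind = categorical ; dom = D } = CategoricalComparison D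
Comparison record { kind = numeric }               = NumericComparison

_≟ʷ_ : DecidableEquality Word
_≟ʷ_ = List.≡-dec Bool._≟_

Fulfils : ∀ A → Comparison A → Constant (kind A) → Set
Fulfils record { kind = categorical } (equal u _)     v = v ≡ u
Fulfils record { kind = categorical } (unequal u _)   v = v ≢ u
Fulfils record { kind = numeric }     (within l u _)  v = l ≤ℚ v × v ≤ℚ u
Fulfils record { kind = numeric }     (outside l u _) v = ¬ (l ≤ℚ v × v ≤ℚ u)

fulfils? : ∀ A (a : Comparison A) v → Dec (Fulfils A a v)
fulfils? record { kind = categorical } (equal u _)     v = v ≟ʷ u
fulfils? record { kind = categorical } (unequal u _)   v = ¬? (v ≟ʷ u)
fulfils? record { kind = numeric }     (within l u _)  v = l ℚ.≤? v ×-dec v ℚ.≤? u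
fulfils? record { kind = numeric }     (outside l u _) v = ¬? (l ℚ.≤? v ×-dec v ℚ.≤? u)

FulfilsValue : ∀ A → Comparison A → Value A → Set
FulfilsValue A a nothing        = ⊥
FulfilsValue A a (just (v , _)) = Fulfils A a v

fulfilsValue? : ∀ A a v → Dec (FulfilsValue A a v)
fulfilsValue? A a nothing        = no λ ()
fulfilsValue? A a (just (v , _)) = fulfils? A a v

module _ (I : AttributeSet) where

  Atomic : Set
  Atomic = Σ (Fin ∣ I ∣ᴬ) λ i → Comparison (attribute I i)

  Conjunction : Set
  Conjunction = List Atomic

  attributesOf : Conjunction → List (Fin ∣ I ∣ᴬ)
  attributesOf = map proj₁

  record Condition : Set where
    field
      atoms  : Conjunction
      unique : Unique (attributesOf atoms)

  open Condition

  -- Being disjoint and nonempty, I_B and I_H are also proper subsets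
  -- of I.
  record Rule : Set where
    field
      body head : Condition
      body≢∅    : attributesOf (atoms body) ≢ []
      head≢∅    : attributesOf (atoms head) ≢ []
      disjoint  : Disjoint (attributesOf (atoms body)) (attributesOf (atoms head))

open Condition public
open Rule public

module _ {I : AttributeSet} where

  SatisfiesAtom : Tuple I → Atomic I → Set
  SatisfiesAtom t (i , a) = FulfilsValue (attribute I i) a (t i)

  satisfiesAtom? : ∀ t a → Dec (SatisfiesAtom t a)
  satisfiesAtom? t (i , a) = fulfilsValue? (attribute I i) a (t i)

  Satisfies : Tuple I → Conjunction I → Set
  Satisfies t C = All (SatisfiesAtom t) C

  satisfies? : ∀ C t → Dec (Satisfies t C)
  satisfies? C t = all? (satisfiesAtom? t) C

  -- T ⟦ C ⟧ is T_C.
  _⟦_⟧ : Database I → Conjunction I → Database I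
  T ⟦ C ⟧ = filter (satisfies? C) T

  -- B ∧ H
  conjunction : Rule I → Conjunction I
  conjunction R = atoms (body R) ++ atoms (head R)

  ruleSize : Rule I → ℕ
  ruleSize R = length (atoms (body R)) + length (atoms (head R))

  Trivial : Rule I → Database I → Set
  Trivial R T = Any (λ a → T ⟦ [ a ] ⟧ ↭ T) (conjunction R)

Index : Set₁
Index = ∀ {I} → Rule I → Database I → ℚ

-- The value 0 for the empty database stands for 0/0 and is immaterial:
-- every rule is trivial with respect to the empty database.
sup : Index
sup     R []         = 0ℚ
sup {I} R T@(_ ∷ T′) = + length (_⟦_⟧ {I} T (conjunction R)) /ℚ suc (length T′)

-- The question ⟨ I , T , ρ , k , s ⟩.
⟨_,_,_,_,_⟩ : (I : AttributeSet) → Database I → Index → ℕ → ℚ → Set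
⟨ I , T , ρ , k , s ⟩ =
  Σ (Rule I) λ R → ¬ Trivial R T × k ≤ ruleSize R × s ≤ℚ ρ R T

------------------------------------------------------------------------
-- Deterministic logarithmic space

Finite : Set → Set
Finite A = ∃[ n ] (A ↔ Fin n)

data Move : Set where
  left stay right : Move

-- The finitely many cells of a tape in use: those to the left of the
-- scanned cell (nearest first), the scanned cell, those to its right.
record Tape (A : Set) : Set where
  constructor tape
  field
    before : List A
    scan   : A
    after  : List A

open Tape public

-- The input tape is delimited by end markers, which the head cannot pass.
data InputCell (A : Set) : Set where
  ⊢ ⊣ : InputCell A
  sym : A → InputCell A

inputTape : ∀ {A} → List A → Tape (InputCell A)
inputTape w = tape [] ⊢ (map sym w ++ [ ⊣ ])

moveInput : ∀ {A} → Move → Tape A → Tape A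
moveInput left  (tape (x ∷ l) y r) = tape l x (y ∷ r)
moveInput right (tape l x (y ∷ r)) = tape (x ∷ l) y r
moveInput _     t                  = t

-- A work tape is infinite in both directions: a blank cell is appended
-- whenever the head leaves the portion visited so far.
moveWork : ∀ {A} → A → Move → Tape A → Tape A
moveWork _ left  (tape (x ∷ l) y r) = tape l x (y ∷ r)
moveWork b left  (tape [] y r)      = tape [] b (y ∷ r)
moveWork _ stay  t                  = t
moveWork _ right (tape l x (y ∷ r)) = tape (x ∷ l) y r
moveWork b right (tape l x [])      = tape (x ∷ l) b []

write : ∀ {A} → A → Tape A → Tape A
write x t = record t { scan = x }

visited : ∀ {A} → Tape A → ℕ
visited t = suc (length (before t) + length (after t))

data Action (Q Γ : Set) (m : ℕ) : Set where
  halt : (accept : Bool) → Action Q Γ m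
  go   : (next : Q) (input : Move) (work : Vec (Γ × Move) m) → Action Q Γ m

-- A deterministic Turing machine with a read-only two-way input tape
-- over A and finitely many work tapes.
record Machine (A : Set) : Set₁ where
  field
    State Symbolʷ : Set
    finiteState   : Finite State
    finiteSymbolʷ : Finite Symbolʷ
    blank         : Symbolʷ
    workTapes     : ℕ
    start         : State
    δ             : State → InputCell A → Vec Symbolʷ workTapes →
                    Action State Symbolʷ workTapes

module _ {A : Set} (M : Machine A) where
  open Machine M

  record Configuration : Set where
    constructor config
    field
      state : State
      input : Tape (InputCell A)
      work  : Vec (Tape Symbolʷ) workTapes

  open Configuration

  initial : List A → Configuration
  initial w = config start (inputTape w) (Vec.replicate workTapes (tape [] blank []))

  action : Configuration → Action State Symbolʷ workTapes
  action c = δ (state c) (scan (input c)) (Vec.map scan (work c))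

  apply : Configuration → State → Move → Vec (Symbolʷ × Move) workTapes → Configuration
  apply c q d ws = config q (moveInput d (input c))
    (Vec.zipWith (λ (x , e) → moveWork blank e ∘ write x) ws (work c))

  -- The input tape is not counted.
  space : Configuration → ℕ
  space c = Vec.sum (Vec.map visited (work c))

  -- Halts s c b : the computation from c halts with answer b, every
  -- configuration on the way using space at most s.
  data Halts (s : ℕ) (c : Configuration) (b : Bool) : Set where
    stop : space c ≤ s → action c ≡ halt b → Halts s c b
    step : ∀ {q d ws} → space c ≤ s → action c ≡ go q d ws →
           Halts s (apply c q d ws) b → Halts s c b

-- The problem P on the class X of inputs, presented to the machine
-- through `encode` over a finite alphabet, is in L.  Words that encode
-- no element of X are not constrained.
InL : ∀ {a p} {A : Set} {X : Set a} → Finite A → (X → List A) → (X → Set p) →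
      Set (lsuc 0ℓ ⊔ˡ a ⊔ˡ p)
InL {A = A} _ encode P =
  Σ (Machine A) λ M → ∃[ f ] (f ∈O[log] ×
    (∀ x → ∃[ b ] (Halts M (f (length (encode x))) (initial M (encode x)) b ×
                   (b ≡ true ⇔ P x))))

------------------------------------------------------------------------
-- Inputs and their encoding

record Input {ℓ} (S : Family ℓ) : Set (lsuc 0ℓ ⊔ˡ ℓ) where
  field
    T   : BooleanDatabase
    T∈S : T ∈ S
    k   : ℕ
    1≤k : 1 ≤ k
    k≤∣I∣ : k ≤ ∣ attributes T ∣ᴬ
    s   : ℚ
    0<s : 0ℚ <ℚ s
    s≤1 : s ≤ℚ 1ℚ

-- `attr`, `tuple`, `cell` and `param` open an attribute declaration, a
-- tuple, an entry of a tuple and one of the parameters k, s.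
data Symbol : Set where
  bit0 bit1 plus minus over null : Symbol
  cat num attr tuple cell param : Symbol

finiteSymbol : Finite Symbol
finiteSymbol = 12 , mk↔ₛ′ to from (toWitness {a? = Fin.all? λ i → to (from i) Fin.≟ i} _) from∘to
  where
  to : Symbol → Fin 12
  to bit0  = # 0
  to bit1  = # 1
  to plus  = # 2
  to minus = # 3
  to over  = # 4
  to null  = # 5
  to cat   = # 6
  to num   = # 7
  to attr  = # 8
  to tuple = # 9
  to cell  = # 10
  to param = # 11

  from : Fin 12 → Symbol
  from = Vec.lookup (bit0 Vec.∷ bit1 Vec.∷ plus Vec.∷ minus Vec.∷ over Vec.∷ null Vec.∷
                     cat Vec.∷ num Vec.∷ attr Vec.∷ tuple Vec.∷ cell Vec.∷ param Vec.∷ Vec.[])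

  from∘to : ∀ x → from (to x) ≡ x
  from∘to bit0  = refl
  from∘to bit1  = refl
  from∘to plus  = refl
  from∘to minus = refl
  from∘to over  = refl
  from∘to null  = refl
  from∘to cat   = refl
  from∘to num   = refl
  from∘to attr  = refl
  from∘to tuple = refl
  from∘to cell  = refl
  from∘to param = refl

encodeWord : Word → List Symbol
encodeWord = map (λ b → if b then bit1 else bit0)

encodeBit : Bit → Symbol
encodeBit zero    = bit0
encodeBit (suc _) = bit1

-- Binary, least significant digit first.
encodeℕ : ℕ → List Symbol
encodeℕ n = map encodeBit (proj₁ (toDigits 2 n))

encodeℤ : ℤ → List Symbol
encodeℤ (+ n)      = plus ∷ encodeℕ n
encodeℤ (-[1+ n ]) = minus ∷ encodeℕ (suc n)

encodeℚ : ℚ → List Symbol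
encodeℚ q = encodeℤ (↥ q) ++ over ∷ encodeℕ (↧ₙ q)

encodeKind : Kind → Symbol
encodeKind categorical = cat
encodeKind numeric     = num

encodeConstant : ∀ κ → Constant κ → List Symbol
encodeConstant categorical = encodeWord
encodeConstant numeric     = encodeℚ

-- A boolean attribute is given by its name, its kind and c(A).
encodeAttribute : ∀ A → IsBoolean A → List Symbol
encodeAttribute A (c , _) =
  attr ∷ encodeWord (name A) ++ encodeKind (kind A) ∷ encodeConstant (kind A) c

encodeValue : ∀ A → Value A → List Symbol
encodeValue A nothing        = [ null ]
encodeValue A (just (v , _)) = encodeConstant (kind A) v

encodeTuple : ∀ I → Tuple I → List Symbol
encodeTuple I t = tuple ∷ concatMap (λ i → cell ∷ encodeValue (attribute I i) (t i)) (allFin ∣ I ∣ᴬ)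

encodeDatabase : BooleanDatabase → List Symbol
encodeDatabase T =
  concatMap (λ i → encodeAttribute (attribute (attributes T) i) (boolean T i))
            (allFin ∣ attributes T ∣ᴬ)
  ++ concatMap (encodeTuple (attributes T)) (tuples T)

encodeInput : ∀ {ℓ} {S : Family ℓ} → Input S → List Symbol
encodeInput x = encodeDatabase T ++ param ∷ encodeℕ k ++ param ∷ encodeℚ s
  where open Input x

{-# OPTIONS --safe #-}

-- A rule of positive support can only use conditions that hold exactly of
-- the non-null values, so it amounts to the set W of its attributes: there
-- is a solution iff some W with at least max(k, 2) attributes, each of them
-- null in some tuple, is contained in sufficiently many tuples.  Such a W
-- consists of non-null attributes of one tuple, which number O(log |I|) in
-- a sparse family; hence it can be coded, relative to that tuple, by a
-- number m polynomial in |I|, and it suffices to search through all tuples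
-- and all m.
--
-- To carry the search out on a Turing machine, it is written as a term of a
-- small functional language in which recursion is bounded so that all
-- values are polynomial in the length of the input.  Terms are compiled to
-- programs on counters, and counters are kept in binary on work tapes.  As
-- time is of no concern, everything is recomputed from the input whenever
-- it is needed.
module Submission where

open import Defs renaming (sym to letter)
open import Data.Bool using (Bool; true; false; if_then_else_; not; _∧_; T?)
open import Data.Bool.Properties as Bool using (∧-zeroʳ; ∧-identityʳ; not-involutive; T-≡)
open import Data.Empty using (⊥-elim)
open import Data.Digit using (Bit; Expansion; toDigits; fromDigits)
open import Data.Fin as Fin using (Fin; zero; suc; toℕ; fromℕ<; _↑ʳ_; #_)
open import Data.Fin.Properties as Fin using (+↔⊎; toℕ<n; toℕ-fromℕ<; toℕ-injective)
import Data.Integer as ℤ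
import Data.Integer.Properties as ℤ
open import Data.List as List using (List; []; _∷_; length; _++_; _ʳ++_; replicate; filter; map; concatMap; allFin; tabulate)
open import Data.List.Extrema.Nat using (xs≤max)
open import Data.List.Membership.Propositional using (_∈_; lose; find)
open import Data.List.Membership.Propositional.Properties using (∈-map⁺; ∈-map⁻; ∈-filter⁻; ∈-lookup)
open import Data.List.Properties using (length-++; length-map; length-replicate; length-tabulate; ++-assoc; ++-identityʳ; map-++; map-∘; map-id; filter-all; filter-notAll; tabulate-lookup)
open import Data.List.Relation.Binary.Permutation.Propositional using (_↭_; ↭-reflexive)
open import Data.List.Relation.Binary.Permutation.Propositional.Properties using (↭-length)
open import Data.List.Relation.Unary.All as All using (All; []; _∷_)
import Data.List.Relation.Unary.All.Properties as All
open import Data.List.Relation.Unary.AllPairs using ([]; _∷_)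
open import Data.List.Relation.Unary.Any as Any using (Any; here)
import Data.List.Relation.Unary.Any.Properties as Any
open import Data.List.Relation.Unary.Unique.Propositional using (Unique)
import Data.List.Relation.Unary.Unique.Propositional.Properties as Unique
open import Data.Maybe using (Maybe; just; nothing; is-just)
open import Data.Nat using (ℕ; zero; suc; pred; _+_; _*_; _^_; _∸_; _⊓_; ⌊_/2⌋; ⌈_/2⌉; _≤_; _<_; _≤ᵇ_; _<ᵇ_; _≤?_; z≤n; s≤s; NonZero; >-nonZero)
open import Data.Nat.Induction using (<-rec)
open import Data.Nat.Logarithm using (⌊log₂_⌋; ⌊log₂⌋-mono-≤; ⌊log₂[2^n]⌋≡n; ⌊log₂⌊n/2⌋⌋≡⌊log₂n⌋∸1)
open import Data.Nat.Properties
open import Data.Nat.Tactic.RingSolver using (solve-∀)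
open import Data.Product using (Σ; ∃-syntax; _×_; _,_; proj₁; proj₂)
open import Data.Rational using (ℚ; mkℚ; 0ℚ; ↥_; ↧ₙ_; *<*) renaming (_≤_ to _≤ℚ_; _<_ to _<ℚ_; _/_ to _/ℚ_)
import Data.Rational.Properties as ℚ
import Data.Rational.Unnormalised as ℚᵘ
import Data.Rational.Unnormalised.Properties as ℚᵘ
open import Data.Sum using (_⊎_; inj₁; inj₂)
open import Data.Sum.Function.Propositional using (_⊎-↔_)
open import Data.Unit using (⊤; tt)
open import Data.Vec as Vec using (Vec; []; _∷_; _[_]≔_)
open import Data.Vec.Properties as Vec using (updateAt-updateAt; lookup∘update; []≔-lookup; lookup-map)
open import Data.Vec.Relation.Binary.Pointwise.Inductive as Pointwise using (Pointwise; []; _∷_)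
open import Data.Vec.Relation.Unary.All as VAll using ([]; _∷_)
open import Data.Vec.Relation.Unary.All.Properties using (lookup⁺)
open import Function using (_∘_; id; _⇔_; mk⇔; mk↔ₛ′; Equivalence)
open import Function.Construct.Composition using (_⇔-∘_; _↔-∘_)
open import Function.Construct.Symmetry using (⇔-sym; ↔-sym)
open import Relation.Binary.PropositionalEquality
open import Relation.Nullary using (¬_; yes; no; does; contradiction)
open import Relation.Nullary.Decidable using (dec-true; dec-false; does-⇔)
open import Relation.Unary using (Decidable)

-- Structured programs for Turing machines

-- A boolean domain has a single non-null value, so an atomic condition cannot tell the non-null
-- entries of its column apart: if it holds of one, it holds of all, and then it is trivial as soon
-- as the column has no null. Positive support provides the one entry of which it holds. The bound 2
-- on the number of attributes reflects that body and head are both nonempty; how the attributes are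
-- divided between them is immaterial.
--
-- The obstacle is the threshold. The numerator and denominator of s may be exponential in the
-- length of the input and so fit into no counter. The inequality between |T| times the numerator
-- and the support times the denominator is therefore decided digit by digit: the digits are read
-- off the input, and only a carry of at most |T| plus the support is stored. The same comparison
-- serves for k, which is likewise given in binary.
--
-- One machine serves the whole family: the constants hidden in the O(log |I|) become the constants
-- of the polynomial that limits the code m.

data Cell : Set where
  blank one two : Cell

finite-⊤ : Finite ⊤
finite-⊤ = 1 , mk↔ₛ′ (λ _ → zero) (λ _ → tt) (λ { zero → refl }) (λ _ → refl)

finite-⊎ : ∀ {A B} → Finite A → Finite B → Finite (A ⊎ B)
finite-⊎ (m , f) (n , g) = m + n , ↔-sym +↔⊎ ↔-∘ (f ⊎-↔ g)

finiteCell : Finite Cell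
finiteCell = 3 , mk↔ₛ′ to from
  (λ { zero → refl ; (suc zero) → refl ; (suc (suc zero)) → refl })
  (λ { blank → refl ; one → refl ; two → refl })
  where
  to : Cell → Fin 3
  to blank = zero
  to one   = suc zero
  to two   = suc (suc zero)

  from : Fin 3 → Cell
  from zero             = blank
  from (suc zero)       = one
  from (suc (suc zero)) = two

CellAction : Set
CellAction = Cell → Cell × Move

onCell : CellAction → Tape Cell → Tape Cell
onCell g t = moveWork blank (proj₂ (g (scan t))) (write (proj₁ (g (scan t))) t)

module Programs (A : Set) (m : ℕ) where

  Test : Set
  Test = InputCell A → Vec Cell m → Bool

  infixr 5 _⨾_

  data Code : Set where
    onTape  : Fin m → CellAction → Code
    onInput : Move → Code
    _⨾_     : Code → Code → Code
    ifte    : Test → Code → Code → Code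
    while   : Test → Code → Code

  -- A sequence has no control point of its own, since its first part exits directly into the entry
  -- of the second; a test needs one, as it takes a transition.
  Pos : Code → Set
  Pos (onTape _ _) = ⊤
  Pos (onInput _)  = ⊤
  Pos (p ⨾ q)      = Pos p ⊎ Pos q
  Pos (ifte _ p q) = ⊤ ⊎ (Pos p ⊎ Pos q)
  Pos (while _ p)  = ⊤ ⊎ Pos p

  finitePos : ∀ p → Finite (Pos p)
  finitePos (onTape _ _) = finite-⊤
  finitePos (onInput _)  = finite-⊤
  finitePos (p ⨾ q)      = finite-⊎ (finitePos p) (finitePos q)
  finitePos (ifte _ p q) = finite-⊎ finite-⊤ (finite-⊎ (finitePos p) (finitePos q))
  finitePos (while _ p)  = finite-⊎ finite-⊤ (finitePos p)

  entry : ∀ p → Pos p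
  entry (onTape _ _) = tt
  entry (onInput _)  = tt
  entry (p ⨾ q)      = inj₁ (entry p)
  entry (ifte _ p q) = inj₁ tt
  entry (while _ p)  = inj₁ tt

  keep : Vec Cell m → Vec (Cell × Move) m
  keep = Vec.map (_, stay)

  module _ {Q : Set} where

    -- The transitions of p inside a machine with states Q, where `emb`
    -- places the control points of p and `exit` is entered after p.
    transition : ∀ p → (exit : Q) (emb : Pos p → Q) → Pos p →
                 InputCell A → Vec Cell m → Action Q Cell m
    transition (onTape i g) exit emb _ a xs = go exit stay (Vec.updateAt (keep xs) i (g ∘ proj₁))
    transition (onInput d)  exit emb _ a xs = go exit d (keep xs)
    transition (p ⨾ q) exit emb (inj₁ x) = transition p (emb (inj₂ (entry q))) (emb ∘ inj₁) x
    transition (p ⨾ q) exit emb (inj₂ y) = transition q exit (emb ∘ inj₂) y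
    transition (ifte b p q) exit emb (inj₁ _) a xs =
      go (if b a xs then emb (inj₂ (inj₁ (entry p))) else emb (inj₂ (inj₂ (entry q)))) stay (keep xs)
    transition (ifte b p q) exit emb (inj₂ (inj₁ x)) = transition p exit (emb ∘ inj₂ ∘ inj₁) x
    transition (ifte b p q) exit emb (inj₂ (inj₂ y)) = transition q exit (emb ∘ inj₂ ∘ inj₂) y
    transition (while b p) exit emb (inj₁ _) a xs =
      go (if b a xs then emb (inj₂ (entry p)) else exit) stay (keep xs)
    transition (while b p) exit emb (inj₂ x) = transition p (emb (inj₁ tt)) (emb ∘ inj₂) x

  Tapes : Set
  Tapes = Tape (InputCell A) × Vec (Tape Cell) m

  test : Test → Tapes → Bool
  test b (x , ts) = b (scan x) (Vec.map scan ts)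

  module _ (p : Code) (verdict : Vec Cell m → Bool) where

    -- The one state added to the control points is the exit of the program, where the machine halts
    -- with an answer read off the scanned work cells.
    machine : Machine A
    machine = record
      { State         = ⊤ ⊎ Pos p
      ; Symbolʷ       = Cell
      ; finiteState   = finite-⊎ finite-⊤ (finitePos p)
      ; finiteSymbolʷ = finiteCell
      ; blank         = blank
      ; workTapes     = m
      ; start         = inj₂ (entry p)
      ; δ             = λ { (inj₁ _) a xs → halt (verdict xs)
                          ; (inj₂ x) a xs → transition p (inj₁ tt) inj₂ x a xs }
      }

  module Semantics (K : ℕ) where

    Ok : Tapes → Set
    Ok (_ , ts) = VAll.All (λ t → visited t ≤ K) ts

    -- Derivations are finite, so one also witnesses termination. `Ok` is demanded wherever a
    -- transition is taken, which leaves only the final configuration to be checked separately.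
    data Run : Code → Tapes → Tapes → Set where
      onTape  : ∀ {i g x ts} → Ok (x , ts) →
                Run (onTape i g) (x , ts) (x , Vec.updateAt ts i (onCell g))
      onInput : ∀ {d x ts} → Ok (x , ts) → Run (onInput d) (x , ts) (moveInput d x , ts)
      _⨾_     : ∀ {p q c c₁ c₂} → Run p c c₁ → Run q c₁ c₂ → Run (p ⨾ q) c c₂
      ifT     : ∀ {b p q c c₁} → Ok c → test b c ≡ true → Run p c c₁ → Run (ifte b p q) c c₁
      ifF     : ∀ {b p q c c₁} → Ok c → test b c ≡ false → Run q c c₁ → Run (ifte b p q) c c₁
      whileT  : ∀ {b p c c₁ c₂} → Ok c → test b c ≡ true → Run p c c₁ →
                Run (while b p) c₁ c₂ → Run (while b p) c c₂
      whileF  : ∀ {b p c} → Ok c → test b c ≡ false → Run (while b p) c c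

    private
      act : Cell × Move → Tape Cell → Tape Cell
      act = λ (x , e) → moveWork blank e ∘ write x

      act-keep : ∀ {n} (ts : Vec (Tape Cell) n) →
                 Vec.zipWith act (Vec.map (_, stay) (Vec.map scan ts)) ts ≡ ts
      act-keep []       = refl
      act-keep (t ∷ ts) = cong (t ∷_) (act-keep ts)

      act-update : ∀ {n} (ts : Vec (Tape Cell) n) i g →
        Vec.zipWith act (Vec.updateAt (Vec.map (_, stay) (Vec.map scan ts)) i (g ∘ proj₁)) ts
          ≡ Vec.updateAt ts i (onCell g)
      act-update (t ∷ ts) zero    g = cong (onCell g t ∷_) (act-keep ts)
      act-update (t ∷ ts) (suc i) g = cong (t ∷_) (act-update ts i g)

    sum-visited : ∀ {n} {ts : Vec (Tape Cell) n} → VAll.All (λ t → visited t ≤ K) ts →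
                  Vec.sum (Vec.map visited ts) ≤ n * K
    sum-visited []       = ≤-refl
    sum-visited (p ∷ ps) = +-mono-≤ p (sum-visited ps)

    module _ (p : Code) (verdict : Vec Cell m → Bool) where

      private
        Q : Set
        Q = ⊤ ⊎ Pos p

        conf : Q → Tapes → Configuration (machine p verdict)
        conf q (x , ts) = config q x ts

        δ′ : Q → InputCell A → Vec Cell m → Action Q Cell m
        δ′ = Machine.δ (machine p verdict)

        Halting : Configuration (machine p verdict) → Bool → Set
        Halting = Halts (machine p verdict) (m * K)

        move : ∀ {q q′ c d ws b} → Ok c →
               δ′ q (scan (proj₁ c)) (Vec.map scan (proj₂ c)) ≡ go q′ d ws →
               ∀ {c′} → Vec.zipWith act ws (proj₂ c) ≡ proj₂ c′ → moveInput d (proj₁ c) ≡ proj₁ c′ →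
               Halting (conf q′ c′) b → Halting (conf q c) b
        move ok e refl refl h = step (sum-visited ok) e h

        -- In continuation style: the run of `r` is put in front of a halting computation that
        -- starts at its exit. Asking only that `δ′` agree with `transition r` on the image of `emb`
        -- allows the induction to descend into subprograms.
        simulate : ∀ r {exit emb c c′ b} → Run r c c′ →
                   (∀ x a xs → δ′ (emb x) a xs ≡ transition r exit emb x a xs) →
                   Halting (conf exit c′) b → Halting (conf (emb (entry r)) c) b
        simulate (onTape i g) (onTape {ts = ts} ok) ag h = move ok (ag _ _ _) (act-update ts i g) refl h
        simulate (onInput d) (onInput {ts = ts} ok) ag h = move ok (ag _ _ _) (act-keep ts) refl h
        simulate (r ⨾ r′) (R ⨾ R′) ag h =
          simulate r R (λ x → ag (inj₁ x)) (simulate r′ R′ (λ x → ag (inj₂ x)) h)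
        simulate (ifte t r r′) {exit} {emb} {c} (ifT ok e R) ag h =
          move ok (trans (ag (inj₁ tt) _ _) (cong (λ z → go (if z then _ else _) stay _) e))
            (act-keep (proj₂ c)) refl
            (simulate r {exit} {emb ∘ inj₂ ∘ inj₁} R (λ x → ag (inj₂ (inj₁ x))) h)
        simulate (ifte t r r′) {exit} {emb} {c} (ifF ok e R) ag h =
          move ok (trans (ag (inj₁ tt) _ _) (cong (λ z → go (if z then _ else _) stay _) e))
            (act-keep (proj₂ c)) refl
            (simulate r′ {exit} {emb ∘ inj₂ ∘ inj₂} R (λ x → ag (inj₂ (inj₂ x))) h)
        simulate (while t r) {exit} {emb} {c} (whileT ok e R R′) ag h =
          move ok (trans (ag (inj₁ tt) _ _) (cong (λ z → go (if z then _ else _) stay _) e))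
            (act-keep (proj₂ c)) refl
            (simulate r {emb (inj₁ tt)} {emb ∘ inj₂} R (λ x → ag (inj₂ x)) (simulate (while t r) {exit} {emb} R′ ag h))
        simulate (while t r) {exit} {emb} {c} (whileF ok e) ag h =
          move ok (trans (ag (inj₁ tt) _ _) (cong (λ z → go (if z then _ else _) stay _) e))
            (act-keep (proj₂ c)) refl h

      machine-halts : ∀ {w x ts} → Run p (inputTape w , Vec.replicate m (tape [] blank [])) (x , ts) →
                      Ok (x , ts) →
                      Halts (machine p verdict) (m * K) (initial (machine p verdict) w) (verdict (Vec.map scan ts))
      machine-halts R ok =
        simulate p {inj₁ tt} {inj₂} R (λ _ _ _ → refl) (stop (sum-visited ok) refl)

-- Binary counters on work tapes

-- Bijective base 2, least significant digit first: false stands for the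
-- digit 1 and true for the digit 2.  Zero is the empty numeral, so a
-- counter is tested for zero by looking at one cell.
incr : List Bool → List Bool
incr []           = false ∷ []
incr (false ∷ ds) = true ∷ ds
incr (true ∷ ds)  = false ∷ incr ds

decr : List Bool → List Bool
decr []               = []
decr (true ∷ ds)      = false ∷ ds
decr (false ∷ [])     = []
decr (false ∷ d ∷ ds) = true ∷ decr (d ∷ ds)

numeral : ℕ → List Bool
numeral zero    = []
numeral (suc n) = incr (numeral n)

decr-incr : ∀ ds → decr (incr ds) ≡ ds
decr-incr []                  = refl
decr-incr (false ∷ ds)        = refl
decr-incr (true ∷ [])         = refl
decr-incr (true ∷ false ∷ ds) = refl
decr-incr (true ∷ true ∷ ds)  = cong (true ∷_) (decr-incr (true ∷ ds))

incr≢[] : ∀ ds → incr ds ≢ []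
incr≢[] []           ()
incr≢[] (false ∷ ds) ()
incr≢[] (true ∷ ds)  ()

value : List Bool → ℕ
value []           = 0
value (false ∷ ds) = 1 + (value ds + value ds)
value (true ∷ ds)  = 2 + (value ds + value ds)

value-incr : ∀ ds → value (incr ds) ≡ suc (value ds)
value-incr []           = refl
value-incr (false ∷ ds) = refl
value-incr (true ∷ ds) rewrite value-incr ds = cong (2 +_) (+-suc (value ds) (value ds))

value-numeral : ∀ n → value (numeral n) ≡ n
value-numeral zero    = refl
value-numeral (suc n) = trans (value-incr (numeral n)) (cong suc (value-numeral n))

-- Every digit is at least 1, so a numeral of length n is worth at least 1 + 2 + ... + 2^(n-1).
2^length≤ : ∀ ds → 2 ^ length ds ≤ suc (value ds)
2^length≤ [] = ≤-refl
2^length≤ (d ∷ ds) = ≤-trans double (digit d)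
  where
  double : 2 ^ suc (length ds) ≤ 2 + (value ds + value ds)
  double = ≤-trans (≤-reflexive (cong (2 ^ length ds +_) (+-identityʳ _)))
    (≤-trans (+-mono-≤ (2^length≤ ds) (2^length≤ ds)) (≤-reflexive (cong suc (+-suc _ _))))

  digit : ∀ d → 2 + (value ds + value ds) ≤ suc (value (d ∷ ds))
  digit false = ≤-refl
  digit true  = n≤1+n _

2^length-numeral≤ : ∀ n → 2 ^ length (numeral n) ≤ suc n
2^length-numeral≤ n = subst (λ v → 2 ^ length (numeral n) ≤ suc v) (value-numeral n) (2^length≤ (numeral n))

digit : Bool → Cell
digit false = one
digit true  = two

digits : List Bool → List Cell
digits = List.map digit

-- When nothing remains to the right, the head still scans a cell: the blank that the last move
-- appended.
at : List Cell → List Cell → Tape Cell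
at l []       = tape l blank []
at l (x ∷ xs) = tape l x xs

isOne isTwo isDigit : Cell → Bool
isOne one = true
isOne _   = false
isTwo two = true
isTwo _   = false
isDigit blank = false
isDigit _     = true

bump : Cell → Cell
bump one = two
bump _   = one

-- What lies to the left of a numeral: nothing on a fresh tape, and one blank once the head has
-- stepped off the first digit. `rewind` stops at this blank.
data Margin : List Cell → Set where
  untouched : Margin []
  touched   : Margin (blank ∷ [])

leave-margin : ∀ {l y xs} → Margin l → moveWork blank left (at l (y ∷ xs)) ≡ at [] (blank ∷ y ∷ xs)
leave-margin untouched = refl
leave-margin touched   = refl

blanks : ℕ → List Cell
blanks j = replicate j blank

module CounterCode (A : Set) (m : ℕ) where

  open Programs A m public

  scanned : Fin m → (Cell → Bool) → Test
  scanned i b _ cs = b (Vec.lookup cs i)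

  rewind : Fin m → Code
  rewind i = while (scanned i isDigit) (onTape i (_, left)) ⨾ onTape i (_, right)

  -- Digits 2 become 1 up to the first digit 1 or the blank behind the numeral; `bump` produces the
  -- right digit in both cases.
  Inc : Fin m → Code
  Inc i = while (scanned i isTwo) (onTape i λ _ → one , right)
        ⨾ onTape i (λ x → bump x , stay)
        ⨾ onTape i (_, left)
        ⨾ rewind i

  -- Digits 1 become 2 on the way to the first digit 2.  If there is none,
  -- the last of them disappears.
  Dec : Fin m → Code
  Dec i = while (scanned i isOne) (onTape i λ _ → two , right)
        ⨾ ifte (scanned i isTwo) (onTape i λ _ → one , left)
            (onTape i (_, left) ⨾ onTape i λ _ → blank , left)
        ⨾ rewind i

  While : Fin m → Code → Code
  While i p = while (scanned i isDigit) p

  If : Fin m → Code → Code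
  If i p = ifte (scanned i isDigit) p (onInput stay)

module Counters (A : Set) (m L : ℕ) where

  open CounterCode A m
  -- Decrementing to a shorter numeral may touch one blank cell beyond it.
  open Semantics (3 + L) public

  looping : ∀ {b p q c c₁ c₂} → Ok c → test b c ≡ true → Run p c c₁ →
            Run (while b p ⨾ q) c₁ c₂ → Run (while b p ⨾ q) c c₂
  looping ok e r (s ⨾ t) = whileT ok e r s ⨾ t

  -- Blanks left behind by longer numerals remain part of the visited tape, so the invariant bounds
  -- numeral and padding together. Keeping the numeral itself within `L` spares the one cell that a
  -- decrement may still visit.
  record Counter (n : ℕ) (t : Tape Cell) : Set where
    constructor counter
    field
      {margin}  : List Cell
      isMargin  : Margin margin
      {padding} : ℕ
      shape     : t ≡ at margin (digits (numeral n) ++ blanks padding)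
      short     : length (numeral n) ≤ L
      extent    : length (numeral n) + padding ≤ suc L

  Counters : Vec ℕ m → Vec (Tape Cell) m → Set
  Counters = Pointwise Counter

  visited-at : ∀ l xs → visited (at l xs) ≤ 1 + (length l + length xs)
  visited-at l []       = ≤-refl
  visited-at l (x ∷ xs) = s≤s (+-monoʳ-≤ (length l) (n≤1+n _))

  length-content : ∀ ds j → length (digits ds ++ blanks j) ≡ length ds + j
  length-content ds j =
    trans (length-++ (digits ds)) (cong₂ _+_ (length-map digit ds) (length-replicate j))

  margin≤1 : ∀ {l} → Margin l → length l ≤ 1
  margin≤1 untouched = z≤n
  margin≤1 touched   = ≤-refl

  counter-visited : ∀ {n t} → Counter n t → visited t ≤ 3 + L
  counter-visited {n} (counter {l} M {j} refl _ ext) =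
    ≤-trans (visited-at l (digits (numeral n) ++ blanks j))
      (s≤s (+-mono-≤ (margin≤1 M) (subst (_≤ suc L) (sym (length-content (numeral n) j)) ext)))

  counters-ok : ∀ {ρ ts} → Counters ρ ts → VAll.All (λ t → visited t ≤ 3 + L) ts
  counters-ok cs = all cs
    where
    all : ∀ {n} {ρ : Vec ℕ n} {ts : Vec (Tape Cell) n} → Pointwise Counter ρ ts → VAll.All (λ t → visited t ≤ 3 + L) ts
    all []       = []
    all (c ∷ cs) = counter-visited c ∷ all cs

  module OneTape (x : Tape (InputCell A)) (ts : Vec (Tape Cell) m) (others : Ok (x , ts)) (i : Fin m)
                 {l : List Cell} (M : Margin l) where

    T : Tape Cell → Tapes
    T t = x , ts [ i ]≔ t

    before-of : List Bool → List Cell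
    before-of zs = digits zs ++ l

    ok : ∀ {t} → visited t ≤ 3 + L → Ok (T t)
    ok p = all ts i others p
      where
      all : ∀ {n} (ts : Vec (Tape Cell) n) i {t} → VAll.All (λ t → visited t ≤ 3 + L) ts →
           visited t ≤ 3 + L → VAll.All (λ t → visited t ≤ 3 + L) (ts [ i ]≔ t)
      all (_ ∷ ts) zero    (_ ∷ ps) p = p ∷ ps
      all (_ ∷ ts) (suc i) (q ∷ ps) p = q ∷ all ts i ps p

    on : ∀ {g t t′} → Ok (T t) → onCell g t ≡ t′ → Run (onTape i g) (T t) (T t′)
    on {g} {t} o refl = subst (λ v → Run (onTape i g) (T t) (x , v)) (updateAt-updateAt i ts) (onTape o)

    tested : ∀ b t → test (scanned i b) (T t) ≡ b (scan t)
    tested b t = cong b (trans (lookup-map i scan (ts [ i ]≔ t)) (cong scan (lookup∘update i ts t)))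

    ok-at : ∀ zs xs → length zs + length xs ≤ suc L → Ok (T (at (before-of zs) xs))
    ok-at zs xs p = ok (≤-trans (visited-at (before-of zs) xs) (s≤s bound))
      where
      bound : length (digits zs ++ l) + length xs ≤ 2 + L
      bound rewrite length-++ (digits zs) {l} | length-map digit zs | +-comm (length zs) (length l)
                  | +-assoc (length l) (length zs) (length xs) = +-mono-≤ (margin≤1 M) p

    -- The starting point of `rewind`: one cell to the left of `xs`, which is the last digit passed
    -- or, if there is none, the blank of the margin.
    leftOf : List Bool → List Cell → Tape Cell
    leftOf []       xs = at [] (blank ∷ xs)
    leftOf (z ∷ zs) xs = at (before-of zs) (digit z ∷ xs)

    ok-leftOf : ∀ zs xs → length zs + length xs ≤ suc L → Ok (T (leftOf zs xs))
    ok-leftOf [] xs p       = ok (≤-trans (visited-at [] (blank ∷ xs)) (s≤s (s≤s p)))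
    ok-leftOf (z ∷ zs) xs p = ok-at zs (digit z ∷ xs) (subst (_≤ suc L) (sym (+-suc (length zs) (length xs))) p)

    moveLeft : ∀ zs y xs → moveWork blank left (at (before-of zs) (y ∷ xs)) ≡ leftOf zs (y ∷ xs)
    moveLeft []       y xs = leave-margin M
    moveLeft (z ∷ zs) y xs = refl

    moveRight : ∀ l y xs → moveWork blank right (at l (y ∷ xs)) ≡ at (y ∷ l) xs
    moveRight l y []       = refl
    moveRight l y (_ ∷ xs) = refl

    rewinds : ∀ zs xs → length zs + length xs ≤ suc L →
              Run (rewind i) (T (leftOf zs xs)) (T (at (blank ∷ []) (digits zs ʳ++ xs)))
    rewinds [] xs p =
      whileF o (tested isDigit (leftOf [] xs)) ⨾ on o (moveRight [] blank xs)
      where o = ok-leftOf [] xs p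
    rewinds (z ∷ zs) xs p =
      looping (ok-leftOf (z ∷ zs) xs p) (trans (tested isDigit (leftOf (z ∷ zs) xs)) (digit-isDigit z))
        (on (ok-leftOf (z ∷ zs) xs p) (moveLeft zs (digit z) xs))
        (rewinds zs (digit z ∷ xs) (subst (_≤ suc L) (sym (+-suc (length zs) (length xs))) p))
      where
      digit-isDigit : ∀ z → isDigit (digit z) ≡ true
      digit-isDigit false = refl
      digit-isDigit true  = refl

    shift : ∀ {a b c} → a + suc b ≤ c → suc a + b ≤ c
    shift {a} {b} {c} = subst (_≤ c) (+-suc a b)

    -- The induction follows the carry, so the head may already have passed the digits `zs`, listed
    -- nearest first; the rewind at the end puts them back, whence `ʳ++`.
    Inc-run : ∀ ds zs j →
      length zs + length (incr ds) ≤ suc L →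
      length zs + (length ds + j) ≤ suc L →
      ∃[ j′ ] length zs + (length (incr ds) + j′) ≤ suc L ×
        Run (Inc i) (T (at (before-of zs) (digits ds ++ blanks j)))
                    (T (at (blank ∷ []) (digits zs ʳ++ (digits (incr ds) ++ blanks j′))))
    Inc-run [] zs zero p q =
      0 , p
      , whileF (ok-at zs [] q) (tested isTwo (at (before-of zs) []))
      ⨾ on (ok-at zs [] q) refl
      ⨾ on (ok-at zs (one ∷ []) p) (moveLeft zs one [])
      ⨾ rewinds zs (one ∷ []) p
    Inc-run [] zs (suc j) p q =
      j , q
      , whileF (ok-at zs _ q′) (tested isTwo (at (before-of zs) (blank ∷ blanks j)))
      ⨾ on (ok-at zs _ q′) refl
      ⨾ on (ok-at zs (one ∷ blanks j) q′) (moveLeft zs one (blanks j))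
      ⨾ rewinds zs (one ∷ blanks j) q′
      where
      q′ : length zs + suc (length (blanks j)) ≤ suc L
      q′ = subst (λ k → length zs + suc k ≤ suc L) (sym (length-replicate j)) q
    Inc-run (false ∷ ds) zs j p q =
      j , q
      , whileF (ok-at zs _ q′) (tested isTwo (at (before-of zs) (one ∷ digits ds ++ blanks j)))
      ⨾ on (ok-at zs _ q′) refl
      ⨾ on (ok-at zs (two ∷ digits ds ++ blanks j) q′) (moveLeft zs two (digits ds ++ blanks j))
      ⨾ rewinds zs (two ∷ digits ds ++ blanks j) q′
      where
      q′ : length zs + suc (length (digits ds ++ blanks j)) ≤ suc L
      q′ = subst (λ k → length zs + suc k ≤ suc L) (sym (length-content ds j)) q
    Inc-run (true ∷ ds) zs j p q with Inc-run ds (false ∷ zs) j (shift p) (shift q)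
    ... | j′ , r , run =
      j′ , subst (_≤ suc L) (sym (+-suc (length zs) _)) r
      , looping (ok-at zs _ q′) (tested isTwo (at (before-of zs) (two ∷ digits ds ++ blanks j)))
          (on (ok-at zs _ q′) (moveRight (before-of zs) one (digits ds ++ blanks j))) run
      where
      q′ : length zs + suc (length (digits ds ++ blanks j)) ≤ suc L
      q′ = subst (λ k → length zs + suc k ≤ suc L) (sym (length-content ds j)) q

    Dec-run : ∀ d ds zs j →
      length zs + suc (length ds) ≤ L →
      length zs + (suc (length ds) + j) ≤ suc L →
      ∃[ j′ ] length zs + (length (decr (d ∷ ds)) + j′) ≤ suc L ×
        Run (Dec i) (T (at (before-of zs) (digits (d ∷ ds) ++ blanks j)))
                    (T (at (blank ∷ []) (digits zs ʳ++ (digits (decr (d ∷ ds)) ++ blanks j′))))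
    Dec-run true ds zs j p q =
      j , q
      , whileF (ok-at zs _ q′) (tested isOne (at (before-of zs) (two ∷ digits ds ++ blanks j)))
      ⨾ ifT (ok-at zs _ q′) (tested isTwo (at (before-of zs) (two ∷ digits ds ++ blanks j)))
          (on (ok-at zs _ q′) (moveLeft zs one (digits ds ++ blanks j)))
      ⨾ rewinds zs (one ∷ digits ds ++ blanks j) q′
      where
      q′ : length zs + suc (length (digits ds ++ blanks j)) ≤ suc L
      q′ = subst (λ k → length zs + suc k ≤ suc L) (sym (length-content ds j)) q
    Dec-run false (d ∷ ds) zs j p q with Dec-run d ds (true ∷ zs) j (shift p) (shift q)
    ... | j′ , r , run =
      j′ , subst (_≤ suc L) (sym (+-suc (length zs) _)) r
      , looping (ok-at zs _ q′) (tested isOne (at (before-of zs) (one ∷ digits (d ∷ ds) ++ blanks j)))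
          (on (ok-at zs _ q′) (moveRight (before-of zs) two (digits (d ∷ ds) ++ blanks j))) run
      where
      q′ : length zs + suc (length (digits (d ∷ ds) ++ blanks j)) ≤ suc L
      q′ = subst (λ k → length zs + suc k ≤ suc L) (sym (length-content (d ∷ ds) j)) q
    Dec-run false [] zs zero p q =
      -- The two blanks are the erased digit and the fresh cell beyond it, which the head had to
      -- visit to find that this digit was the last.
      2 , wide
      , looping (ok-at zs _ q) (tested isOne (at (before-of zs) (one ∷ [])))
          (on (ok-at zs _ q) (moveRight (before-of zs) two []))
          (whileF (ok-at (true ∷ zs) [] (shift q)) (tested isOne (at (before-of (true ∷ zs)) []))
          ⨾ ifF (ok-at (true ∷ zs) [] (shift q)) (tested isTwo (at (before-of (true ∷ zs)) []))
              (on (ok-at (true ∷ zs) [] (shift q)) refl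
              ⨾ on (ok-at zs (two ∷ blank ∷ []) wide) (moveLeft zs blank (blank ∷ [])))
          ⨾ rewinds zs (blanks 2) wide)
      where
      wide : length zs + 2 ≤ suc L
      wide = subst (_≤ suc L) (sym (+-suc (length zs) 1)) (s≤s p)
    Dec-run false [] zs (suc j) p q =
      2 + j , q
      , looping (ok-at zs _ q′) (tested isOne (at (before-of zs) (one ∷ blanks (suc j))))
          (on (ok-at zs _ q′) (moveRight (before-of zs) two (blanks (suc j))))
          (whileF o (tested isOne (at (before-of (true ∷ zs)) (blanks (suc j))))
          ⨾ ifF o (tested isTwo (at (before-of (true ∷ zs)) (blanks (suc j))))
              (on o refl
              ⨾ on (ok-at zs (two ∷ blanks (suc j)) q′) (moveLeft zs blank (blanks (suc j))))
          ⨾ rewinds zs (blanks (2 + j)) q′)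
      where
      q′ : length zs + (2 + length (blanks j)) ≤ suc L
      q′ = subst (λ k → length zs + (2 + k) ≤ suc L) (sym (length-replicate j)) q
      o = ok-at (true ∷ zs) (blanks (suc j)) (shift q′)

  infix 4 _∶_⇒_

  State : Set
  State = Tape (InputCell A) × Vec ℕ m

  -- Margin and padding are hidden: a run may start from any tapes representing the old values and
  -- ends on some tapes representing the new ones.
  _∶_⇒_ : Code → State → State → Set
  p ∶ (x , ρ) ⇒ (x′ , ρ′) =
    ∀ {ts} → Counters ρ ts → ∃[ ts′ ] Counters ρ′ ts′ × Run p (x , ts) (x′ , ts′)

  update : ∀ {n} {ρ : Vec ℕ n} {ts : Vec (Tape Cell) n} {v t} i → Pointwise Counter ρ ts → Counter v t →
           Pointwise Counter (ρ [ i ]≔ v) (ts [ i ]≔ t)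
  update zero    (_ ∷ cs) c = c ∷ cs
  update (suc i) (d ∷ cs) c = d ∷ update i cs c

  unchanged : ∀ {ts : Vec (Tape Cell) m} {i t} → Vec.lookup ts i ≡ t → ts [ i ]≔ t ≡ ts
  unchanged {ts} {i} refl = []≔-lookup ts i

  Inc-rule : ∀ {x ρ} i → length (numeral (suc (Vec.lookup ρ i))) ≤ L →
             Inc i ∶ (x , ρ) ⇒ (x , ρ [ i ]≔ suc (Vec.lookup ρ i))
  Inc-rule {x} {ρ} i fits {ts} cs with Pointwise.lookup cs i
  ... | counter M {j} shape _ ext
    with OneTape.Inc-run x ts (counters-ok cs) i M (numeral (Vec.lookup ρ i)) [] j (m≤n⇒m≤1+n fits) ext
  ... | _ , ext′ , run =
    _ , update i cs (counter touched refl fits ext′)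
      , subst (λ us → Run (Inc i) (x , us) _) (unchanged shape) run

  Dec-rule : ∀ {x ρ n} i → Vec.lookup ρ i ≡ suc n → Dec i ∶ (x , ρ) ⇒ (x , ρ [ i ]≔ n)
  Dec-rule {x} {ρ} {n} i eq {ts} cs with Pointwise.lookup cs i
  ... | c rewrite eq with c
  ... | counter M {j} shape short ext with incr (numeral n) in e
  ... | [] = ⊥-elim (incr≢[] (numeral n) e)
  ... | d ∷ ds with OneTape.Dec-run x ts (counters-ok cs) i M d ds [] j short ext
  ... | j′ , ext′ , run =
    _ , update i cs (counter touched refl short′ (subst (λ es → length es + j′ ≤ suc L) decr≡ ext′))
      , subst₂ (λ us es → Run (Dec i) (x , us) (x , ts [ i ]≔ at (blank ∷ []) (digits es ++ blanks j′)))
          (unchanged shape) decr≡ run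
    where
    decr≡ : decr (d ∷ ds) ≡ numeral n
    decr≡ = trans (cong decr (sym e)) (decr-incr (numeral n))

    decr-≤ : ∀ d ds → length (decr (d ∷ ds)) ≤ suc (length ds)
    decr-≤ true  ds       = ≤-refl
    decr-≤ false []       = z≤n
    decr-≤ false (d ∷ ds) = s≤s (decr-≤ d ds)

    short′ : length (numeral n) ≤ L
    short′ = subst (λ es → length es ≤ L) decr≡ (≤-trans (decr-≤ d ds) short)

  private
    incr-scan : ∀ l ds j → isDigit (scan (at l (digits (incr ds) ++ blanks j))) ≡ true
    incr-scan l []           j = refl
    incr-scan l (false ∷ ds) j = refl
    incr-scan l (true ∷ ds)  j = refl

    counter-scan : ∀ {n t} → Counter n t → isDigit (scan t) ≡ (0 <ᵇ n)
    counter-scan {zero}  (counter M {zero}  refl _ _) = refl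
    counter-scan {zero}  (counter M {suc j} refl _ _) = refl
    counter-scan {suc n} (counter M {j}     refl _ _) = incr-scan _ (numeral n) j

  nonzero-test : ∀ {ρ ts} i → Counters ρ ts →
                 isDigit (Vec.lookup (Vec.map scan ts) i) ≡ (0 <ᵇ Vec.lookup ρ i)
  nonzero-test {ts = ts} i cs = trans (cong isDigit (lookup-map i scan ts)) (counter-scan (Pointwise.lookup cs i))

  seq-rule : ∀ {p q s s₁ s₂} → p ∶ s ⇒ s₁ → q ∶ s₁ ⇒ s₂ → p ⨾ q ∶ s ⇒ s₂
  seq-rule p q cs with p cs
  ... | _ , cs₁ , r with q cs₁
  ... | _ , cs₂ , r′ = _ , cs₂ , r ⨾ r′

  input-rule : ∀ {x ρ} d → onInput d ∶ (x , ρ) ⇒ (moveInput d x , ρ)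
  input-rule d cs = _ , cs , onInput (counters-ok cs)

  while-zero : ∀ {x ρ p} i → Vec.lookup ρ i ≡ 0 → While i p ∶ (x , ρ) ⇒ (x , ρ)
  while-zero i e cs = _ , cs , whileF (counters-ok cs) (trans (nonzero-test i cs) (cong (0 <ᵇ_) e))

  while-suc : ∀ {x ρ n p s₁ s₂} i → Vec.lookup ρ i ≡ suc n →
              p ∶ (x , ρ) ⇒ s₁ → While i p ∶ s₁ ⇒ s₂ → While i p ∶ (x , ρ) ⇒ s₂
  while-suc i e body rest cs with body cs
  ... | _ , cs₁ , r with rest cs₁
  ... | _ , cs₂ , r′ =
    _ , cs₂ , whileT (counters-ok cs) (trans (nonzero-test i cs) (cong (0 <ᵇ_) e)) r r′

  if-zero : ∀ {x ρ p} i → Vec.lookup ρ i ≡ 0 → If i p ∶ (x , ρ) ⇒ (x , ρ)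
  if-zero i e cs =
    _ , cs , ifF (counters-ok cs) (trans (nonzero-test i cs) (cong (0 <ᵇ_) e)) (onInput (counters-ok cs))

  if-suc : ∀ {x ρ n p s} i → Vec.lookup ρ i ≡ suc n → p ∶ (x , ρ) ⇒ s → If i p ∶ (x , ρ) ⇒ s
  if-suc i e body cs with body cs
  ... | _ , cs₁ , r = _ , cs₁ , ifT (counters-ok cs) (trans (nonzero-test i cs) (cong (0 <ᵇ_) e)) r

  scan-loop-stop : ∀ {x ρ p} (b : InputCell A → Bool) → b (scan x) ≡ false →
                   while (λ a _ → b a) p ∶ (x , ρ) ⇒ (x , ρ)
  scan-loop-stop b e cs = _ , cs , whileF (counters-ok cs) e

  scan-loop-step : ∀ {x ρ p s₁ s₂} (b : InputCell A → Bool) → b (scan x) ≡ true → p ∶ (x , ρ) ⇒ s₁ →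
                   while (λ a _ → b a) p ∶ s₁ ⇒ s₂ → while (λ a _ → b a) p ∶ (x , ρ) ⇒ s₂
  scan-loop-step b e body rest cs with body cs
  ... | _ , cs₁ , r with rest cs₁
  ... | _ , cs₂ , r′ = _ , cs₂ , whileT (counters-ok cs) e r r′

  scan-if : ∀ {x ρ p q s} (b : InputCell A → Bool) →
            (if b (scan x) then p else q) ∶ (x , ρ) ⇒ s → ifte (λ a _ → b a) p q ∶ (x , ρ) ⇒ s
  scan-if {x} b body cs with b (scan x) in e
  ... | true  with body cs
  ... | _ , cs₁ , r = _ , cs₁ , ifT (counters-ok cs) e r
  scan-if {x} b body cs | false with body cs
  ... | _ , cs₁ , r = _ , cs₁ , ifF (counters-ok cs) e r

-- A term language with polynomially bounded values

total : ℕ → (ℕ → ℕ) → ℕ → ℕ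
total z f zero    = z
total z f (suc n) = f n + total z f n

capped : ℕ → ℕ → (ℕ → ℕ → ℕ) → ℕ → ℕ
capped b z s zero    = z
capped b z s (suc n) = s n (capped b z s n) ⊓ b

bit : Bool → ℕ
bit b = if b then 1 else 0

module _ {A : Set} where

  -- Position 0 is the left end marker; to the right of the input, every
  -- position holds the right end marker.
  headAt : List A → ℕ → Tape (InputCell A)
  headAt w zero    = inputTape w
  headAt w (suc k) = moveInput right (headAt w k)

  cellAt : List A → ℕ → InputCell A
  cellAt w k = scan (headAt w k)

-- Every value is bounded by a fixed power of the bounds on the variables:
-- `sum` cannot feed its result back, and `rec` is capped.
data Term (A : Set) : ℕ → Set where
  var  : ∀ {n} → Fin n → Term A n
  zero : ∀ {n} → Term A n
  suc  : ∀ {n} → Term A n → Term A n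
  wk   : ∀ {n} → Term A n → Term A (suc n)
  call : ∀ {n k} → Term A k → Vec (Fin n) k → Term A n
  lett : ∀ {n} → Term A n → Term A (suc n) → Term A n
  look : ∀ {n} → (InputCell A → Bool) → Term A n → Term A n
  sum  : ∀ {n} (z a : Term A n) → Term A (suc n) → Term A n
  rec  : ∀ {n} (b a z : Term A n) → Term A (suc (suc n)) → Term A n

module _ {A : Set} where

  eval : ∀ {n} → List A → Term A n → Vec ℕ n → ℕ
  eval w (var i)       vs       = Vec.lookup vs i
  eval w zero          vs       = 0
  eval w (suc t)       vs       = suc (eval w t vs)
  eval w (wk t)        (_ ∷ vs) = eval w t vs
  eval w (call t τ)    vs       = eval w t (Vec.map (Vec.lookup vs) τ)
  eval w (lett a t)    vs       = eval w t (eval w a vs ∷ vs)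
  eval w (look f t)    vs       = bit (f (cellAt w (eval w t vs)))
  eval w (sum z a t)   vs       = total (eval w z vs) (λ i → eval w t (i ∷ vs)) (eval w a vs)
  eval w (rec b a z s) vs       =
    capped (eval w b vs) (eval w z vs) (λ i r → eval w s (r ∷ i ∷ vs)) (eval w a vs)

  -- The exponent for which `eval≤` holds. A body under a binder is evaluated with the bound x
  -- replaced by a power of x, so degrees multiply; the `suc` in that power ensures that the old
  -- variables stay below the new bound.
  deg : ∀ {n} → Term A n → ℕ
  deg (var i)       = 1
  deg zero          = 1
  deg (suc t)       = suc (deg t)
  deg (wk t)        = deg t
  deg (call t τ)    = deg t
  deg (lett a t)    = suc (deg a) * suc (deg t)
  deg (look f t)    = deg t
  deg (sum z a t)   = suc (deg z + (deg a + suc (deg a) * deg t))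
  deg (rec b a z s) = suc (deg a + (deg b + deg z)) * suc (deg s)

-- Polynomial bounds on the values of terms

module Powers {x : ℕ} (2≤x : 2 ≤ x) where

  instance
    x≢0 : NonZero x
    x≢0 = >-nonZero (≤-trans (s≤s z≤n) 2≤x)

  pow-mono : ∀ {a b} → a ≤ b → x ^ a ≤ x ^ b
  pow-mono = ^-monoʳ-≤ x

  1≤pow : ∀ a → 1 ≤ x ^ a
  1≤pow a = pow-mono {0} {a} z≤n

  x≤pow-suc : ∀ a → x ≤ x ^ suc a
  x≤pow-suc a = subst (_≤ x ^ suc a) (*-identityʳ x) (*-monoʳ-≤ x (1≤pow a))

  n≤pow : ∀ {p a b} → p ≤ x ^ a → a ≤ b → p ≤ x ^ b
  n≤pow p q = ≤-trans p (pow-mono q)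

  double≤ : ∀ a → x ^ a + x ^ a ≤ x ^ suc a
  double≤ a = ≤-trans (≤-reflexive (cong (x ^ a +_) (sym (+-identityʳ _)))) (*-monoˡ-≤ (x ^ a) 2≤x)

  plus≤ : ∀ {p q} a b → p ≤ x ^ a → q ≤ x ^ b → p + q ≤ x ^ suc (a + b)
  plus≤ a b p q = ≤-trans
    (+-mono-≤ (n≤pow {a = a} p (m≤m+n a b)) (n≤pow {a = b} q (m≤n+m b a))) (double≤ (a + b))

  times≤ : ∀ {p q} a b → p ≤ x ^ a → q ≤ x ^ b → p * q ≤ x ^ (a + b)
  times≤ a b p q = ≤-trans (*-mono-≤ p q) (≤-reflexive (sym (^-distribˡ-+-* x a b)))

  2≤pow-suc : ∀ a → 2 ≤ x ^ suc a
  2≤pow-suc a = ≤-trans 2≤x (x≤pow-suc a)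

total≤ : ∀ z f M n → (∀ i → i < n → f i ≤ M) → total z f n ≤ z + n * M
total≤ z f M zero    p = m≤m+n z 0
total≤ z f M (suc n) p = ≤-trans
  (+-mono-≤ (p n ≤-refl) (total≤ z f M n λ i q → p i (m≤n⇒m≤1+n q)))
  (≤-reflexive (trans (sym (+-assoc M z _)) (trans (cong (_+ n * M) (+-comm M z)) (+-assoc z M _))))

total-mono : ∀ z f {m n} → m ≤ n → total z f m ≤ total z f n
total-mono z f {n = zero}  z≤n = ≤-refl
total-mono z f {m} {suc n} p with m≤n⇒m<n∨m≡n p
... | inj₂ refl = ≤-refl
... | inj₁ (s≤s q) = ≤-trans (total-mono z f q) (m≤n+m _ (f n))

module _ {A : Set} (w : List A) where

  Below : ∀ {n} → ℕ → Vec ℕ n → Set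
  Below x = VAll.All (_≤ x)

  below-trans : ∀ {n x y} {vs : Vec ℕ n} → x ≤ y → Below x vs → Below y vs
  below-trans p = VAll.map (λ q → ≤-trans q p)

  below-lookup : ∀ {n k x} {vs : Vec ℕ n} (τ : Vec (Fin n) k) → Below x vs → Below x (Vec.map (Vec.lookup vs) τ)
  below-lookup []      vs≤x = []
  below-lookup (i ∷ τ) vs≤x = lookup⁺ vs≤x i ∷ below-lookup τ vs≤x

  eval≤ : ∀ {n} (t : Term A n) {vs x} → 2 ≤ x → Below x vs → eval w t vs ≤ x ^ deg t

  -- A case distinction suffices: before the first round the value is that of `z`, and after any
  -- round the cap alone bounds it, whatever the step does. The exponent also covers `a` so that the
  -- same power bounds the index of the round.
  rec≤ : ∀ {n} (b a z : Term A n) (s : Term A (2 + n)) {vs x} → 2 ≤ x → Below x vs → ∀ i →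
         capped (eval w b vs) (eval w z vs) (λ i r → eval w s (r ∷ i ∷ vs)) i
           ≤ x ^ suc (deg a + (deg b + deg z))
  rec≤ b a z s {vs} {x} 2≤x vs≤x zero =
    n≤pow {a = deg z} (eval≤ z 2≤x vs≤x)
      (m≤n⇒m≤1+n (≤-trans (m≤n+m (deg z) (deg b)) (m≤n+m _ (deg a))))
    where open Powers 2≤x
  rec≤ b a z s {vs} {x} 2≤x vs≤x (suc i) =
    ≤-trans (m⊓n≤n _ (eval w b vs)) (n≤pow {a = deg b} (eval≤ b 2≤x vs≤x)
      (m≤n⇒m≤1+n (≤-trans (m≤m+n (deg b) (deg z)) (m≤n+m _ (deg a)))))
    where open Powers 2≤x

  body≤ : ∀ {n} (a : Term A n) (t : Term A (suc n)) {vs x} → 2 ≤ x → Below x vs → ∀ i → i ≤ eval w a vs →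
          eval w t (i ∷ vs) ≤ x ^ (suc (deg a) * deg t)
  body≤ a t {vs} {x} 2≤x vs≤x i i≤ =
    ≤-trans (eval≤ t (2≤pow-suc (deg a))
      (n≤pow {a = deg a} (≤-trans i≤ (eval≤ a 2≤x vs≤x)) (n≤1+n _) ∷ below-trans (x≤pow-suc (deg a)) vs≤x))
      (≤-reflexive (^-*-assoc x (suc (deg a)) (deg t)))
    where open Powers 2≤x

  eval≤ (var i) 2≤x vs≤x = ≤-trans (lookup⁺ vs≤x i) (≤-reflexive (sym (*-identityʳ _)))
  eval≤ zero 2≤x vs≤x = z≤n
  eval≤ (suc t) 2≤x vs≤x = plus≤ 0 (deg t) ≤-refl (eval≤ t 2≤x vs≤x)
    where open Powers 2≤x
  eval≤ (wk t) {_ ∷ vs} 2≤x (_ ∷ vs≤x) = eval≤ t 2≤x vs≤x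
  eval≤ (call t τ) 2≤x vs≤x = eval≤ t 2≤x (below-lookup τ vs≤x)
  eval≤ (lett a t) 2≤x vs≤x =
    n≤pow {a = suc (deg a) * deg t} (body≤ a t 2≤x vs≤x _ ≤-refl) (*-monoʳ-≤ (suc (deg a)) (n≤1+n (deg t)))
    where open Powers 2≤x
  eval≤ (look f t) {vs} {x} 2≤x vs≤x with f (cellAt w (eval w t vs))
  ... | true  = Powers.1≤pow 2≤x (deg t)
  ... | false = z≤n
  eval≤ (sum z a t) {vs} 2≤x vs≤x =
    ≤-trans (total≤ (eval w z vs) (λ i → eval w t (i ∷ vs)) _ (eval w a vs)
              (λ i i< → body≤ a t 2≤x vs≤x i (<⇒≤ i<)))
      (plus≤ (deg z) (deg a + suc (deg a) * deg t) (eval≤ z 2≤x vs≤x)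
        (times≤ (deg a) (suc (deg a) * deg t) (eval≤ a 2≤x vs≤x) ≤-refl))
    where open Powers 2≤x
  eval≤ (rec b a z s) {vs} 2≤x vs≤x =
    n≤pow {a = suc (deg a + (deg b + deg z))} (rec≤ b a z s 2≤x vs≤x (eval w a vs))
      (≤-trans (≤-reflexive (sym (*-identityʳ _))) (*-monoʳ-≤ (suc (deg a + (deg b + deg z))) (s≤s (z≤n {deg s}))))
    where open Powers 2≤x

-- Compiling terms to counter programs

-- The counters form a stack of height h on top of which e counters are
-- unused; with this form of addition, pushing preserves e ⊕ h
-- definitionally.
_⊕_ : ℕ → ℕ → ℕ
zero  ⊕ h = h
suc e ⊕ h = e ⊕ suc h

lift : ∀ {h} e → Fin h → Fin (e ⊕ h)
lift zero    i = i
lift (suc e) i = lift e (suc i)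

pad : ∀ {h} e → Vec ℕ h → Vec ℕ (e ⊕ h)
pad zero    ρ = ρ
pad (suc e) ρ = pad e (0 ∷ ρ)

lookup-pad : ∀ {h} e (ρ : Vec ℕ h) i → Vec.lookup (pad e ρ) (lift e i) ≡ Vec.lookup ρ i
lookup-pad zero    ρ i = refl
lookup-pad (suc e) ρ i = lookup-pad e (0 ∷ ρ) (suc i)

update-pad : ∀ {h} e (ρ : Vec ℕ h) i v → pad e ρ [ lift e i ]≔ v ≡ pad e (ρ [ i ]≔ v)
update-pad zero    ρ i v = refl
update-pad (suc e) ρ i v = update-pad e (0 ∷ ρ) (suc i) v

module Compiler (A : Set) where

  open module Code-m {m : ℕ} = CounterCode A m public

  notLeftEnd notRightEnd : InputCell A → Bool
  notLeftEnd ⊢ = false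
  notLeftEnd _ = true
  notRightEnd ⊣ = false
  notRightEnd _ = true

  skip : ∀ {m} → Code {m}
  skip = onInput stay

  rewindInput : ∀ {m} → Code {m}
  rewindInput = while (λ a _ → notLeftEnd a) (onInput left)

  Repeat : ∀ {m} → Fin m → Code {m} → Code {m}
  Repeat i p = While i (Dec i ⨾ p)

  -- Walking the head out uses up the counter, which is thus zero when it receives the outcome.
  -- Rewinding restores the convention that terms are evaluated from the left end marker.
  Look : ∀ {m} → (InputCell A → Bool) → Fin m → Code {m}
  Look f i = Repeat i (onInput right) ⨾ ifte (λ a _ → f a) (Inc i) skip ⨾ rewindInput

  need : ∀ {n} → Term A n → ℕ
  need (var i)       = 1
  need zero          = 0
  need (suc t)       = need t
  need (wk t)        = need t
  need (call t τ)    = need t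
  need (lett a t)    = suc (need a + need t)
  need (look f t)    = need t
  need (sum z a t)   = 3 + (need z + (need a + need t))
  need (rec b a z s) = 5 + (need b + (need a + (need z + need s)))

  -- The value is pushed, with e more counters above it as scratch space;
  -- if these are fewer than `need t`, the code is junk.  The variables are
  -- at the stack positions σ.
  compile : ∀ {n h} → Term A n → ∀ e → Vec (Fin h) n → Code {suc e ⊕ h}
  compile (var i) (suc e) σ =
      -- Reading a counter empties it, so the variable is copied twice and then restored from one of
      -- the copies.
      Repeat (lift e (suc (suc s))) (Inc (lift e zero) ⨾ Inc (lift e (suc zero)))
    ⨾ Repeat (lift e zero) (Inc (lift e (suc (suc s))))
    where s = Vec.lookup σ i
  compile zero e σ = skip
  compile (suc t) e σ = compile t e σ ⨾ Inc (lift e zero)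
  compile (wk t) e (_ ∷ σ) = compile t e σ
  compile (call t τ) e σ = compile t e (Vec.map (Vec.lookup σ) τ)
  compile (lett a t) (suc e) σ =
      compile a (suc e) σ
    ⨾ compile t e (zero ∷ Vec.map suc σ)
    -- The result lies above the value of `a`, which is cleared so that the result can be poured
    -- into its place.
    ⨾ Repeat (lift e (suc zero)) skip
    ⨾ Repeat (lift e zero) (Inc (lift e (suc zero)))
  compile (look f t) e σ = compile t e σ ⨾ Look f (lift e zero)
  compile (sum z a t) (suc (suc (suc e))) σ =
      -- The counters to which the values of `z` and `a` are pushed serve as accumulator and as
      -- countdown; the next one, still zero, is the index seen by the body.
      compile z (3 + e) σ
    ⨾ compile a (2 + e) (Vec.map suc σ)
    ⨾ Repeat ctr
        ( compile t e (zero ∷ Vec.map (3 ↑ʳ_) σ)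
        ⨾ Repeat val (Inc acc)
        ⨾ Inc idx )
    ⨾ Repeat idx skip
    where
    val = lift e zero
    idx = lift e (suc zero)
    ctr = lift e (suc (suc zero))
    acc = lift e (suc (suc (suc zero)))
  compile (rec b a z s) (suc (suc (suc (suc (suc e))))) σ =
      compile z (5 + e) σ
    ⨾ compile b (4 + e) (Vec.map suc σ)
    ⨾ compile a (3 + e) (Vec.map (2 ↑ʳ_) σ)
    ⨾ Repeat ctr
        ( compile s (suc e) (suc (suc (suc zero)) ∷ zero ∷ Vec.map (4 ↑ʳ_) σ)
        ⨾ ( Repeat acc skip
          -- Moving at most `cap` units from `val` to the emptied `acc` leaves the minimum there;
          -- `tmp` records the cap, which is restored from it.
          ⨾ Repeat cap (Inc tmp ⨾ If val (Dec val ⨾ Inc acc))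
          ⨾ Repeat tmp (Inc cap)
          ⨾ Repeat val skip )
        ⨾ Inc idx )
    ⨾ Repeat idx skip
    ⨾ Repeat cap skip
    where
    tmp = lift e zero
    val = lift e (suc zero)
    idx = lift e (suc (suc zero))
    ctr = lift e (suc (suc (suc zero)))
    cap = lift e (suc (suc (suc (suc zero))))
    acc = lift e (suc (suc (suc (suc (suc zero)))))
  compile t e σ = skip

-- Correctness of the compiled code

module Execution (A : Set) (w : List A) (L B : ℕ) (fits : ∀ {n} → n ≤ B → length (numeral n) ≤ L) where

  open Compiler A
  open module Counters-m {m : ℕ} = Counters A m L public

  Stack : ℕ → Set
  Stack h = Tape (InputCell A) × Vec ℕ h

  Exec : ∀ {h} e → Code {e ⊕ h} → Stack h → Stack h → Set
  Exec e p (x , ρ) (x′ , ρ′) = p ∶ (x , pad e ρ) ⇒ (x′ , pad e ρ′)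

  infixr 5 _then_

  _then_ : ∀ {m p q s s₁ s₂} → _∶_⇒_ {m} p s s₁ → q ∶ s₁ ⇒ s₂ → p ⨾ q ∶ s ⇒ s₂
  _then_ = seq-rule

  inc : ∀ {h x} e (i : Fin h) ρ → suc (Vec.lookup ρ i) ≤ B →
        Exec e (Inc (lift e i)) (x , ρ) (x , ρ [ i ]≔ suc (Vec.lookup ρ i))
  inc {x = x} e i ρ p =
    subst (λ ρ′ → Inc (lift e i) ∶ (x , pad e ρ) ⇒ (x , ρ′))
      (trans (cong (λ v → pad e ρ [ lift e i ]≔ suc v) (lookup-pad e ρ i)) (update-pad e ρ i _))
      (Inc-rule (lift e i) (subst (λ v → length (numeral (suc v)) ≤ L) (sym (lookup-pad e ρ i)) (fits p)))

  dec : ∀ {h x n} e (i : Fin h) ρ → Vec.lookup ρ i ≡ suc n →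
        Exec e (Dec (lift e i)) (x , ρ) (x , ρ [ i ]≔ n)
  dec {x = x} e i ρ p =
    subst (λ ρ′ → Dec (lift e i) ∶ (x , pad e ρ) ⇒ (x , ρ′)) (update-pad e ρ i _)
      (Dec-rule (lift e i) (trans (lookup-pad e ρ i) p))

  skips : ∀ {m x} {ρ : Vec ℕ m} → skip ∶ (x , ρ) ⇒ (x , ρ)
  skips = input-rule stay

  -- S k d is the state with k rounds to go after d rounds.
  repeat : ∀ {h} e (i : Fin h) {p} n (S : ℕ → ℕ → Stack h) →
           (∀ k d → k + d ≡ n → Vec.lookup (proj₂ (S k d)) i ≡ k) →
           (∀ k d → suc (k + d) ≡ n →
             Exec e p (proj₁ (S (suc k) d) , proj₂ (S (suc k) d) [ i ]≔ k) (S k (suc d))) →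
           Exec e (Repeat (lift e i) p) (S n 0) (S 0 n)
  repeat {h} e i {p} n S counts body = from n 0 (+-identityʳ n)
    where
    from : ∀ k d → k + d ≡ n → Exec e (Repeat (lift e i) p) (S k d) (S 0 n)
    from zero    d refl = while-zero (lift e i) (trans (lookup-pad e _ i) (counts 0 d refl))
    from (suc k) d eq   = while-suc (lift e i) (trans (lookup-pad e _ i) (counts (suc k) d eq))
      (dec e i _ (counts (suc k) d eq) then body k d eq) (from k (suc d) (trans (+-suc k d) eq))

  drain : ∀ {h x} e (i : Fin h) ρ → Exec e (Repeat (lift e i) skip) (x , ρ) (x , ρ [ i ]≔ 0)
  drain {x = x} e i ρ =
    subst (λ ρ₀ → Exec e (Repeat (lift e i) skip) (x , ρ₀) (x , ρ [ i ]≔ 0)) ([]≔-lookup ρ i)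
      (repeat e i (Vec.lookup ρ i) (λ k _ → x , ρ [ i ]≔ k) (λ k _ _ → lookup∘update i ρ k)
        λ k d _ → subst (λ ρ′ → Exec e skip (x , ρ′) (x , ρ [ i ]≔ k)) (sym (updateAt-updateAt i ρ)) skips)

  posn : List A → List A → Tape (InputCell A)
  posn u []      = tape (List.map letter u ++ ⊢ ∷ []) ⊣ []
  posn u (a ∷ v) = tape (List.map letter u ++ ⊢ ∷ []) (letter a) (List.map letter v ++ ⊣ ∷ [])

  first-right : ∀ w → moveInput right (inputTape w) ≡ posn [] w
  first-right []      = refl
  first-right (a ∷ w) = refl

  next-right : ∀ u a v → moveInput right (posn u (a ∷ v)) ≡ posn (a ∷ u) v
  next-right u a []      = refl
  next-right u a (_ ∷ v) = refl

  -- The head cannot pass the right end marker, so arbitrarily many moves to the right lead to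
  -- finitely many tapes, and rewinding can be proved without a bound on the number of moves.
  data Reached : Tape (InputCell A) → Set where
    leftEnd : Reached (inputTape w)
    inside  : ∀ u v → u ʳ++ v ≡ w → Reached (posn u v)

  reached : ∀ k → Reached (headAt w k)
  reached zero = leftEnd
  reached (suc k) with headAt w k | reached k
  ... | _ | leftEnd          = subst Reached (sym (first-right w)) (inside [] w refl)
  ... | _ | inside u [] e      = inside u [] e
  ... | _ | inside u (a ∷ v) e = subst Reached (sym (next-right u a v)) (inside (a ∷ u) v e)

  rewinds-input : ∀ {m x} {ρ : Vec ℕ m} → Reached x → rewindInput ∶ (x , ρ) ⇒ (inputTape w , ρ)
  rewinds-input leftEnd = scan-loop-stop notLeftEnd refl
  rewinds-input {ρ = ρ} (inside u v refl) = back u v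
    where
    notLeft : ∀ u v → notLeftEnd (scan (posn u v)) ≡ true
    notLeft u []      = refl
    notLeft u (a ∷ v) = refl

    leftmost : ∀ v → moveInput left (posn [] v) ≡ inputTape v
    leftmost []      = refl
    leftmost (a ∷ v) = refl

    leftward : ∀ a u v → moveInput left (posn (a ∷ u) v) ≡ posn u (a ∷ v)
    leftward a u []      = refl
    leftward a u (_ ∷ v) = refl

    back : ∀ u v → rewindInput ∶ (posn u v , ρ) ⇒ (inputTape (u ʳ++ v) , ρ)
    back [] v = scan-loop-step notLeftEnd (notLeft [] v)
      (subst (λ x → onInput left ∶ (posn [] v , ρ) ⇒ (x , ρ)) (leftmost v) (input-rule left))
      (scan-loop-stop notLeftEnd refl)
    back (a ∷ u) v = scan-loop-step notLeftEnd (notLeft (a ∷ u) v)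
      (subst (λ x → onInput left ∶ (posn (a ∷ u) v , ρ) ⇒ (x , ρ)) (leftward a u v) (input-rule left))
      (back u (a ∷ v))

  looks : ∀ {h} e f k (ρ : Vec ℕ h) → 1 ≤ B →
          Exec e (Look f (lift e zero)) (inputTape w , k ∷ ρ) (inputTape w , bit (f (cellAt w k)) ∷ ρ)
  looks e f k ρ 1≤B =
         repeat e zero k (λ j d → headAt w d , j ∷ ρ) (λ _ _ _ → refl) (λ _ _ _ → input-rule right)
    then scan-if f decide
    then rewinds-input (reached k)
    where
    decide : Exec e (if f (cellAt w k) then Inc (lift e zero) else skip)
               (headAt w k , 0 ∷ ρ) (headAt w k , bit (f (cellAt w k)) ∷ ρ)
    decide with f (cellAt w k)
    ... | true  = inc e zero (0 ∷ ρ) 1≤B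
    ... | false = skips

  pour : ∀ {h x} e (j : Fin h) n ρ → n + Vec.lookup ρ j ≤ B →
         Exec e (Repeat (lift e zero) (Inc (lift e (suc j)))) (x , n ∷ ρ)
                (x , 0 ∷ ρ [ j ]≔ (n + Vec.lookup ρ j))
  pour {x = x} e j n ρ p =
    subst (λ ρ₀ → Exec e (Repeat (lift e zero) (Inc (lift e (suc j)))) (x , n ∷ ρ₀) (x , 0 ∷ ρ [ j ]≔ (n + v)))
      ([]≔-lookup ρ j)
      (repeat e zero n (λ k d → x , k ∷ ρ [ j ]≔ (d + v)) (λ _ _ _ → refl)
        λ k d eq → subst (λ ρ₁ → Exec e (Inc (lift e (suc j))) (x , k ∷ ρ [ j ]≔ (d + v)) (x , k ∷ ρ₁))
          (trans (updateAt-updateAt j ρ) (cong (λ u → ρ [ j ]≔ suc u) (lookup∘update j ρ (d + v))))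
          (inc e (suc j) _ (≤-trans (≤-reflexive (cong suc (lookup∘update j ρ (d + v))))
            (≤-trans (+-monoˡ-≤ v (m+n≤o⇒n≤o k (≤-reflexive (trans (+-suc k d) eq)))) p))))
    where v = Vec.lookup ρ j

  copy : ∀ {h x} e (i : Fin h) ρ → Vec.lookup ρ i ≤ B →
         Exec e (Repeat (lift e (suc (suc i))) (Inc (lift e zero) ⨾ Inc (lift e (suc zero)))
                 ⨾ Repeat (lift e zero) (Inc (lift e (suc (suc i)))))
              (x , 0 ∷ 0 ∷ ρ) (x , 0 ∷ Vec.lookup ρ i ∷ ρ)
  copy {x = x} e i ρ p =
         subst (λ ρ₀ → Exec e (Repeat (lift e (suc (suc i))) (Inc (lift e zero) ⨾ Inc (lift e (suc zero))))
                         (x , 0 ∷ 0 ∷ ρ₀) (x , n ∷ n ∷ ρ [ i ]≔ 0))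
           ([]≔-lookup ρ i)
           (repeat e (suc (suc i)) n (λ k d → x , d ∷ d ∷ ρ [ i ]≔ k) (λ k d _ → lookup∘update i ρ k) out)
    then subst (λ ρ₁ → Exec e (Repeat (lift e zero) (Inc (lift e (suc (suc i)))))
                         (x , n ∷ n ∷ ρ [ i ]≔ 0) (x , 0 ∷ n ∷ ρ₁))
           (trans (updateAt-updateAt i ρ) (trans (cong (ρ [ i ]≔_) back) ([]≔-lookup ρ i)))
           (pour e (suc i) n (n ∷ ρ [ i ]≔ 0) (≤-trans (≤-reflexive back) p))
    where
    n = Vec.lookup ρ i

    back : n + Vec.lookup (ρ [ i ]≔ 0) i ≡ n
    back = trans (cong (n +_) (lookup∘update i ρ 0)) (+-identityʳ n)

    out : ∀ k d → suc (k + d) ≡ n →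
          Exec e (Inc (lift e zero) ⨾ Inc (lift e (suc zero)))
            (x , d ∷ d ∷ ((ρ [ i ]≔ suc k) [ i ]≔ k)) (x , suc d ∷ suc d ∷ ρ [ i ]≔ k)
    out k d eq =
      subst (λ ρ′ → Exec e (Inc (lift e zero) ⨾ Inc (lift e (suc zero)))
                      (x , d ∷ d ∷ ρ′) (x , suc d ∷ suc d ∷ ρ [ i ]≔ k))
        (sym (updateAt-updateAt i ρ))
        (inc e zero (d ∷ d ∷ _) fit then inc e (suc zero) (suc d ∷ d ∷ _) fit)
      where
      fit : suc d ≤ B
      fit = ≤-trans (m+n≤o⇒n≤o k (≤-reflexive (trans (+-suc k d) eq))) p

  min-step : ∀ v c → (v ∸ c ≡ 0 × v ∸ suc c ≡ 0 × v ⊓ suc c ≡ v ⊓ c)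
                   ⊎ (v ∸ c ≡ suc (v ∸ suc c) × v ⊓ suc c ≡ suc (v ⊓ c))
  min-step zero    c       = inj₁ (0∸n≡0 c , refl , refl)
  min-step (suc v) zero    = inj₂ (refl , cong suc (⊓-zeroʳ v))
  min-step (suc v) (suc c) with min-step v c
  ... | inj₁ (p , q , r) = inj₁ (p , q , cong suc r)
  ... | inj₂ (p , q)     = inj₂ (p , cong suc q)

  module _ {h : ℕ} (e d k b v : ℕ) {ρ : Vec ℕ h} where

    private
      tmp val cap acc : Fin (e ⊕ (6 + h))
      tmp = lift e zero
      val = lift e (suc zero)
      cap = lift e (suc (suc (suc (suc zero))))
      acc = lift e (suc (suc (suc (suc (suc zero)))))

    takes-minimum : ∀ {x r} → b ≤ B →
      Exec e (Repeat acc skip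
              ⨾ Repeat cap (Inc tmp ⨾ If val (Dec val ⨾ Inc acc))
              ⨾ Repeat tmp (Inc cap)
              ⨾ Repeat val skip)
           (x , 0 ∷ v ∷ d ∷ k ∷ b ∷ r ∷ ρ) (x , 0 ∷ 0 ∷ d ∷ k ∷ b ∷ v ⊓ b ∷ ρ)
    takes-minimum {x} b≤B =
           drain e (suc (suc (suc (suc (suc zero))))) _
      then subst (λ m → Exec e (Repeat cap (Inc tmp ⨾ If val (Dec val ⨾ Inc acc)))
                          (x , 0 ∷ v ∷ d ∷ k ∷ b ∷ m ∷ ρ) (x , b ∷ v ∸ b ∷ d ∷ k ∷ 0 ∷ v ⊓ b ∷ ρ))
             (⊓-zeroʳ v)
             (repeat e (suc (suc (suc (suc zero)))) b state (λ _ _ _ → refl) round)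
      then subst (λ c → Exec e (Repeat tmp (Inc cap))
                          (x , b ∷ v ∸ b ∷ d ∷ k ∷ 0 ∷ v ⊓ b ∷ ρ) (x , 0 ∷ v ∸ b ∷ d ∷ k ∷ c ∷ v ⊓ b ∷ ρ))
             (+-identityʳ b)
             (pour e (suc (suc (suc zero))) b _ (≤-trans (≤-reflexive (+-identityʳ b)) b≤B))
      then drain e (suc zero) (0 ∷ v ∸ b ∷ d ∷ k ∷ b ∷ v ⊓ b ∷ ρ)
      where
      state : ℕ → ℕ → Stack _
      state j c = x , c ∷ v ∸ c ∷ d ∷ k ∷ j ∷ v ⊓ c ∷ ρ

      round : ∀ j c → suc (j + c) ≡ b →
              Exec e (Inc tmp ⨾ If val (Dec val ⨾ Inc acc)) (state j c) (state j (suc c))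
      round j c eq = inc e zero (c ∷ v ∸ c ∷ d ∷ k ∷ j ∷ v ⊓ c ∷ ρ) (≤-trans c<b b≤B) then move
        where
        c<b : suc c ≤ b
        c<b = m+n≤o⇒n≤o j (≤-reflexive (trans (+-suc j c) eq))

        move : Exec e (If val (Dec val ⨾ Inc acc))
                 (x , suc c ∷ v ∸ c ∷ d ∷ k ∷ j ∷ v ⊓ c ∷ ρ)
                 (x , suc c ∷ v ∸ suc c ∷ d ∷ k ∷ j ∷ v ⊓ suc c ∷ ρ)
        move with min-step v c
        ... | inj₁ (p , q , r) rewrite p | q | r = if-zero val (lookup-pad e _ (suc zero))
        ... | inj₂ (p , q) rewrite p | q =
          if-suc val (lookup-pad e (_ ∷ suc _ ∷ _) (suc zero))
            (dec e (suc zero) (suc c ∷ suc _ ∷ _) refl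
            then inc e (suc (suc (suc (suc (suc zero))))) (suc c ∷ v ∸ suc c ∷ d ∷ k ∷ j ∷ v ⊓ c ∷ ρ)
                   (≤-trans (≤-reflexive (sym q)) (≤-trans (m⊓n≤n v (suc c)) (≤-trans c<b b≤B))))

  module _ {h : ℕ} (ρ : Vec ℕ h) where

    shifted : ∀ {n k} {σ : Vec (Fin h) n} {vs} (f : Fin h → Fin k) (ρ′ : Vec ℕ k) →
              (∀ i → Vec.lookup ρ′ (f i) ≡ Vec.lookup ρ i) →
              Vec.map (Vec.lookup ρ) σ ≡ vs → Vec.map (Vec.lookup ρ′) (Vec.map f σ) ≡ vs
    shifted {σ = σ} f ρ′ p e = trans (sym (Vec.map-∘ (Vec.lookup ρ′) f σ)) (trans (Vec.map-cong p σ) e)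

  module Budget {n} {vs : Vec ℕ n} {x} (2≤x : 2 ≤ x) (vs≤x : Below w x vs) where

    open Powers 2≤x public

    affords : ∀ {a b} → a ≤ b → x ^ b ≤ B → x ^ a ≤ B
    affords p = ≤-trans (pow-mono p)

  -- Induction on the term. The last hypothesis guarantees that every counter in use, intermediate
  -- ones included, stays within `B`; under a binder x is replaced by a power of x exactly as in
  -- `eval≤`, and `deg` was chosen so that the hypothesis is inherited. The padding returns the
  -- scratch counters to zero.
  correct : ∀ {n h} (t : Term A n) e (σ : Vec (Fin h) n) ρ {vs x} → need t ≤ e →
            Vec.map (Vec.lookup ρ) σ ≡ vs → 2 ≤ x → Below w x vs → x ^ deg t ≤ B →
            Exec e (compile t e σ) (inputTape w , 0 ∷ ρ) (inputTape w , eval w t vs ∷ ρ)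
  correct (var i) (suc e) σ ρ {x = x} (s≤s _) refl 2≤x vs≤x fit =
    subst (λ v → Exec e (compile (var i) (suc e) σ) (inputTape w , 0 ∷ 0 ∷ ρ) (inputTape w , 0 ∷ v ∷ ρ))
      (sym (lookup-map i (Vec.lookup ρ) σ))
      (copy e (Vec.lookup σ i) ρ
        (≤-trans (≤-reflexive (sym (lookup-map i (Vec.lookup ρ) σ)))
          (≤-trans (eval≤ w (var i) 2≤x vs≤x) fit)))
  correct zero e σ ρ n≤e env 2≤x vs≤x fit = skips
  correct (suc t) e σ ρ n≤e env 2≤x vs≤x fit =
         correct t e σ ρ n≤e env 2≤x vs≤x (affords (n≤1+n (deg t)) fit)
    then inc e zero (_ ∷ ρ) (≤-trans (eval≤ w (suc t) 2≤x vs≤x) fit)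
    where open Budget 2≤x vs≤x
  correct (wk t) e (_ ∷ σ) ρ n≤e refl 2≤x (_ ∷ vs≤x) fit = correct t e σ ρ n≤e refl 2≤x vs≤x fit
  correct (call t τ) e σ ρ n≤e refl 2≤x vs≤x fit =
    correct t e (Vec.map (Vec.lookup σ) τ) ρ n≤e
      (trans (sym (Vec.map-∘ (Vec.lookup ρ) (Vec.lookup σ) τ)) (Vec.map-cong (λ i → sym (lookup-map i (Vec.lookup ρ) σ)) τ))
      2≤x (below-lookup w τ vs≤x) fit
  correct (lett a t) (suc e) σ ρ {vs} {x} (s≤s n≤e) env 2≤x vs≤x fit =
         correct a (suc e) σ ρ (m≤n⇒m≤1+n (m+n≤o⇒m≤o (need a) n≤e)) env 2≤x vs≤x (affords da fit)
    then correct t e (zero ∷ Vec.map suc σ) (va ∷ ρ) (m+n≤o⇒n≤o (need a) n≤e)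
           (cong (va ∷_) (shifted ρ suc (va ∷ ρ) (λ _ → refl) env))
           (2≤pow-suc (deg a))
           (n≤pow {a = deg a} (eval≤ w a 2≤x vs≤x) (n≤1+n _) ∷ below-trans w (x≤pow-suc (deg a)) vs≤x)
           (≤-trans (≤-reflexive (^-*-assoc x (suc (deg a)) (deg t)))
             (affords (*-monoʳ-≤ (suc (deg a)) (n≤1+n (deg t))) fit))
    then drain e (suc zero) (v ∷ va ∷ ρ)
    then subst (λ u → Exec e (Repeat (lift e zero) (Inc (lift e (suc zero))))
                        (inputTape w , v ∷ 0 ∷ ρ) (inputTape w , 0 ∷ u ∷ ρ))
           (+-identityʳ v)
           (pour e zero v (0 ∷ ρ) (≤-trans (≤-reflexive (+-identityʳ v))
             (≤-trans (eval≤ w (lett a t) 2≤x vs≤x) fit)))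
    where
    open Budget 2≤x vs≤x
    va = eval w a vs
    v  = eval w t (va ∷ vs)

    da : deg a ≤ suc (deg a) * suc (deg t)
    da = ≤-trans (n≤1+n (deg a)) (m≤m*n (suc (deg a)) (suc (deg t)))
  correct (look f t) e σ ρ {vs} {x} n≤e env 2≤x vs≤x fit =
         correct t e σ ρ n≤e env 2≤x vs≤x fit
    then looks e f (eval w t vs) ρ (≤-trans (1≤pow (deg t)) fit)
    where open Budget 2≤x vs≤x
  correct (sum z a t) (suc (suc (suc e))) σ ρ {vs} {x} (s≤s (s≤s (s≤s n≤e))) env 2≤x vs≤x fit =
         correct z (3 + e) σ ρ (≤-trans (m+n≤o⇒m≤o (need z) n≤e) (m≤n+m e 3)) env 2≤x vs≤x
           (affords (m≤n⇒m≤1+n (m≤m+n (deg z) _)) fit)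
    then correct a (2 + e) (Vec.map suc σ) (vz ∷ ρ)
           (≤-trans (m+n≤o⇒m≤o (need a) (m+n≤o⇒n≤o (need z) n≤e)) (m≤n+m e 2))
           (shifted ρ suc (vz ∷ ρ) (λ _ → refl) env) 2≤x vs≤x (affords da fit)
    then repeat e (suc (suc zero)) va
           (λ k d → inputTape w , 0 ∷ d ∷ k ∷ total vz f d ∷ ρ) (λ _ _ _ → refl) round
    then drain e (suc zero) (0 ∷ va ∷ 0 ∷ total vz f va ∷ ρ)
    where
    open Budget 2≤x vs≤x
    vz = eval w z vs
    va = eval w a vs

    f : ℕ → ℕ
    f i = eval w t (i ∷ vs)

    da : deg a ≤ suc (deg z + (deg a + suc (deg a) * deg t))
    da = m≤n⇒m≤1+n (≤-trans (m≤m+n (deg a) _) (m≤n+m _ (deg z)))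

    round : ∀ k d → suc (k + d) ≡ va → Exec e _
              (inputTape w , 0 ∷ d ∷ k ∷ total vz f d ∷ ρ)
              (inputTape w , 0 ∷ suc d ∷ k ∷ total vz f (suc d) ∷ ρ)
    round k d eq =
           correct t e (zero ∷ Vec.map (3 ↑ʳ_) σ) (d ∷ k ∷ total vz f d ∷ ρ)
             (m+n≤o⇒n≤o (need a) (m+n≤o⇒n≤o (need z) n≤e))
             (cong (d ∷_) (shifted ρ (3 ↑ʳ_) (d ∷ k ∷ total vz f d ∷ ρ) (λ _ → refl) env))
             (2≤pow-suc (deg a))
             (n≤pow {a = deg a} (≤-trans (<⇒≤ d<a) (eval≤ w a 2≤x vs≤x)) (n≤1+n _)
               ∷ below-trans w (x≤pow-suc (deg a)) vs≤x)
             (≤-trans (≤-reflexive (^-*-assoc x (suc (deg a)) (deg t)))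
               (affords (m≤n⇒m≤1+n (≤-trans (m≤n+m (suc (deg a) * deg t) (deg a)) (m≤n+m _ (deg z)))) fit))
      then pour e (suc (suc zero)) (f d) (d ∷ k ∷ total vz f d ∷ ρ)
             (≤-trans (total-mono vz f d<a) (≤-trans (eval≤ w (sum z a t) 2≤x vs≤x) fit))
      then inc e (suc zero) (0 ∷ d ∷ k ∷ total vz f (suc d) ∷ ρ)
             (≤-trans d<a (≤-trans (eval≤ w a 2≤x vs≤x) (affords da fit)))
      where
      d<a : d < va
      d<a = m+n≤o⇒n≤o k (≤-reflexive (trans (+-suc k d) eq))
  correct (rec b a z s) (suc (suc (suc (suc (suc e))))) σ ρ {vs} {x}
          (s≤s (s≤s (s≤s (s≤s (s≤s n≤e))))) env 2≤x vs≤x fit =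
         correct z (5 + e) σ ρ (≤-trans (m+n≤o⇒m≤o (need z) needs-zs) (m≤n+m e 5)) env 2≤x vs≤x
           (affords (≤-trans (m≤n+m (deg z) (deg b)) (m≤n+m _ (deg a))) fit′)
    then correct b (4 + e) (Vec.map suc σ) (vz ∷ ρ)
           (≤-trans (m+n≤o⇒m≤o (need b) n≤e) (m≤n+m e 4))
           (shifted ρ suc (vz ∷ ρ) (λ _ → refl) env) 2≤x vs≤x (affords db fit′)
    then correct a (3 + e) (Vec.map (2 ↑ʳ_) σ) (vb ∷ vz ∷ ρ)
           (≤-trans (m+n≤o⇒m≤o (need a) (m+n≤o⇒n≤o (need b) n≤e)) (m≤n+m e 3))
           (shifted ρ (2 ↑ʳ_) (vb ∷ vz ∷ ρ) (λ _ → refl) env) 2≤x vs≤x (affords (m≤m+n (deg a) _) fit′)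
    then repeat e (suc (suc (suc zero))) va
           (λ k d → inputTape w , 0 ∷ 0 ∷ d ∷ k ∷ vb ∷ R d ∷ ρ) (λ _ _ _ → refl) round
    then drain e (suc (suc zero)) (0 ∷ 0 ∷ va ∷ 0 ∷ vb ∷ R va ∷ ρ)
    then drain e (suc (suc (suc (suc zero)))) (0 ∷ 0 ∷ 0 ∷ 0 ∷ vb ∷ R va ∷ ρ)
    where
    open Budget 2≤x vs≤x
    vz = eval w z vs
    va = eval w a vs
    vb = eval w b vs
    K = suc (deg a + (deg b + deg z))

    R : ℕ → ℕ
    R = capped vb vz (λ i r → eval w s (r ∷ i ∷ vs))

    needs-zs : need z + need s ≤ e
    needs-zs = m+n≤o⇒n≤o (need a) (m+n≤o⇒n≤o (need b) n≤e)

    fit″ : x ^ K ≤ B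
    fit″ = affords (m≤m*n K (suc (deg s))) fit

    fit′ : x ^ (deg a + (deg b + deg z)) ≤ B
    fit′ = affords (n≤1+n (deg a + (deg b + deg z))) fit″

    db : deg b ≤ deg a + (deg b + deg z)
    db = ≤-trans (m≤m+n (deg b) (deg z)) (m≤n+m _ (deg a))

    va≤ : va ≤ x ^ K
    va≤ = n≤pow {a = deg a} (eval≤ w a 2≤x vs≤x) (m≤n⇒m≤1+n (m≤m+n (deg a) _))

    round : ∀ k d → suc (k + d) ≡ va → Exec e _
              (inputTape w , 0 ∷ 0 ∷ d ∷ k ∷ vb ∷ R d ∷ ρ)
              (inputTape w , 0 ∷ 0 ∷ suc d ∷ k ∷ vb ∷ R (suc d) ∷ ρ)
    round k d eq =
           correct s (suc e) (suc (suc (suc zero)) ∷ zero ∷ Vec.map (4 ↑ʳ_) σ) (d ∷ k ∷ vb ∷ R d ∷ ρ)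
             (m≤n⇒m≤1+n (m+n≤o⇒n≤o (need z) needs-zs))
             (cong (λ us → R d ∷ d ∷ us) (shifted ρ (4 ↑ʳ_) (d ∷ k ∷ vb ∷ R d ∷ ρ) (λ _ → refl) env))
             (2≤pow-suc (deg a + (deg b + deg z)))
             (rec≤ w b a z s 2≤x vs≤x d ∷ ≤-trans (<⇒≤ d<a) va≤
               ∷ below-trans w (x≤pow-suc (deg a + (deg b + deg z))) vs≤x)
             (≤-trans (≤-reflexive (^-*-assoc x K (deg s)))
               (affords (*-monoʳ-≤ K (n≤1+n (deg s))) fit))
      then takes-minimum e d k vb _ (≤-trans (eval≤ w b 2≤x vs≤x) (affords db fit′))
      then inc e (suc (suc zero)) (0 ∷ 0 ∷ d ∷ k ∷ vb ∷ R (suc d) ∷ ρ) (≤-trans d<a (≤-trans va≤ fit″))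
      where
      d<a : d < va
      d<a = m+n≤o⇒n≤o k (≤-reflexive (trans (+-suc k d) eq))

-- Terms decide problems in logarithmic space

n<2^suc⌊log₂n⌋ : ∀ n → n < 2 ^ suc ⌊log₂ n ⌋
n<2^suc⌊log₂n⌋ n with 2 ^ suc ⌊log₂ n ⌋ ≤? n
... | no  p = ≰⇒> p
... | yes p = contradiction
  (≤-trans (≤-reflexive (sym (⌊log₂[2^n]⌋≡n (suc ⌊log₂ n ⌋)))) (⌊log₂⌋-mono-≤ p)) (<-irrefl refl)

2^-cancel-≤ : ∀ {a b} → 2 ^ a ≤ 2 ^ b → a ≤ b
2^-cancel-≤ {a} {b} p = ≮⇒≥ λ b<a → <⇒≱ (^-monoʳ-< 2 (s≤s (s≤s z≤n)) b<a) p

module Decider {A : Set} (t : Term A 1) where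

  open Compiler A

  height : ℕ
  height = suc (need t) ⊕ 1

  tally : Fin height → Code {height}
  tally i = while (λ a _ → notRightEnd a) (Inc i ⨾ onInput right)

  measure : Fin height → Code {height}
  measure i = onInput right ⨾ tally i ⨾ rewindInput

  decider : Code {height}
  decider = measure (lift (suc (need t)) zero) ⨾ compile t (need t) (zero ∷ [])

  verdict : Vec Cell height → Bool
  verdict cs = isDigit (Vec.lookup cs (lift (need t) zero))

  decidingMachine : Machine A
  decidingMachine = machine decider verdict

  module _ (w : List A) (L B : ℕ) (fits : ∀ {n} → n ≤ B → length (numeral n) ≤ L) where

    open Execution A w L B fits

    private e = need t

    passes : ∀ u v n → n + length v ≤ B → u ʳ++ v ≡ w → ∃[ x ] Reached x ×
             Exec (suc e) (tally (lift (suc e) zero))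
               (posn u v , n ∷ []) (x , n + length v ∷ [])
    passes u [] n p eq =
      posn u [] , inside u [] eq
      , subst (λ m → Exec (suc e) (tally (lift (suc e) zero)) (posn u [] , n ∷ []) (posn u [] , m ∷ [])) (sym (+-identityʳ n))
          (scan-loop-stop notRightEnd refl)
    passes u (a ∷ v) n p eq with passes (a ∷ u) v (suc n) (subst (_≤ B) (+-suc n (length v)) p) eq
    ... | x , r , run =
      x , r
      , subst (λ m → Exec (suc e) (tally (lift (suc e) zero)) (posn u (a ∷ v) , n ∷ []) (x , m ∷ [])) (sym (+-suc n (length v)))
          (scan-loop-step notRightEnd refl
            (inc (suc e) zero (n ∷ [])
               (≤-trans (s≤s (m≤m+n n (length v))) (subst (_≤ B) (+-suc n (length v)) p))
             then subst (λ y → Exec (suc e) (onInput right) (posn u (a ∷ v) , suc n ∷ []) (y , suc n ∷ []))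
                    (next-right u a v) (input-rule right))
            run)

    measures : length w ≤ B → Exec (suc e) (measure (lift (suc e) zero))
                 (inputTape w , 0 ∷ []) (inputTape w , length w ∷ [])
    measures p with passes [] w 0 p refl
    ... | x , r , run =
           subst (λ y → Exec (suc e) (onInput right) (inputTape w , 0 ∷ []) (y , 0 ∷ []))
             (first-right w) (input-rule right)
      then run
      then rewinds-input r

    fresh : ∀ n → Pointwise (Counter {height}) (Vec.replicate n 0) (Vec.replicate n (tape [] blank []))
    fresh zero    = []
    fresh (suc n) = counter untouched refl z≤n z≤n ∷ fresh n

    pad-zeros : ∀ {h} e → pad e (Vec.replicate h 0) ≡ Vec.replicate (e ⊕ h) 0
    pad-zeros zero    = refl
    pad-zeros (suc e) = pad-zeros e

    decides : ∀ {x} → 2 ≤ x → length w ≤ x → x ^ suc (deg t) ≤ B →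
              Halts decidingMachine (height * (3 + L))
                (initial decidingMachine w) (0 <ᵇ eval w t (length w ∷ []))
    decides {x} 2≤x w≤x fit = let ts , cs , run = runs in
      subst (Halts decidingMachine (height * (3 + L)) (initial decidingMachine w))
        (trans (nonzero-test (lift e zero) cs) (cong (0 <ᵇ_) (lookup-pad e (eval w t (length w ∷ []) ∷ length w ∷ []) zero)))
        (machine-halts decider verdict run (counters-ok cs))
      where
      open Powers 2≤x

      runs : ∃[ ts ] Counters-m.Counters (pad e (eval w t (length w ∷ []) ∷ length w ∷ [])) ts ×
                     Run decider (inputTape w , Vec.replicate height (tape [] blank [])) (inputTape w , ts)
      runs = (measures (≤-trans w≤x (≤-trans (x≤pow-suc (deg t)) fit))
             then correct t e (zero ∷ []) (length w ∷ []) ≤-refl refl 2≤x (w≤x ∷ [])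
                    (≤-trans (pow-mono (n≤1+n (deg t))) fit))
             (subst (λ ρ → Pointwise (Counter {height}) ρ (Vec.replicate height (tape [] blank [])))
               (sym (pad-zeros (suc e))) (fresh height))

  -- The input length is below 2^(2 + log n), so all counters stay within 2^E for E = (2 + log n)
  -- times `suc (deg t)`. Numerals up to that size have at most E + 1 digits, and each of the tapes
  -- uses at most 3 cells more.
  spaceBound : ℕ → ℕ
  spaceBound n = height * (3 + suc ((2 + ⌊log₂ n ⌋) * suc (deg t)))

  spaceBound∈O[log] : spaceBound ∈O[log]
  -- From 2 on the rounded logarithm l is at least 1, which allows 4 ≤ 4l and 2 + l ≤ 3l.
  spaceBound∈O[log] = height * (4 + 3 * d) , 2 , λ n 2≤n →
    ≤-trans (*-monoʳ-≤ height (bound ⌊log₂ n ⌋ (subst (_≤ ⌊log₂ n ⌋) (⌊log₂[2^n]⌋≡n 1) (⌊log₂⌋-mono-≤ 2≤n))))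
      (≤-reflexive (sym (*-assoc height (4 + 3 * d) ⌊log₂ n ⌋)))
    where
    d = suc (deg t)

    bound : ∀ l → 1 ≤ l → 4 + (2 + l) * d ≤ (4 + 3 * d) * l
    bound l 1≤l = ≤-trans
      (+-mono-≤ (*-monoʳ-≤ 4 1≤l) (≤-trans (*-monoˡ-≤ d (+-monoˡ-≤ l (*-monoʳ-≤ 2 1≤l))) (≤-reflexive eq)))
      (≤-reflexive (sym (*-distribʳ-+ l 4 (3 * d))))
      where
      eq : (2 * l + l) * d ≡ 3 * d * l
      eq = trans (cong (_* d) (+-comm (2 * l) l)) (trans (*-assoc 3 l d) (trans (cong (3 *_) (*-comm l d)) (sym (*-assoc 3 d l))))

  decides-in-logspace : ∀ w → Halts decidingMachine (spaceBound (length w)) (initial decidingMachine w)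
                                (0 <ᵇ eval w t (length w ∷ []))
  decides-in-logspace w =
    decides w (suc E) (2 ^ E) short {2 ^ (2 + l)} (^-monoʳ-≤ 2 {1} {2 + l} (s≤s z≤n))
      (≤-trans (<⇒≤ (n<2^suc⌊log₂n⌋ (length w))) (^-monoʳ-≤ 2 {suc l} {2 + l} (n≤1+n (suc l))))
      (≤-reflexive (^-*-assoc 2 (2 + l) (suc (deg t))))
    where
    l = ⌊log₂ length w ⌋
    E = (2 + l) * suc (deg t)

    short : ∀ {n} → n ≤ 2 ^ E → length (numeral n) ≤ suc E
    short {n} p = 2^-cancel-≤ (≤-trans (2^length-numeral≤ n)
      (≤-trans (+-mono-≤ (m^n>0 2 E) p) (≤-reflexive (cong (2 ^ E +_) (sym (+-identityʳ _))))))

  inL : ∀ {a p} {X : Set a} (fin : Finite A) (encode : X → List A) (P : X → Set p) →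
        (∀ x → (0 <ᵇ eval (encode x) t (length (encode x) ∷ [])) ≡ true ⇔ P x) → InL fin encode P
  inL fin encode P correct = decidingMachine , spaceBound , spaceBound∈O[log] , λ x →
    _ , decides-in-logspace (encode x) , correct x

-- Arithmetic and logic in the term language

countTo : (ℕ → Bool) → ℕ → ℕ
countTo p zero    = 0
countTo p (suc n) = bit (p n) + countTo p n

existsTo forallTo : (ℕ → Bool) → ℕ → Bool
existsTo p n = 0 <ᵇ countTo p n
forallTo p n = not (existsTo (not ∘ p) n)

implies : Bool → Bool → Bool
implies a b = if a then b else true

odd : ℕ → Bool
odd n = 0 <ᵇ (n ∸ (⌊ n /2⌋ + ⌊ n /2⌋))

countTo-cong : ∀ {p q} n → (∀ i → i < n → p i ≡ q i) → countTo p n ≡ countTo q n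
countTo-cong zero    e = refl
countTo-cong (suc n) e = cong₂ (λ b m → bit b + m) (e n ≤-refl) (countTo-cong n λ i i<n → e i (m≤n⇒m≤1+n i<n))

existsTo-cong : ∀ {p q} n → (∀ i → i < n → p i ≡ q i) → existsTo p n ≡ existsTo q n
existsTo-cong n e = cong (0 <ᵇ_) (countTo-cong n e)

forallTo-cong : ∀ {p q} n → (∀ i → i < n → p i ≡ q i) → forallTo p n ≡ forallTo q n
forallTo-cong n e = cong not (existsTo-cong n λ i i<n → cong not (e i i<n))

existsTo-intro : ∀ {p n} i → i < n → p i ≡ true → existsTo p n ≡ true
existsTo-intro {p} {suc n} i i<n e with p n in eq | m≤n⇒m<n∨m≡n i<n
... | true  | _ = refl
... | false | inj₁ (s≤s i<n′) = existsTo-intro i i<n′ e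
... | false | inj₂ refl with trans (sym eq) e
... | ()

existsTo-elim : ∀ {p} n → existsTo p n ≡ true → ∃[ i ] i < n × p i ≡ true
existsTo-elim {p} (suc n) e with p n in eq
... | true  = n , ≤-refl , eq
... | false with existsTo-elim n e
... | i , i<n , q = i , m≤n⇒m≤1+n i<n , q

forallTo-elim : ∀ {p n} → forallTo p n ≡ true → ∀ i → i < n → p i ≡ true
forallTo-elim {p} {n} e i i<n with p i in eq
... | true  = refl
... | false with trans (cong not (sym (existsTo-intro {not ∘ p} i i<n (cong not eq)))) e
... | ()

forallTo-intro : ∀ {p} n → (∀ i → i < n → p i ≡ true) → forallTo p n ≡ true
forallTo-intro {p} n all with existsTo (not ∘ p) n in eq
... | false = refl
... | true with existsTo-elim n eq
... | i , i<n , e with trans (cong not (sym (all i i<n))) e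
... | ()

module _ {A : Set} where

  infixr 6 _andᵗ_

  oneᵗ : ∀ {n} → Term A n
  oneᵗ = suc zero

  -- Opaque, so that large terms are not normalised during type checking.
  opaque

    -- `c` is the number of rounds: none leaves `b`, and any positive number yields `a`, which the
    -- cap `a` does not cut.
    iteᵗ : ∀ {n} (c a b : Term A n) → Term A n
    iteᵗ c a b = rec a c b (wk (wk a))

    notᵗ : ∀ {n} → Term A n → Term A n
    notᵗ a = iteᵗ a zero oneᵗ

    _andᵗ_ impliesᵗ : ∀ {n} (a b : Term A n) → Term A n
    a andᵗ b     = iteᵗ a b zero
    impliesᵗ a b = iteᵗ a b oneᵗ

    -- Each round returns its index, and the last of a rounds has index a - 1.
    predᵗ : ∀ {n} → Term A n → Term A n
    predᵗ a = rec a a zero (var (suc zero))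

    monusᵗ leᵗ plusᵗ timesᵗ : ∀ {n} (a b : Term A n) → Term A n
    monusᵗ a b = rec a b a (predᵗ (var zero))
    leᵗ a b    = notᵗ (monusᵗ a b)
    plusᵗ a b  = sum a b oneᵗ
    timesᵗ a b = sum zero a (wk b)

    powerᵗ : ∀ {n} → Term A n → ℕ → Term A n
    powerᵗ a zero    = oneᵗ
    powerᵗ a (suc c) = timesᵗ a (powerᵗ a c)

    literalᵗ : ∀ {n} → ℕ → Term A n
    literalᵗ zero    = zero
    literalᵗ (suc k) = suc (literalᵗ k)

    countᵗ existsᵗ forallᵗ : ∀ {n} → Term A n → Term A (suc n) → Term A n
    countᵗ a φ  = sum zero a (iteᵗ φ oneᵗ zero)
    existsᵗ a φ = countᵗ a φ
    forallᵗ a φ = notᵗ (existsᵗ a (notᵗ φ))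

    -- The recursion is ⌊(k+1)/2⌋ = ⌈k/2⌉ = k - ⌊k/2⌋.
    halfᵗ oddᵗ : ∀ {n} → Term A n → Term A n
    halfᵗ a = rec a a zero (monusᵗ (var (suc zero)) (var zero))
    oddᵗ a  = monusᵗ a (plusᵗ (halfᵗ a) (halfᵗ a))

  module Evaluation (w : List A) where

    holds : ∀ {n} → Term A n → Vec ℕ n → Bool
    holds φ vs = 0 <ᵇ eval w φ vs

    module _ {n} (vs : Vec ℕ n) where

      private
        ⟦_⟧ᵗ : Term A n → ℕ
        ⟦ t ⟧ᵗ = eval w t vs

      opaque
        unfolding iteᵗ notᵗ _andᵗ_ impliesᵗ predᵗ monusᵗ leᵗ plusᵗ timesᵗ powerᵗ literalᵗ countᵗ existsᵗ forallᵗ halfᵗ oddᵗ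

        eval-ite : ∀ c a b → ⟦ iteᵗ c a b ⟧ᵗ ≡ (if holds c vs then ⟦ a ⟧ᵗ else ⟦ b ⟧ᵗ)
        eval-ite c a b with ⟦ c ⟧ᵗ
        ... | zero  = refl
        ... | suc k = ⊓-idem ⟦ a ⟧ᵗ

        eval-not : ∀ a → ⟦ notᵗ a ⟧ᵗ ≡ bit (not (holds a vs))
        eval-not a rewrite eval-ite a zero oneᵗ with holds a vs
        ... | true  = refl
        ... | false = refl

        holds-bit : ∀ b → (0 <ᵇ bit b) ≡ b
        holds-bit true  = refl
        holds-bit false = refl

        holds-not : ∀ a → holds (notᵗ a) vs ≡ not (holds a vs)
        holds-not a = trans (cong (0 <ᵇ_) (eval-not a)) (holds-bit _)

        holds-and : ∀ a b → holds (a andᵗ b) vs ≡ (holds a vs ∧ holds b vs)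
        holds-and a b rewrite eval-ite a b zero with holds a vs
        ... | true  = refl
        ... | false = refl

        holds-implies : ∀ a b → holds (impliesᵗ a b) vs ≡ implies (holds a vs) (holds b vs)
        holds-implies a b rewrite eval-ite a b oneᵗ with holds a vs
        ... | true  = refl
        ... | false = refl

        holds-look : ∀ f a → holds (look f a) vs ≡ f (cellAt w ⟦ a ⟧ᵗ)
        holds-look f a = holds-bit _

        eval-pred : ∀ a → ⟦ predᵗ a ⟧ᵗ ≡ pred ⟦ a ⟧ᵗ
        eval-pred a with ⟦ a ⟧ᵗ
        ... | zero  = refl
        ... | suc k = m≤n⇒m⊓n≡m (n≤1+n k)

        eval-plus : ∀ a b → ⟦ plusᵗ a b ⟧ᵗ ≡ ⟦ a ⟧ᵗ + ⟦ b ⟧ᵗ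
        eval-plus a b = trans (count-up ⟦ b ⟧ᵗ) (+-comm ⟦ b ⟧ᵗ ⟦ a ⟧ᵗ)
          where
          count-up : ∀ k → total ⟦ a ⟧ᵗ (λ _ → 1) k ≡ k + ⟦ a ⟧ᵗ
          count-up zero    = refl
          count-up (suc k) = cong suc (count-up k)

        eval-times : ∀ a b → ⟦ timesᵗ a b ⟧ᵗ ≡ ⟦ a ⟧ᵗ * ⟦ b ⟧ᵗ
        eval-times a b = add-up ⟦ a ⟧ᵗ
          where
          add-up : ∀ k → total 0 (λ _ → ⟦ b ⟧ᵗ) k ≡ k * ⟦ b ⟧ᵗ
          add-up zero    = refl
          add-up (suc k) = cong (⟦ b ⟧ᵗ +_) (add-up k)

        eval-literal : ∀ k → ⟦ literalᵗ k ⟧ᵗ ≡ k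
        eval-literal zero    = refl
        eval-literal (suc k) = cong suc (eval-literal k)

    module _ {n} (vs : Vec ℕ n) where

      private
        ⟦_⟧ᵗ : Term A n → ℕ
        ⟦ t ⟧ᵗ = eval w t vs

      opaque
        unfolding iteᵗ notᵗ _andᵗ_ impliesᵗ predᵗ monusᵗ leᵗ plusᵗ timesᵗ powerᵗ literalᵗ countᵗ existsᵗ forallᵗ halfᵗ oddᵗ

        eval-power : ∀ a c → ⟦ powerᵗ a c ⟧ᵗ ≡ ⟦ a ⟧ᵗ ^ c
        eval-power a zero    = refl
        eval-power a (suc c) = trans (eval-times vs a (powerᵗ a c)) (cong (⟦ a ⟧ᵗ *_) (eval-power a c))

        eval-monus : ∀ a b → ⟦ monusᵗ a b ⟧ᵗ ≡ ⟦ a ⟧ᵗ ∸ ⟦ b ⟧ᵗ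
        eval-monus a b = down ⟦ b ⟧ᵗ
          where
          R : ℕ → ℕ
          R = capped ⟦ a ⟧ᵗ ⟦ a ⟧ᵗ (λ i r → eval w (predᵗ (var zero)) (r ∷ i ∷ vs))

          down : ∀ k → R k ≡ ⟦ a ⟧ᵗ ∸ k
          down zero = refl
          down (suc k) = trans
            (cong (_⊓ ⟦ a ⟧ᵗ) (trans (eval-pred (R k ∷ k ∷ vs) (var zero))
              (trans (cong pred (down k)) (pred[m∸n]≡m∸[1+n] ⟦ a ⟧ᵗ k))))
            (m≤n⇒m⊓n≡m (m∸n≤m ⟦ a ⟧ᵗ (suc k)))

        holds-le : ∀ a b → holds (leᵗ a b) vs ≡ (⟦ a ⟧ᵗ ≤ᵇ ⟦ b ⟧ᵗ)
        holds-le a b = trans (holds-not vs (monusᵗ a b))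
          (trans (cong (λ k → not (0 <ᵇ k)) (eval-monus a b)) (monus-le ⟦ a ⟧ᵗ ⟦ b ⟧ᵗ))
          where
          monus-le : ∀ x y → not (0 <ᵇ (x ∸ y)) ≡ (x ≤ᵇ y)
          monus-le zero          y       = cong (λ k → not (0 <ᵇ k)) (0∸n≡0 y)
          monus-le (suc x)       zero    = refl
          monus-le (suc zero)    (suc y) = monus-le zero y
          monus-le (suc (suc x)) (suc y) = monus-le (suc x) y

        eval-count : ∀ a φ → ⟦ countᵗ a φ ⟧ᵗ ≡ countTo (λ i → holds φ (i ∷ vs)) ⟦ a ⟧ᵗ
        eval-count a φ = tally ⟦ a ⟧ᵗ
          where
          tally : ∀ k → total 0 (λ i → eval w (iteᵗ φ oneᵗ zero) (i ∷ vs)) k ≡ countTo (λ i → holds φ (i ∷ vs)) k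
          tally zero    = refl
          tally (suc k) = cong₂ _+_ (eval-ite (k ∷ vs) φ oneᵗ zero) (tally k)

        holds-exists : ∀ a φ → holds (existsᵗ a φ) vs ≡ existsTo (λ i → holds φ (i ∷ vs)) ⟦ a ⟧ᵗ
        holds-exists a φ = cong (0 <ᵇ_) (eval-count a φ)

        holds-forall : ∀ a φ → holds (forallᵗ a φ) vs ≡ forallTo (λ i → holds φ (i ∷ vs)) ⟦ a ⟧ᵗ
        holds-forall a φ = trans (holds-not vs (existsᵗ a (notᵗ φ)))
          (cong not (trans (holds-exists a (notᵗ φ)) (existsTo-cong ⟦ a ⟧ᵗ λ i _ → holds-not (i ∷ vs) φ)))

    module _ {n} (vs : Vec ℕ n) where

      opaque
        unfolding iteᵗ notᵗ _andᵗ_ impliesᵗ predᵗ monusᵗ leᵗ plusᵗ timesᵗ powerᵗ literalᵗ countᵗ existsᵗ forallᵗ halfᵗ oddᵗ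

        eval-half : ∀ a → eval w (halfᵗ a) vs ≡ ⌊ eval w a vs /2⌋
        eval-half a = halves (eval w a vs) ≤-refl
          where
          R : ℕ → ℕ
          R = capped (eval w a vs) 0 (λ i r → eval w (monusᵗ (var (suc zero)) (var zero)) (r ∷ i ∷ vs))

          halves : ∀ k → k ≤ eval w a vs → R k ≡ ⌊ k /2⌋
          halves zero    _ = refl
          halves (suc k) k<a = trans
            (cong (_⊓ eval w a vs) (trans (eval-monus (R k ∷ k ∷ vs) (var (suc zero)) (var zero))
              (trans (cong (k ∸_) (halves k (<⇒≤ k<a))) other-half)))
            (m≤n⇒m⊓n≡m (≤-trans (⌈n/2⌉≤n k) (<⇒≤ k<a)))
            where
            other-half : k ∸ ⌊ k /2⌋ ≡ ⌈ k /2⌉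
            other-half = trans (cong (_∸ ⌊ k /2⌋) (trans (sym (⌊n/2⌋+⌈n/2⌉≡n k)) (+-comm ⌊ k /2⌋ ⌈ k /2⌉)))
              (m+n∸n≡m ⌈ k /2⌉ ⌊ k /2⌋)

        holds-odd : ∀ a → holds (oddᵗ a) vs ≡ odd (eval w a vs)
        holds-odd a = cong (0 <ᵇ_) (trans (eval-monus vs a (plusᵗ (halfᵗ a) (halfᵗ a)))
          (cong (eval w a vs ∸_) (trans (eval-plus vs (halfᵗ a) (halfᵗ a)) (cong₂ _+_ (eval-half a) (eval-half a)))))

-- Terms about the input word

weight : (ℕ → Bool) → ℕ → ℕ
weight f zero    = 0
weight f (suc n) = weight f n + bit (f n) * 2 ^ n

⌈/2⌉≤ : ∀ {x k} → x ≤ k + k → ⌈ x /2⌉ ≤ k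
⌈/2⌉≤ {x} {k} p = ≤-trans (⌈n/2⌉-mono p) (≤-reflexive (sym (n≡⌈n+n/2⌉ k)))

≤⌈/2⌉ : ∀ {x k} → ⌈ x /2⌉ ≤ k → x ≤ k + k
≤⌈/2⌉ {x} p = ≤-trans (≤-reflexive (sym (⌊n/2⌋+⌈n/2⌉≡n x)))
  (+-mono-≤ (≤-trans (⌊n/2⌋≤⌈n/2⌉ x) p) p)

≤ᵇ-cong : ∀ {a b c d} → (a ≤ b ⇔ c ≤ d) → (a ≤ᵇ b) ≡ (c ≤ᵇ d)
≤ᵇ-cong {a} {b} {c} {d} e = does-⇔ e (a ≤? b) (c ≤? d)

-- Whether a·P ≤ c·Q for numbers P and Q given by their bits, with all
-- intermediate values at most a + c: since the complement of Q is
-- 2ⁿ − 1 − Q, the inequality says that c + a·P + c·(complement of Q) is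
-- at most c·2ⁿ, and the left-hand side is added up from the least
-- significant bit on, keeping only the carry, rounded up.
module Comparison (a c : ℕ) (P Q : ℕ → Bool) where

  addend : ℕ → ℕ
  addend n = a * bit (P n) + c * bit (not (Q n))

  carry : ℕ → ℕ
  carry zero    = c
  carry (suc n) = ⌈ carry n + addend n /2⌉

  added : ℕ → ℕ
  added zero    = 0
  added (suc n) = added n + addend n * 2 ^ n

  addend≤ : ∀ n → addend n ≤ a + c
  addend≤ n = +-mono-≤ (at-most a (P n)) (at-most c (not (Q n)))
    where
    at-most : ∀ x b → x * bit b ≤ x
    at-most x true  = ≤-reflexive (*-identityʳ x)
    at-most x false = ≤-trans (≤-reflexive (*-zeroʳ x)) z≤n

  carry≤ : ∀ n → carry n ≤ a + c
  carry≤ zero    = m≤n+m c a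
  carry≤ (suc n) = ⌈/2⌉≤ (+-mono-≤ (carry≤ n) (addend≤ n))

  -- Rounding up loses nothing, because x/2 and ⌈x/2⌉ lie below the same integers. The quantifier
  -- over k is needed: the induction passes from k to 2k minus the current addend.
  carry-bound : ∀ n k → carry n ≤ k ⇔ c + added n ≤ k * 2 ^ n
  carry-bound zero k rewrite +-identityʳ c | *-identityʳ k = mk⇔ (λ p → p) (λ p → p)
  carry-bound (suc n) k = mk⇔ fwd bwd
    where
    y = addend n

    regroup : ∀ c s y t → c + (s + y * t) ≡ (c + s) + y * t
    regroup = solve-∀

    split : ∀ r → r + y ≡ k + k → r * 2 ^ n + y * 2 ^ n ≡ k * 2 ^ suc n
    split r e = trans (sym (*-distribʳ-+ (2 ^ n) r y)) (trans (cong (_* 2 ^ n) e) (twice k (2 ^ n)))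
      where
      twice : ∀ k t → (k + k) * t ≡ k * (2 * t)
      twice = solve-∀

    fwd : carry (suc n) ≤ k → c + added (suc n) ≤ k * 2 ^ suc n
    fwd p with m≤n⇒∃[o]m+o≡n (m+n≤o⇒n≤o (carry n) (≤⌈/2⌉ p))
    ... | r , e = ≤-trans (≤-reflexive (regroup c (added n) y (2 ^ n)))
      (≤-trans (+-monoˡ-≤ (y * 2 ^ n) (Equivalence.to (carry-bound n r)
          (+-cancelʳ-≤ y (carry n) r (≤-trans (≤⌈/2⌉ p) (≤-reflexive (sym (trans (+-comm r y) e)))))))
        (≤-reflexive (split r (trans (+-comm r y) e))))

    bwd : c + added (suc n) ≤ k * 2 ^ suc n → carry (suc n) ≤ k
    bwd p with m≤n⇒∃[o]m+o≡n (*-cancelʳ-≤ y (k + k) (2 ^ n) {{m^n≢0 2 n}} y≤)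
      where
      twice : ∀ k t → k * (2 * t) ≡ (k + k) * t
      twice = solve-∀

      y≤ : y * 2 ^ n ≤ (k + k) * 2 ^ n
      y≤ = ≤-trans (≤-trans (m≤n+m (y * 2 ^ n) (c + added n)) (≤-reflexive (sym (regroup c (added n) y (2 ^ n)))))
        (≤-trans p (≤-reflexive (twice k (2 ^ n))))
    ... | r , e = ⌈/2⌉≤ (≤-trans
      (+-monoˡ-≤ y (Equivalence.from (carry-bound n r) (+-cancelʳ-≤ (y * 2 ^ n) (c + added n) (r * 2 ^ n)
        (≤-trans (≤-reflexive (sym (regroup c (added n) y (2 ^ n))))
          (≤-trans p (≤-reflexive (sym (split r (trans (+-comm r y) e)))))))))
      (≤-reflexive (trans (+-comm r y) e)))

  -- A bit of `Q` and its complement add up to 1, so the multiples of `c` amount to c·2ⁿ whatever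
  -- `Q` is.
  added-weight : ∀ n → (c + added n) + c * weight Q n ≡ a * weight P n + c * 2 ^ n
  added-weight zero = base a c
    where
    base : ∀ a c → (c + 0) + c * 0 ≡ a * 0 + c * 1
    base = solve-∀
  added-weight (suc n) = trans (gather c a (added n) (bit (P n)) (bit (not (Q n))) (bit (Q n)) (weight Q n) (2 ^ n))
    (trans (cong₂ (λ u v → u + (a * bit (P n) + c * v) * 2 ^ n) (added-weight n) (complement (Q n)))
      (spread c a (bit (P n)) (weight P n) (2 ^ n)))
    where
    gather : ∀ c a s p q′ q v t → (c + (s + (a * p + c * q′) * t)) + c * (v + q * t)
                                ≡ ((c + s) + c * v) + (a * p + c * (q′ + q)) * t
    gather = solve-∀

    spread : ∀ c a p v t → (a * v + c * t) + (a * p + c * 1) * t ≡ a * (v + p * t) + c * (2 * t)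
    spread = solve-∀

    complement : ∀ b → bit (not b) + bit b ≡ 1
    complement true  = refl
    complement false = refl

  carry≤c : ∀ n → carry n ≤ c ⇔ a * weight P n ≤ c * weight Q n
  carry≤c n = mk⇔
    (λ p → +-cancelʳ-≤ (c * 2 ^ n) (a * weight P n) (c * weight Q n)
      (≤-trans (≤-reflexive (sym (added-weight n)))
        (≤-trans (+-monoˡ-≤ (c * weight Q n) (Equivalence.to (carry-bound n c) p)) (≤-reflexive (+-comm (c * 2 ^ n) _)))))
    (λ p → Equivalence.from (carry-bound n c) (+-cancelʳ-≤ (c * weight Q n) (c + added n) (c * 2 ^ n)
      (≤-trans (≤-reflexive (added-weight n))
        (≤-trans (+-monoˡ-≤ (c * 2 ^ n) p) (≤-reflexive (+-comm (c * weight Q n) _))))))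

module _ {A : Set} where

  -- The recursion computes `Comparison.carry`, so `P` and `Q` see the carry as variable 0 and the
  -- index of the bit as variable 1. By `carry≤` the cap never takes effect.
  compareᵗ : ∀ {n} (m a c : Term A n) (P Q : Term A (2 + n)) → Term A n
  compareᵗ m a c P Q =
    leᵗ (rec (plusᵗ a c) m c (halfᵗ (suc (plusᵗ (var zero)
           (plusᵗ (iteᵗ P (wk (wk a)) zero) (iteᵗ Q zero (wk (wk c)))))))) c

  nth : List A → ℕ → InputCell A
  nth []      _       = ⊣
  nth (a ∷ w) zero    = letter a
  nth (a ∷ w) (suc k) = nth w k

  runRight : Tape (InputCell A) → ℕ → Tape (InputCell A)
  runRight t zero    = t
  runRight t (suc k) = runRight (moveInput right t) k

  headAt-runRight : ∀ w k t j → t ≡ headAt w j → runRight t k ≡ headAt w (k + j)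
  headAt-runRight w zero    t j e = e
  headAt-runRight w (suc k) t j e =
    trans (headAt-runRight w k (moveInput right t) (suc j) (cong (moveInput right) e)) (cong (headAt w) (+-suc k j))

  runRight-nth : ∀ l x w k → scan (runRight (tape l x (List.map letter w ++ ⊣ ∷ [])) (suc k)) ≡ nth w k
  runRight-nth l x []      zero    = refl
  runRight-nth l x (a ∷ w) zero    = refl
  runRight-nth l x (a ∷ w) (suc k) = runRight-nth (x ∷ l) (letter a) w k
  runRight-nth l x []      (suc k) = at-end k
    where
    at-end : ∀ k → scan (runRight (tape (x ∷ l) ⊣ []) (suc k)) ≡ ⊣
    at-end zero    = refl
    at-end (suc k) = at-end k

  cellAt-suc : ∀ w k → cellAt w (suc k) ≡ nth w k
  cellAt-suc w k = trans
    (cong scan (sym (trans (headAt-runRight w (suc k) (inputTape w) 0 refl) (cong (headAt w) (+-identityʳ (suc k))))))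
    (runRight-nth [] ⊢ w k)

  is : (A → Bool) → InputCell A → Bool
  is p (letter a) = p a
  is p _          = false

  occurrences : (A → Bool) → List A → ℕ
  occurrences p []      = 0
  occurrences p (a ∷ w) = bit (p a) + occurrences p w

  occurrences-++ : ∀ p u v → occurrences p (u ++ v) ≡ occurrences p u + occurrences p v
  occurrences-++ p []      v = refl
  occurrences-++ p (a ∷ u) v =
    trans (cong (bit (p a) +_) (occurrences-++ p u v)) (sym (+-assoc (bit (p a)) (occurrences p u) _))

  countTo-suc : ∀ p n → countTo p (suc n) ≡ bit (p 0) + countTo (p ∘ suc) n
  countTo-suc p zero    = refl
  countTo-suc p (suc n) = trans (cong (bit (p (suc n)) +_) (countTo-suc p n)) (swap (bit (p (suc n))) (bit (p 0)) _)
    where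
    swap : ∀ a b c → a + (b + c) ≡ b + (a + c)
    swap = solve-∀

  countTo-occurrences : ∀ p w → countTo (λ k → is p (nth w k)) (length w) ≡ occurrences p w
  countTo-occurrences p []      = refl
  countTo-occurrences p (a ∷ w) =
    trans (countTo-suc (λ k → is p (nth (a ∷ w) k)) (length w)) (cong (bit (p a) +_) (countTo-occurrences p w))

  -- The prefixes with at most g occurrences are those that end before occurrence number g, counted
  -- from 0; their number is its position. Thus counting does the work of a search.
  position : (A → Bool) → List A → ℕ → ℕ
  position p w g = countTo (λ q → countTo (λ k → is p (nth w k)) (suc q) ≤ᵇ g) (length w)

  countTo-none : ∀ {p} n → (∀ i → i < n → p i ≡ false) → countTo p n ≡ 0
  countTo-none zero    e = refl
  countTo-none {p} (suc n) e rewrite e n ≤-refl = countTo-none n λ i i<n → e i (m≤n⇒m≤1+n i<n)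

  position-occurrence : ∀ p u a v → p a ≡ true → position p (u ++ a ∷ v) (occurrences p u) ≡ length u
  position-occurrence p [] a v pa = countTo-none (suc (length v)) λ q _ →
    cong (_≤ᵇ 0) (trans (countTo-suc (λ k → is p (nth (a ∷ v) k)) q) (cong (λ b → bit b + countTo (λ k → is p (nth v k)) q) pa))
  position-occurrence p (x ∷ u) a v pa =
    trans (countTo-suc (λ q → countTo (λ k → is p (nth (x ∷ u ++ a ∷ v) k)) (suc q) ≤ᵇ occurrences p (x ∷ u)) (length (u ++ a ∷ v)))
      (cong₂ _+_ (first (p x))
        (trans (countTo-cong (length (u ++ a ∷ v)) λ q _ →
            trans (cong (_≤ᵇ occurrences p (x ∷ u)) (countTo-suc (λ k → is p (nth (x ∷ u ++ a ∷ v) k)) (suc q)))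
              (+-cancel-≤ᵇ (bit (p x)) _ _))
          (position-occurrence p u a v pa)))
    where
    first : ∀ b → bit ((bit b + 0) ≤ᵇ (bit b + occurrences p u)) ≡ 1
    first true  = refl
    first false = refl

    +-cancel-≤ᵇ : ∀ k a b → ((k + a) ≤ᵇ (k + b)) ≡ (a ≤ᵇ b)
    +-cancel-≤ᵇ k a b = ≤ᵇ-cong (mk⇔ (+-cancelˡ-≤ k a b) (+-monoʳ-≤ k))

  nth-++ : ∀ u v k → nth (u ++ v) (length u + k) ≡ nth v k
  nth-++ []      v k = refl
  nth-++ (x ∷ u) v k = nth-++ u v k

  lookᵗ : ∀ {n} → (A → Bool) → Term A n → Term A n
  lookᵗ p k = look (is p) (suc k)

  occurrencesᵗ : (A → Bool) → Term A 1
  occurrencesᵗ p = countᵗ (var zero) (lookᵗ p (var zero))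

  occurrences-upToᵗ positionᵗ : (A → Bool) → Term A 2
  occurrences-upToᵗ p = countᵗ (suc (var zero)) (lookᵗ p (var zero))
  positionᵗ p = countᵗ (var (suc zero)) (leᵗ (call (occurrences-upToᵗ p) (zero ∷ suc zero ∷ [])) (var (suc zero)))

  -- Variables: index i, start of the field, end of the field.  The first
  -- symbol of the field opens it and does not count.
  fieldᵗ : (A → Bool) → Term A 3
  fieldᵗ p = lookᵗ p k andᵗ leᵗ (suc k) (var (suc (suc zero)))
    where k = suc (plusᵗ (var (suc zero)) (var zero))

  module Lookups (w : List A) where

    open Evaluation w public

    holds-lookᵗ : ∀ {n} (vs : Vec ℕ n) p t → holds (lookᵗ p t) vs ≡ is p (nth w (eval w t vs))
    holds-lookᵗ vs p t = trans (holds-look vs (is p) (suc t)) (cong (is p) (cellAt-suc w (eval w t vs)))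

    eval-occurrences : ∀ p → eval w (occurrencesᵗ p) (length w ∷ []) ≡ occurrences p w
    eval-occurrences p = trans (eval-count (length w ∷ []) (var zero) (lookᵗ p (var zero)))
      (trans (countTo-cong (length w) λ k _ → holds-lookᵗ (k ∷ length w ∷ []) p (var zero))
        (countTo-occurrences p w))

    eval-position : ∀ p g → eval w (positionᵗ p) (g ∷ length w ∷ []) ≡ position p w g
    eval-position p g = trans
      (eval-count (g ∷ length w ∷ []) (var (suc zero))
        (leᵗ (call (occurrences-upToᵗ p) (zero ∷ suc zero ∷ [])) (var (suc zero))))
      (countTo-cong (length w) λ q _ → trans
        (holds-le (q ∷ g ∷ length w ∷ []) (call (occurrences-upToᵗ p) (zero ∷ suc zero ∷ [])) (var (suc zero)))
        (cong (_≤ᵇ g) (trans (eval-count (q ∷ g ∷ []) (suc (var zero)) (lookᵗ p (var zero)))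
          (countTo-cong (suc q) λ k _ → holds-lookᵗ (k ∷ q ∷ g ∷ []) p (var zero)))))

    holds-compare : ∀ {n} (vs : Vec ℕ n) m a c P Q {P′ Q′ : ℕ → Bool} →
      (∀ r i → holds P (r ∷ i ∷ vs) ≡ P′ i) → (∀ r i → holds Q (r ∷ i ∷ vs) ≡ Q′ i) →
      holds (compareᵗ m a c P Q) vs
        ≡ (eval w a vs * weight P′ (eval w m vs) ≤ᵇ eval w c vs * weight Q′ (eval w m vs))
    holds-compare vs m a c P Q {P′} {Q′} eP eQ = trans (holds-le vs (rec (plusᵗ a c) m c (halfᵗ (suc (plusᵗ (var zero) s)))) c)
      (trans (cong (_≤ᵇ eval w c vs) (carries (eval w m vs))) (≤ᵇ-cong (carry≤c (eval w m vs))))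
      where
      open Comparison (eval w a vs) (eval w c vs) P′ Q′

      s : Term A (2 + _)
      s = plusᵗ (iteᵗ P (wk (wk a)) zero) (iteᵗ Q zero (wk (wk c)))

      R : ℕ → ℕ
      R = capped (eval w (plusᵗ a c) vs) (eval w c vs) (λ i r → eval w (halfᵗ (suc (plusᵗ (var zero) s))) (r ∷ i ∷ vs))

      adds : ∀ r i → eval w s (r ∷ i ∷ vs) ≡ addend i
      adds r i = trans (eval-plus (r ∷ i ∷ vs) (iteᵗ P (wk (wk a)) zero) (iteᵗ Q zero (wk (wk c))))
        (cong₂ _+_
          (trans (eval-ite (r ∷ i ∷ vs) P (wk (wk a)) zero) (trans (cong (if_then eval w a vs else 0) (eP r i)) (select (P′ i))))
          (trans (eval-ite (r ∷ i ∷ vs) Q zero (wk (wk c))) (trans (cong (if_then 0 else eval w c vs) (eQ r i)) (unselect (Q′ i)))))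
        where
        select : ∀ b {x} → (if b then x else 0) ≡ x * bit b
        select true  = sym (*-identityʳ _)
        select false {x} = sym (*-zeroʳ x)

        unselect : ∀ b {x} → (if b then 0 else x) ≡ x * bit (not b)
        unselect true {x}  = sym (*-zeroʳ x)
        unselect false = sym (*-identityʳ _)

      carries : ∀ i → R i ≡ carry i
      carries zero = refl
      carries (suc i) = trans
        (cong₂ _⊓_
          (trans (eval-half (R i ∷ i ∷ vs) (suc (plusᵗ (var zero) s)))
            (cong ⌈_/2⌉ (trans (eval-plus (R i ∷ i ∷ vs) (var zero) s) (cong₂ _+_ (carries i) (adds (R i) i)))))
          (eval-plus vs a c))
        (m≤n⇒m⊓n≡m (carry≤ (suc i)))

    nth-≥ : ∀ (u : List A) k → length u ≤ k → nth u k ≡ ⊣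
    nth-≥ []      k       _       = refl
    nth-≥ (x ∷ u) (suc k) (s≤s p) = nth-≥ u k p

    holds-field : ∀ p u a ds v i → w ≡ u ++ a ∷ ds ++ v →
                  holds (fieldᵗ p) (i ∷ length u ∷ suc (length u + length ds) ∷ []) ≡ is p (nth ds i)
    holds-field p u a ds v i refl = trans (holds-and vs (lookᵗ p k) (leᵗ (suc k) end))
      (trans (cong₂ _∧_
          (trans (holds-lookᵗ vs p k) (cong (is p) (trans (cong (nth w) at-k) (nth-++ u (a ∷ ds ++ v) (suc i)))))
          (trans (holds-le vs (suc k) end) (cong (λ n → suc (suc n) ≤ᵇ suc (length u + length ds)) (eval-plus vs start index))))
        (trans (cong (is p (nth (ds ++ v) i) ∧_) (≤ᵇ-cong {suc (suc (length u + i))} {d = length ds} (mk⇔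
            (λ q → +-cancelˡ-≤ (length u) (suc i) (length ds) (≤-trans (≤-reflexive (+-suc (length u) i)) (≤-pred q)))
            (λ q → s≤s (≤-trans (≤-reflexive (sym (+-suc (length u) i))) (+-monoʳ-≤ (length u) q))))))
          (inside ds i)))
      where
      vs : Vec ℕ 3
      vs = i ∷ length u ∷ suc (length u + length ds) ∷ []
      index start end k : Term A 3
      index = var zero
      start = var (suc zero)
      end   = var (suc (suc zero))
      k     = suc (plusᵗ start index)

      at-k : eval w k vs ≡ length u + suc i
      at-k = trans (cong suc (eval-plus vs start index)) (sym (+-suc (length u) i))

      inside : ∀ ds i → (is p (nth (ds ++ v) i) ∧ (suc i ≤ᵇ length ds)) ≡ is p (nth ds i)
      inside []       i       = ∧-zeroʳ _
      inside (d ∷ ds) zero    = ∧-identityʳ _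
      inside (d ∷ ds) (suc i) = inside ds i

-- Searching for a set of attributes

isAttr isTuple isCell isParam isNull isOver isBit1 : Symbol → Bool
isAttr attr = true
isAttr _    = false
isTuple tuple = true
isTuple _     = false
isCell cell = true
isCell _    = false
isParam param = true
isParam _     = false
isNull null = true
isNull _    = false
isOver over = true
isOver _    = false
isBit1 bit1 = true
isBit1 _    = false

-- The number m selects a subset of the non-null attributes of a row: each
-- of these consumes one binary digit of m, starting from the lowest.
unread : (ℕ → Bool) → ℕ → ℕ → ℕ
unread row m zero    = m
unread row m (suc i) = if row i then ⌊ unread row m i /2⌋ else unread row m i

selected : (ℕ → Bool) → ℕ → ℕ → Bool
selected row m i = row i ∧ odd (unread row m i)

unread≤ : ∀ row m i → unread row m i ≤ m
unread≤ row m zero = ≤-refl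
unread≤ row m (suc i) with row i
... | true  = ≤-trans (⌊n/2⌋≤n (unread row m i)) (unread≤ row m i)
... | false = unread≤ row m i

module Search (nonnull : ℕ → ℕ → Bool) (n T : ℕ) where

  nontrivial : (ℕ → Bool) → Bool
  nontrivial W = forallTo (λ i → implies (W i) (existsTo (λ j → not (nonnull j i)) T)) n

  support : (ℕ → Bool) → ℕ
  support W = countTo (λ j → forallTo (λ i → implies (W i) (nonnull j i)) n) T

  Accepted : (k p q : ℕ) → (ℕ → Bool) → Set
  Accepted k p q W = 2 ≤ countTo W n × k ≤ countTo W n × nontrivial W ≡ true × T * p ≤ support W * q

  acceptable : (k u p q : ℕ) → (ℕ → Bool) → Bool
  acceptable k u p q W =
    -- The bound k is accessible only through its digits and `compareᵗ` multiplies each side by a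
    -- number given by digits, so the other side gets a factor `u`, whose digits will be those of 1.
    (2 ≤ᵇ countTo W n) ∧ (1 * k ≤ᵇ countTo W n * u) ∧ nontrivial W ∧ (T * p ≤ᵇ support W * q)

  found : (k u p q d : ℕ) → Bool
  found k u p q d = existsTo (λ j → existsTo (λ m → acceptable k u p q (selected (nonnull j) m)) d) T

-- Variables: i, j, n, N.
nonnullᵗ : Term Symbol 4
nonnullᵗ =
  lett (plusᵗ (timesᵗ (var (# 1)) (var (# 2))) (var (# 0)))
  (lett (call (positionᵗ isCell) (# 0 ∷ # 4 ∷ []))
  (notᵗ (lookᵗ isNull (suc (var (# 0))))))

-- Variables: i, m, j, n, N.
unreadᵗ selectedᵗ : Term Symbol 5
unreadᵗ = rec (var (# 1)) (var (# 0)) (var (# 1))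
  (iteᵗ (call nonnullᵗ (# 1 ∷ # 4 ∷ # 5 ∷ # 6 ∷ [])) (halfᵗ (var (# 0))) (var (# 0)))
selectedᵗ = call nonnullᵗ (# 0 ∷ # 2 ∷ # 3 ∷ # 4 ∷ []) andᵗ oddᵗ unreadᵗ

-- Variables: m, j, n, N.
sizeᵗ : Term Symbol 4
sizeᵗ = countᵗ (var (# 2)) selectedᵗ

-- Variables: i, n, N, T.
missingᵗ : Term Symbol 4
missingᵗ = existsᵗ (var (# 3)) (notᵗ (call nonnullᵗ (# 1 ∷ # 0 ∷ # 2 ∷ # 3 ∷ [])))

-- Variables: j′, m, j, n, N.
coveredᵗ : Term Symbol 5
coveredᵗ = forallᵗ (var (# 3))
  (impliesᵗ (call selectedᵗ (# 0 ∷ # 2 ∷ # 3 ∷ # 4 ∷ # 5 ∷ [])) (call nonnullᵗ (# 0 ∷ # 1 ∷ # 4 ∷ # 5 ∷ [])))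

-- Variables: m, j, n, N, T.
nontrivialᵗ supportᵗ : Term Symbol 5
nontrivialᵗ = forallᵗ (var (# 2))
  (impliesᵗ (call selectedᵗ (# 0 ∷ # 1 ∷ # 2 ∷ # 3 ∷ # 4 ∷ [])) (call missingᵗ (# 0 ∷ # 3 ∷ # 4 ∷ # 5 ∷ [])))
supportᵗ = countᵗ (var (# 4)) (call coveredᵗ (# 0 ∷ # 1 ∷ # 2 ∷ # 3 ∷ # 4 ∷ []))

-- Variables: P₂, O, i.
numeratorᵗ : Term Symbol 3
numeratorᵗ = lett (suc (var (# 0))) (call (fieldᵗ isBit1) (# 3 ∷ # 0 ∷ # 2 ∷ []))

-- Variables: support, size, N, T, P₁, P₂, O, where P₁ and P₂ are the
-- positions of the symbols `param` and O is the last one of `over`.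
longᵗ frequentᵗ : Term Symbol 7
longᵗ = compareᵗ (var (# 2)) oneᵗ (var (# 1))
  (call (fieldᵗ isBit1) (# 1 ∷ # 6 ∷ # 7 ∷ [])) (notᵗ (var (# 1)))
frequentᵗ = compareᵗ (var (# 2)) (var (# 3)) (var (# 0))
  (call numeratorᵗ (# 7 ∷ # 8 ∷ # 1 ∷ [])) (call (fieldᵗ isBit1) (# 1 ∷ # 8 ∷ # 4 ∷ []))

-- Variables: m, j, n, N, T, P₁, P₂, O.
acceptableᵗ : Term Symbol 8
acceptableᵗ =
  lett (call sizeᵗ (# 0 ∷ # 1 ∷ # 2 ∷ # 3 ∷ []))
  (lett (call supportᵗ (# 1 ∷ # 2 ∷ # 3 ∷ # 4 ∷ # 5 ∷ []))
  (leᵗ (suc oneᵗ) (var (# 1))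
  andᵗ call longᵗ (# 0 ∷ # 1 ∷ # 5 ∷ # 6 ∷ # 7 ∷ # 8 ∷ # 9 ∷ [])
  andᵗ call nontrivialᵗ (# 2 ∷ # 3 ∷ # 4 ∷ # 5 ∷ # 6 ∷ [])
  andᵗ call frequentᵗ (# 0 ∷ # 1 ∷ # 5 ∷ # 6 ∷ # 7 ∷ # 8 ∷ # 9 ∷ [])))

-- Variables: O, P₂, P₁, T, n, N.
searchᵗ : (c₀ c : ℕ) → Term Symbol 6
searchᵗ c₀ c = existsᵗ (var (# 3))
  (existsᵗ (timesᵗ (literalᵗ c₀) (powerᵗ (var (# 5)) c))
  (call acceptableᵗ (# 0 ∷ # 1 ∷ # 6 ∷ # 7 ∷ # 5 ∷ # 4 ∷ # 3 ∷ # 2 ∷ [])))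

-- `over` also occurs in the numeric constants of the database, so the one belonging to s is
-- identified as the last; the symbols `param` open k and s and occur nowhere else.
problemᵗ : (c₀ c : ℕ) → Term Symbol 1
problemᵗ c₀ c =
  lett (occurrencesᵗ isAttr)
  (lett (call (occurrencesᵗ isTuple) (# 1 ∷ []))
  (lett (lett zero (call (positionᵗ isParam) (# 0 ∷ # 3 ∷ [])))
  (lett (lett oneᵗ (call (positionᵗ isParam) (# 0 ∷ # 4 ∷ [])))
  (lett (lett (predᵗ (call (occurrencesᵗ isOver) (# 4 ∷ []))) (call (positionᵗ isOver) (# 0 ∷ # 5 ∷ [])))
  (searchᵗ c₀ c)))))

-- Values of the search terms

module Evaluate (w : List Symbol) where

  open Lookups w

  private N = length w

  -- Each encoded tuple has exactly n entries, null ones included, so entry i of tuple j is opened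
  -- by occurrence number j·n + i of `cell`.
  nonnull : ℕ → ℕ → ℕ → Bool
  nonnull n j i = not (is isNull (nth w (suc (position isCell w (j * n + i)))))

  holds-nonnull : ∀ i j n → holds nonnullᵗ (i ∷ j ∷ n ∷ N ∷ []) ≡ nonnull n j i
  holds-nonnull i j n = trans (holds-not (p ∷ g ∷ vs) (lookᵗ isNull (suc (var (# 0)))))
    (cong not (trans (holds-lookᵗ (p ∷ g ∷ vs) isNull (suc (var (# 0))))
      (cong (λ k → is isNull (nth w (suc k)))
        (trans (cong (λ h → eval w (positionᵗ isCell) (h ∷ N ∷ [])) index) (eval-position isCell (j * n + i))))))
    where
    vs : Vec ℕ 4
    vs = i ∷ j ∷ n ∷ N ∷ []
    g p : ℕ
    g = eval w (plusᵗ (timesᵗ (var (# 1)) (var (# 2))) (var (# 0))) vs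
    p = eval w (positionᵗ isCell) (g ∷ N ∷ [])

    index : g ≡ j * n + i
    index = trans (eval-plus vs (timesᵗ (var (# 1)) (var (# 2))) (var (# 0)))
      (cong (_+ i) (eval-times vs (var (# 1)) (var (# 2))))

  module _ (m j n : ℕ) where

    open Search (nonnull n) n

    W : ℕ → Bool
    W = selected (nonnull n j) m

    eval-unread : ∀ i → eval w unreadᵗ (i ∷ m ∷ j ∷ n ∷ N ∷ []) ≡ unread (nonnull n j) m i
    eval-unread k = reads k
      where
      s : Term Symbol 7
      s = iteᵗ (call nonnullᵗ (# 1 ∷ # 4 ∷ # 5 ∷ # 6 ∷ [])) (halfᵗ (var (# 0))) (var (# 0))

      R : ℕ → ℕ
      R = capped m m (λ i r → eval w s (r ∷ i ∷ k ∷ m ∷ j ∷ n ∷ N ∷ []))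

      reads : ∀ i → R i ≡ unread (nonnull n j) m i
      reads zero = refl
      reads (suc i) = trans
        (cong (_⊓ m) (trans (eval-ite vs (call nonnullᵗ (# 1 ∷ # 4 ∷ # 5 ∷ # 6 ∷ [])) (halfᵗ (var (# 0))) (var (# 0)))
          (trans (cong₂ (λ b h → if b then h else R i) (holds-nonnull i j n) (eval-half vs (var (# 0))))
            (cong (λ r → if nonnull n j i then ⌊ r /2⌋ else r) (reads i)))))
        (m≤n⇒m⊓n≡m (unread≤ (nonnull n j) m (suc i)))
        where
        vs : Vec ℕ 7
        vs = R i ∷ i ∷ k ∷ m ∷ j ∷ n ∷ N ∷ []

    holds-selected : ∀ i → holds selectedᵗ (i ∷ m ∷ j ∷ n ∷ N ∷ []) ≡ W i
    holds-selected i = trans (holds-and vs (call nonnullᵗ (# 0 ∷ # 2 ∷ # 3 ∷ # 4 ∷ [])) (oddᵗ unreadᵗ))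
      (cong₂ _∧_ (holds-nonnull i j n) (trans (holds-odd vs unreadᵗ) (cong odd (eval-unread i))))
      where
      vs : Vec ℕ 5
      vs = i ∷ m ∷ j ∷ n ∷ N ∷ []

    eval-size : eval w sizeᵗ (m ∷ j ∷ n ∷ N ∷ []) ≡ countTo W n
    eval-size = trans (eval-count (m ∷ j ∷ n ∷ N ∷ []) (var (# 2)) selectedᵗ) (countTo-cong n λ i _ → holds-selected i)

    holds-covered : ∀ j′ → holds coveredᵗ (j′ ∷ m ∷ j ∷ n ∷ N ∷ [])
                         ≡ forallTo (λ i → implies (W i) (nonnull n j′ i)) n
    holds-covered j′ = trans
      (holds-forall (j′ ∷ m ∷ j ∷ n ∷ N ∷ []) (var (# 3))
        (impliesᵗ (call selectedᵗ (# 0 ∷ # 2 ∷ # 3 ∷ # 4 ∷ # 5 ∷ [])) (call nonnullᵗ (# 0 ∷ # 1 ∷ # 4 ∷ # 5 ∷ []))))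
      (forallTo-cong n λ i _ → trans
        (holds-implies (i ∷ j′ ∷ m ∷ j ∷ n ∷ N ∷ []) (call selectedᵗ (# 0 ∷ # 2 ∷ # 3 ∷ # 4 ∷ # 5 ∷ []))
          (call nonnullᵗ (# 0 ∷ # 1 ∷ # 4 ∷ # 5 ∷ [])))
        (cong₂ implies (holds-selected i) (holds-nonnull i j′ n)))

    module _ (T : ℕ) where

      eval-support : eval w supportᵗ (m ∷ j ∷ n ∷ N ∷ T ∷ []) ≡ support T W
      eval-support = trans
        (eval-count (m ∷ j ∷ n ∷ N ∷ T ∷ []) (var (# 4)) (call coveredᵗ (# 0 ∷ # 1 ∷ # 2 ∷ # 3 ∷ # 4 ∷ [])))
        (countTo-cong T λ j′ _ → holds-covered j′)

      holds-nontrivial : holds nontrivialᵗ (m ∷ j ∷ n ∷ N ∷ T ∷ []) ≡ nontrivial T W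
      holds-nontrivial = trans
        (holds-forall (m ∷ j ∷ n ∷ N ∷ T ∷ []) (var (# 2))
          (impliesᵗ (call selectedᵗ (# 0 ∷ # 1 ∷ # 2 ∷ # 3 ∷ # 4 ∷ [])) (call missingᵗ (# 0 ∷ # 3 ∷ # 4 ∷ # 5 ∷ []))))
        (forallTo-cong n λ i _ → trans
          (holds-implies (i ∷ m ∷ j ∷ n ∷ N ∷ T ∷ []) (call selectedᵗ (# 0 ∷ # 1 ∷ # 2 ∷ # 3 ∷ # 4 ∷ []))
            (call missingᵗ (# 0 ∷ # 3 ∷ # 4 ∷ # 5 ∷ [])))
          (cong₂ implies (holds-selected i)
            (trans (holds-exists (i ∷ n ∷ N ∷ T ∷ []) (var (# 3)) (notᵗ (call nonnullᵗ (# 1 ∷ # 0 ∷ # 2 ∷ # 3 ∷ []))))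
              (existsTo-cong T λ j′ _ → trans
                (holds-not (j′ ∷ i ∷ n ∷ N ∷ T ∷ []) (call nonnullᵗ (# 1 ∷ # 0 ∷ # 2 ∷ # 3 ∷ [])))
                (cong not (holds-nonnull i j′ n))))))

  module Parameters (X K P Q : List Symbol)
    (w≡ : w ≡ X ++ param ∷ K ++ param ∷ plus ∷ P ++ over ∷ Q)
    (X-params : occurrences isParam X ≡ 0) (K-params : occurrences isParam K ≡ 0)
    (Q-overs : occurrences isOver Q ≡ 0) where

    private
      p₁ p₂ o : ℕ
      p₁ = length X
      p₂ = suc (length X + length K)
      o  = suc (suc p₂ + length P)

      U V : List Symbol
      U = X ++ param ∷ K
      V = X ++ param ∷ K ++ param ∷ plus ∷ P

      w≡U : w ≡ U ++ param ∷ plus ∷ P ++ over ∷ Q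
      w≡U = trans w≡ (sym (++-assoc X (param ∷ K) _))

      w≡V : w ≡ V ++ over ∷ Q
      w≡V = trans w≡ (trans (cong (λ u → X ++ param ∷ u) (sym (++-assoc K (param ∷ plus ∷ P) (over ∷ Q))))
        (sym (++-assoc X (param ∷ K ++ param ∷ plus ∷ P) (over ∷ Q))))

      length-U : length U ≡ p₂
      length-U = trans (length-++ X) (+-suc (length X) (length K))

      length-V : length V ≡ o
      length-V = trans (trans (length-++ X) (cong (λ k → length X + suc k) (length-++ K)))
        (arrange (length X) (length K) (length P))
        where
        arrange : ∀ x k p → x + suc (k + suc (suc p)) ≡ suc (suc (suc (x + k)) + p)
        arrange = solve-∀

    position-first : position isParam w 0 ≡ p₁
    position-first = trans (cong₂ (position isParam) w≡ (sym X-params)) (position-occurrence isParam X param _ refl)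

    position-second : position isParam w 1 ≡ p₂
    position-second = trans (cong₂ (position isParam) w≡U (sym U-params))
      (trans (position-occurrence isParam U param _ refl) length-U)
      where
      U-params : occurrences isParam U ≡ 1
      U-params = trans (occurrences-++ isParam X (param ∷ K)) (cong₂ (λ a b → a + suc b) X-params K-params)

    position-over : position isOver w (pred (occurrences isOver w)) ≡ o
    position-over = trans (cong₂ (position isOver) w≡V V-overs)
      (trans (position-occurrence isOver V over Q refl) length-V)
      where
      V-overs : pred (occurrences isOver w) ≡ occurrences isOver V
      V-overs = trans (cong (λ u → pred (occurrences isOver u)) w≡V)
        (cong pred (trans (occurrences-++ isOver V (over ∷ Q))
          (trans (cong (λ q → occurrences isOver V + suc q) Q-overs) (+-comm _ 1))))

    digitOf : List Symbol → ℕ → Bool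
    digitOf ds i = is isBit1 (nth ds i)

    holds-k : ∀ i → holds (fieldᵗ isBit1) (i ∷ p₁ ∷ p₂ ∷ []) ≡ digitOf K i
    holds-k i = holds-field isBit1 X param K _ i w≡

    holds-numerator : ∀ i → holds numeratorᵗ (p₂ ∷ o ∷ i ∷ []) ≡ digitOf P i
    holds-numerator i = subst
      (λ l → holds (fieldᵗ isBit1) (i ∷ l ∷ suc (l + length P) ∷ []) ≡ digitOf P i)
      (trans (length-++ U) (trans (+-comm (length U) 1) (cong suc length-U)))
      -- The sign plays the part of the symbol that opens the field.
      (holds-field isBit1 (U ++ param ∷ []) plus P (over ∷ Q) i
        (trans w≡U (sym (++-assoc U (param ∷ []) _))))

    holds-denominator : ∀ i → holds (fieldᵗ isBit1) (i ∷ o ∷ N ∷ []) ≡ digitOf Q i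
    holds-denominator i = subst₂ (λ l e → holds (fieldᵗ isBit1) (i ∷ l ∷ e ∷ []) ≡ digitOf Q i) length-V
      (sym (trans (cong length w≡V) (trans (length-++ V) (+-suc (length V) (length Q)))))
      (holds-field isBit1 V over Q [] i (trans w≡V (cong (λ u → V ++ over ∷ u) (sym (++-identityʳ Q)))))

    module _ (n T : ℕ) (n≡ : occurrences isAttr w ≡ n) (T≡ : occurrences isTuple w ≡ T) where

      open Search (nonnull n) n T

      private
        κ ι π θ : ℕ
        κ = weight (digitOf K) N
        ι = weight (λ i → not (0 <ᵇ i)) N
        π = weight (digitOf P) N
        θ = weight (digitOf Q) N

      module _ (c z : ℕ) where

        private
          us : Vec ℕ 7
          us = c ∷ z ∷ N ∷ T ∷ p₁ ∷ p₂ ∷ o ∷ []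

        holds-long : holds longᵗ us ≡ (1 * κ ≤ᵇ z * ι)
        holds-long = holds-compare us (var (# 2)) oneᵗ (var (# 1))
          (call (fieldᵗ isBit1) (# 1 ∷ # 6 ∷ # 7 ∷ [])) (notᵗ (var (# 1)))
          (λ _ i → holds-k i) (λ r i → holds-not (r ∷ i ∷ us) (var (# 1)))

        holds-frequent : holds frequentᵗ us ≡ (T * π ≤ᵇ c * θ)
        holds-frequent = holds-compare us (var (# 2)) (var (# 3)) (var (# 0))
          (call numeratorᵗ (# 7 ∷ # 8 ∷ # 1 ∷ [])) (call (fieldᵗ isBit1) (# 1 ∷ # 8 ∷ # 4 ∷ []))
          (λ _ i → holds-numerator i) (λ _ i → holds-denominator i)

      holds-acceptable : ∀ m j → holds acceptableᵗ (m ∷ j ∷ n ∷ N ∷ T ∷ p₁ ∷ p₂ ∷ o ∷ []) 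
                              ≡ acceptable κ ι π θ (W m j n)
      holds-acceptable m j =
        trans (cong₂ (λ z s → holds core (s ∷ z ∷ m ∷ j ∷ n ∷ N ∷ T ∷ p₁ ∷ p₂ ∷ o ∷ []))
          (eval-size m j n) (eval-support m j n T))
        (trans (holds-and vs (leᵗ (suc oneᵗ) (var (# 1))) (long andᵗ nontriv andᵗ frequent))
          (cong₂ _∧_ (holds-le vs (suc oneᵗ) (var (# 1)))
            (trans (holds-and vs long (nontriv andᵗ frequent)) (cong₂ _∧_
              (holds-long (support (W m j n)) (countTo (W m j n) n))
              (trans (holds-and vs nontriv frequent) (cong₂ _∧_
                (holds-nontrivial m j n T)
                (holds-frequent (support (W m j n)) (countTo (W m j n) n))))))))
        where
        long nontriv frequent core : Term Symbol 10
        long     = call longᵗ (# 0 ∷ # 1 ∷ # 5 ∷ # 6 ∷ # 7 ∷ # 8 ∷ # 9 ∷ [])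
        nontriv  = call nontrivialᵗ (# 2 ∷ # 3 ∷ # 4 ∷ # 5 ∷ # 6 ∷ [])
        frequent = call frequentᵗ (# 0 ∷ # 1 ∷ # 5 ∷ # 6 ∷ # 7 ∷ # 8 ∷ # 9 ∷ [])
        core     = leᵗ (suc oneᵗ) (var (# 1)) andᵗ long andᵗ nontriv andᵗ frequent

        vs : Vec ℕ 10
        vs = support (W m j n) ∷ countTo (W m j n) n ∷ m ∷ j ∷ n ∷ N ∷ T ∷ p₁ ∷ p₂ ∷ o ∷ []

      holds-search : ∀ c₀ c → holds (searchᵗ c₀ c) (o ∷ p₂ ∷ p₁ ∷ T ∷ n ∷ N ∷ []) ≡ found κ ι π θ (c₀ * n ^ c)
      holds-search c₀ c = trans (holds-exists vs (var (# 3)) (existsᵗ range core))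
        (existsTo-cong T λ j _ → trans (holds-exists (j ∷ vs) range core)
          (trans (cong (existsTo (λ m → holds core (m ∷ j ∷ vs))) (eval-range j))
            (existsTo-cong (c₀ * n ^ c) λ m _ → holds-acceptable m j)))
        where
        vs : Vec ℕ 6
        vs = o ∷ p₂ ∷ p₁ ∷ T ∷ n ∷ N ∷ []

        range : Term Symbol 7
        range = timesᵗ (literalᵗ c₀) (powerᵗ (var (# 5)) c)

        core : Term Symbol 8
        core = call acceptableᵗ (# 0 ∷ # 1 ∷ # 6 ∷ # 7 ∷ # 5 ∷ # 4 ∷ # 3 ∷ # 2 ∷ [])

        eval-range : ∀ j → eval w range (j ∷ vs) ≡ c₀ * n ^ c
        eval-range j = trans (eval-times (j ∷ vs) (literalᵗ c₀) (powerᵗ (var (# 5)) c))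
          (cong₂ _*_ (eval-literal (j ∷ vs) c₀) (eval-power (j ∷ vs) (var (# 5)) c))

      holds-problem : ∀ c₀ c → holds (problemᵗ c₀ c) (N ∷ []) ≡ found κ ι π θ (c₀ * n ^ c)
      holds-problem c₀ c = trans
        (cong (holds (searchᵗ c₀ c))
          (cong₂ _∷_ O≡ (cong₂ _∷_ P₂≡ (cong₂ _∷_ P₁≡ (cong₂ (λ t a → t ∷ a ∷ N ∷ []) T′≡ n′≡)))))
        (holds-search c₀ c)
        where
        n′≡ : eval w (occurrencesᵗ isAttr) (N ∷ []) ≡ n
        n′≡ = trans (eval-occurrences isAttr) n≡

        T′≡ : eval w (occurrencesᵗ isTuple) (N ∷ []) ≡ T
        T′≡ = trans (eval-occurrences isTuple) T≡

        P₁≡ : eval w (positionᵗ isParam) (0 ∷ N ∷ []) ≡ p₁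
        P₁≡ = trans (eval-position isParam 0) position-first

        P₂≡ : eval w (positionᵗ isParam) (1 ∷ N ∷ []) ≡ p₂
        P₂≡ = trans (eval-position isParam 1) position-second

        vs : Vec ℕ 5
        vs = eval w (positionᵗ isParam) (1 ∷ N ∷ []) ∷ eval w (positionᵗ isParam) (0 ∷ N ∷ [])
           ∷ eval w (occurrencesᵗ isTuple) (N ∷ []) ∷ eval w (occurrencesᵗ isAttr) (N ∷ []) ∷ N ∷ []

        O≡ : eval w (positionᵗ isOver) (eval w (predᵗ (call (occurrencesᵗ isOver) (# 4 ∷ []))) vs ∷ N ∷ []) ≡ o
        O≡ = trans (eval-position isOver _) (trans
          (cong (position isOver w) (trans (eval-pred vs (call (occurrencesᵗ isOver) (# 4 ∷ [])))
            (cong pred (eval-occurrences isOver))))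
          position-over)

-- Rules and sets of attributes

module _ {X : Set} {P : X → Set} (P? : Decidable P) where

  filter≤countTo : ∀ xs (q : ℕ → Bool) → (∀ j → P (List.lookup xs j) → q (toℕ j) ≡ true) →
                   length (filter P? xs) ≤ countTo q (length xs)
  filter≤countTo [] q h = z≤n
  filter≤countTo (x ∷ xs) q h rewrite countTo-suc {A = X} q (length xs)
    with P? x | filter≤countTo xs (q ∘ suc) (h ∘ suc)
  ... | yes p | rest rewrite h zero p = s≤s rest
  ... | no _  | rest = ≤-trans rest (m≤n+m _ (bit (q 0)))

  countTo≤filter : ∀ xs (q : ℕ → Bool) → (∀ j → q (toℕ j) ≡ true → P (List.lookup xs j)) →
                   countTo q (length xs) ≤ length (filter P? xs)
  countTo≤filter [] q h = z≤n
  countTo≤filter (x ∷ xs) q h rewrite countTo-suc {A = X} q (length xs)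
    with P? x | q 0 in e | countTo≤filter xs (q ∘ suc) (h ∘ suc)
  ... | yes p | true  | rest = s≤s rest
  ... | yes p | false | rest = m≤n⇒m≤1+n rest
  ... | no ¬p | true  | rest = contradiction (h zero e) ¬p
  ... | no ¬p | false | rest = rest

_without_ : (ℕ → Bool) → ℕ → ℕ → Bool
(p without x) i = p i ∧ not (does (i ≟ x))

without-other : ∀ p {x i} → i ≢ x → (p without x) i ≡ p i
without-other p {x} {i} i≢x rewrite dec-false (i ≟ x) i≢x = ∧-identityʳ (p i)

countTo-without : ∀ p n x → x < n → p x ≡ true → countTo p n ≡ suc (countTo (p without x) n)
countTo-without p (suc n) x x<n px with m≤n⇒m<n∨m≡n x<n
... | inj₂ refl rewrite px | dec-true (n ≟ n) refl =
  cong suc (countTo-cong n λ i i<n → sym (without-other p (<⇒≢ i<n)))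
... | inj₁ (s≤s x<n′) = begin-equality
  bit (p n) + countTo p n                         ≡⟨ cong (bit (p n) +_) (countTo-without p n x x<n′ px) ⟩
  bit (p n) + suc (countTo (p without x) n)       ≡⟨ +-suc (bit (p n)) _ ⟩
  suc (bit (p n) + countTo (p without x) n)
    ≡⟨ cong (λ b → suc (bit b + countTo (p without x) n)) (sym (without-other p (≢-sym (<⇒≢ x<n′)))) ⟩
  suc (bit ((p without x) n) + countTo (p without x) n) ∎
  where open ≤-Reasoning

unique≤countTo : ∀ {n} (xs : List (Fin n)) p → Unique xs → All (λ i → p (toℕ i) ≡ true) xs →
                 length xs ≤ countTo p n
unique≤countTo []       p _            _          = z≤n
unique≤countTo {n} (x ∷ xs) p (x∉xs ∷ unique) (px ∷ pxs) = ≤-trans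
  (s≤s (unique≤countTo xs (p without toℕ x) unique
    (All.zipWith (λ (x≢y , py) → trans (without-other p (λ e → x≢y (toℕ-injective (sym e)))) py) (x∉xs , pxs))))
  (≤-reflexive (sym (countTo-without p n (toℕ x) (toℕ<n x) px)))

lookup-tabulate-toℕ : ∀ {m n} (f : Fin m → Fin n) k → (∀ i → toℕ (f i) ≡ k + toℕ i) →
                      ∀ j → toℕ (List.lookup (List.tabulate f) j) ≡ k + toℕ j
lookup-tabulate-toℕ {suc m} f k h zero    = h zero
lookup-tabulate-toℕ {suc m} f k h (suc j) =
  trans (lookup-tabulate-toℕ (f ∘ suc) (suc k) (λ i → trans (h (suc i)) (+-suc k (toℕ i))) j) (sym (+-suc k (toℕ j)))

countTo≤filter-allFin : ∀ n {P : Fin n → Set} (P? : Decidable P) p →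
                        (∀ i → p (toℕ i) ≡ true → P i) → countTo p n ≤ length (filter P? (allFin n))
countTo≤filter-allFin n P? p h =
  subst (λ m → countTo p m ≤ length (filter P? (allFin n))) (length-tabulate {n = n} id)
    (countTo≤filter P? (allFin n) p λ j e →
      h (List.lookup (allFin n) j) (trans (cong p (lookup-tabulate-toℕ id 0 (λ _ → refl) j)) e))

filter-allFin : ∀ n (p : ℕ → Bool) →
                length (filter (λ i → p (toℕ i) Bool.≟ true) (allFin n)) ≡ countTo p n
filter-allFin n p = ≤-antisym
  (unique≤countTo _ p (Unique.filter⁺ (λ i → p (toℕ i) Bool.≟ true) (Unique.allFin⁺ n))
    (All.all-filter (λ i → p (toℕ i) Bool.≟ true) (allFin n)))
  (countTo≤filter-allFin n (λ i → p (toℕ i) Bool.≟ true) p λ i e → e)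

-- `_/ℚ_` reduces the fraction, so the cross multiplication takes place with the unreduced fraction
-- `q`, which is equivalent to it.
≤/-⇔ : ∀ (s : ℚ) {p} a b → ↥ s ≡ ℤ.+ p → s ≤ℚ (ℤ.+ a /ℚ suc b) ⇔ suc b * p ≤ a * ↧ₙ s
≤/-⇔ (mkℚ _ d-1 _) {p} a b refl = mk⇔ fwd bwd
  where
  q = ℚᵘ.mkℚᵘ (ℤ.+ a) b

  integers : ∀ x y z w → (x * y ≤ z * w) ⇔ (ℤ.+ x ℤ.* ℤ.+ y ℤ.≤ ℤ.+ z ℤ.* ℤ.+ w)
  integers x y z w = mk⇔
    (λ p → subst₂ ℤ._≤_ (ℤ.pos-* x y) (ℤ.pos-* z w) (ℤ.+≤+ p))
    (λ p → ℤ.drop‿+≤+ (subst₂ ℤ._≤_ (sym (ℤ.pos-* x y)) (sym (ℤ.pos-* z w)) p))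

  fwd : _ → suc b * p ≤ a * suc d-1
  fwd s≤ with ℚᵘ.≤-respʳ-≃ (ℚ.toℚᵘ-fromℚᵘ q) (ℚ.toℚᵘ-mono-≤ s≤)
  ... | ℚᵘ.*≤* l = ≤-trans (≤-reflexive (*-comm (suc b) p)) (Equivalence.from (integers p (suc b) a (suc d-1)) l)

  bwd : suc b * p ≤ a * suc d-1 → _
  bwd l = ℚ.toℚᵘ-cancel-≤ (ℚᵘ.≤-respʳ-≃ (ℚᵘ.≃-sym (ℚ.toℚᵘ-fromℚᵘ q))
    (ℚᵘ.*≤* (Equivalence.to (integers p (suc b) a (suc d-1)) (≤-trans (≤-reflexive (*-comm p (suc b))) l))))

left-positive : ∀ a b → 1 ≤ a * b → 1 ≤ a
left-positive (suc a) b _ = s≤s z≤n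

numerator-positive : ∀ s {p} → 0ℚ <ℚ s → ↥ s ≡ ℤ.+ p → 1 ≤ p
numerator-positive (mkℚ (ℤ.+ suc p) _ _) _               refl = s≤s z≤n
numerator-positive (mkℚ (ℤ.+ zero) _ _)  (*<* (ℤ.+<+ ())) refl

-- The canonical condition that is satisfied precisely by the tuples not null at `A`.
presence : ∀ A → IsBoolean A → Comparison A
presence record { kind = categorical } (c , dom⇔) = equal c (Equivalence.from (dom⇔ c) refl)
presence record { kind = numeric }     (c , dom⇔) = within c c ℚ.≤-refl

presence-fulfilled : ∀ A b v → FulfilsValue A (presence A b) (just v)
presence-fulfilled record { kind = categorical } (c , dom⇔) (v , v∈) = Equivalence.to (dom⇔ v) v∈
presence-fulfilled record { kind = numeric }     (c , dom⇔) (v , v∈) with Equivalence.to (dom⇔ v) v∈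
... | refl = ℚ.≤-refl , ℚ.≤-refl

-- Both values are c(A). This is the only way in which booleanness restricts the conditions of a
-- given rule.
boolean-fulfils : ∀ A → IsBoolean A → ∀ a v w → FulfilsValue A a (just v) → FulfilsValue A a (just w)
boolean-fulfils A (c , dom⇔) a (v , v∈) (w , w∈) =
  subst (Fulfils A a) (trans (Equivalence.to (dom⇔ v) v∈) (sym (Equivalence.to (dom⇔ w) w∈)))

module Rules (T : BooleanDatabase) (nonnull : ℕ → ℕ → Bool)
  (agrees : ∀ j i → nonnull (toℕ j) (toℕ i) ≡ is-just (List.lookup (tuples T) j i)) where

  private
    I  = attributes T
    n  = ∣ I ∣ᴬ
    ts = tuples T

  open Search nonnull n (length ts)

  covered : (ℕ → Bool) → ℕ → Bool
  covered W j = forallTo (λ i → implies (W i) (nonnull j i)) n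

  covered-elim : ∀ {W} j → covered W (toℕ j) ≡ true → ∀ i → W (toℕ i) ≡ true →
                 is-just (List.lookup ts j i) ≡ true
  covered-elim {W} j e i Wi with forallTo-elim {n = n} e (toℕ i) (toℕ<n i)
  ... | h rewrite Wi = trans (sym (agrees j i)) h

  covered-intro : ∀ {W} j → (∀ i → W (toℕ i) ≡ true → is-just (List.lookup ts j i) ≡ true) →
                  covered W (toℕ j) ≡ true
  covered-intro {W} j h = forallTo-intro n λ i i<n →
    subst (λ i → implies (W i) (nonnull (toℕ j) i) ≡ true) (toℕ-fromℕ< i<n) (pointwise (fromℕ< i<n))
    where
    pointwise : ∀ i → implies (W (toℕ i)) (nonnull (toℕ j) (toℕ i)) ≡ true
    pointwise i with W (toℕ i) in e
    ... | true  = trans (agrees j i) (h i e)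
    ... | false = refl

  module FromRule (R : Rule I) (¬trivial : ¬ Trivial R ts) where

    private
      C  = conjunction R
      xs = attributesOf I C

    open import Data.List.Membership.DecPropositional (Fin._≟_ {n}) using (_∈?_)
    open import Data.List.Membership.DecPropositional _≟_ renaming (_∈?_ to _∈ℕ?_) using ()

    W : ℕ → Bool
    W i = does (i ∈ℕ? map toℕ xs)

    W-intro : ∀ {i} → i ∈ xs → W (toℕ i) ≡ true
    W-intro {i} i∈ = dec-true (toℕ i ∈ℕ? map toℕ xs) (∈-map⁺ toℕ i∈)

    W-elim : ∀ i → W i ≡ true → ∃[ a ] a ∈ C × toℕ (proj₁ a) ≡ i
    W-elim i e with i ∈ℕ? map toℕ xs
    ... | yes p with ∈-map⁻ toℕ p
    ... | x , x∈ , refl with ∈-map⁻ proj₁ x∈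
    ... | a , a∈ , refl = a , a∈ , refl

    attributes-split : xs ≡ attributesOf I (atoms (body R)) ++ attributesOf I (atoms (head R))
    attributes-split = map-++ proj₁ (atoms (body R)) (atoms (head R))

    ruleSize≤ : ruleSize R ≤ countTo W n
    ruleSize≤ = ≤-trans (≤-reflexive (trans (sym (length-++ (atoms (body R)))) (sym (length-map proj₁ C))))
      (unique≤countTo xs W
        (subst Unique (sym attributes-split) (Unique.++⁺ (unique (body R)) (unique (head R)) (disjoint R)))
        (All.tabulate W-intro))

    2≤ruleSize : 2 ≤ ruleSize R
    2≤ruleSize = +-mono-≤ (nonempty (atoms (body R)) (body≢∅ R)) (nonempty (atoms (head R)) (head≢∅ R))
      where
      nonempty : ∀ as → attributesOf I as ≢ [] → 1 ≤ length as
      nonempty []      p = contradiction refl p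
      nonempty (_ ∷ _) p = s≤s z≤n

    satisfied-just : ∀ t {a} → SatisfiesAtom {I} t a → is-just (t (proj₁ a)) ≡ true
    satisfied-just t {i , a} h with t i
    ... | just _ = refl

    count≤support : length (_⟦_⟧ {I} ts C) ≤ support W
    count≤support = filter≤countTo (satisfies? {I} C) ts (covered W) λ j sat → covered-intro j λ i Wi →
      holds-at j sat i (W-elim (toℕ i) Wi)
      where
      holds-at : ∀ j → Satisfies {I} (List.lookup ts j) C → ∀ i → (∃[ a ] a ∈ C × toℕ (proj₁ a) ≡ toℕ i) →
                 is-just (List.lookup ts j i) ≡ true
      holds-at j sat i (a , a∈ , e) =
        subst (λ i → is-just (List.lookup ts j i) ≡ true) (toℕ-injective e)
          (satisfied-just (List.lookup ts j) (All.lookup sat a∈))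

    -- If some attribute of the rule were null in no tuple, its condition, which holds in `t`, would
    -- by `boolean-fulfils` hold in every tuple, and the rule would be trivial.
    nontrivial-W : ∀ {t} → Satisfies {I} t C → nontrivial W ≡ true
    nontrivial-W {t} sat = forallTo-intro n λ i _ → pointwise i
      where
      missing : ∀ a → a ∈ C → existsTo (λ j → not (nonnull j (toℕ (proj₁ a)))) (length ts) ≡ true
      missing (i , a) a∈ with existsTo (λ j → not (nonnull j (toℕ i))) (length ts) in e
      ... | true  = refl
      ... | false = contradiction (lose a∈ (↭-reflexive (filter-all (satisfies? {I} ((i , a) ∷ [])) (All.tabulate everywhere))))
                      ¬trivial
        where
        present : ∀ j → is-just (List.lookup ts j i) ≡ true
        present j with is-just (List.lookup ts j i) in e′
        ... | true  = refl
        ... | false = trans (sym e) (existsTo-intro (toℕ j) (toℕ<n j) (cong not (trans (agrees j i) e′)))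

        transfer : ∀ (u : Tuple I) → is-just (u i) ≡ true → SatisfiesAtom {I} u (i , a)
        transfer u ju with u i | t i | All.lookup sat a∈
        ... | just v | just v₀ | h = boolean-fulfils (attribute I i) (boolean T i) a v₀ v h

        everywhere : ∀ {u} → u ∈ ts → Satisfies {I} u ((i , a) ∷ [])
        everywhere {u} u∈ = transfer u
          (subst (λ u → is-just (u i) ≡ true) (sym (Any.lookup-index u∈)) (present (Any.index u∈))) ∷ []

      pointwise : ∀ i → implies (W i) (existsTo (λ j → not (nonnull j i)) (length ts)) ≡ true
      pointwise i with W i in Wi
      ... | false = refl
      ... | true with W-elim i Wi
      ... | a , a∈ , refl = missing a a∈

  atom : Fin n → Atomic I
  atom i = i , presence (attribute I i) (boolean T i)

  attributesOf-atoms : ∀ xs → attributesOf I (map atom xs) ≡ xs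
  attributesOf-atoms xs = trans (sym (map-∘ xs)) (map-id xs)

  -- Size, triviality and support depend only on the conjunction of body and head, so any division
  -- will do: here the first attribute forms the body.
  ruleOf : ∀ xs → Unique xs → 2 ≤ length xs → Σ (Rule I) λ R → conjunction R ≡ map atom xs
  ruleOf (x ∷ y ∷ xs) (x∉ ∷ unique) (s≤s (s≤s z≤n)) = record
    { body     = record { atoms = atom x ∷ [] ; unique = [] ∷ [] }
    ; head     = record { atoms  = map atom (y ∷ xs)
                        ; unique = subst Unique (sym (attributesOf-atoms (y ∷ xs))) unique }
    ; body≢∅   = λ ()
    ; head≢∅   = λ ()
    ; disjoint = λ { (here refl , x∈) → All.lookup x∉ (subst (x ∈_) (attributesOf-atoms (y ∷ xs)) x∈) refl }
    } , refl

  module FromAttributes (W : ℕ → Bool) (2≤W : 2 ≤ countTo W n) (W-nontrivial : nontrivial W ≡ true) where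

    private
      chosen? : Decidable (λ (i : Fin n) → W (toℕ i) ≡ true)
      chosen? i = W (toℕ i) Bool.≟ true

      xs : List (Fin n)
      xs = filter chosen? (allFin n)

      size-xs : length xs ≡ countTo W n
      size-xs = filter-allFin n W

      result = ruleOf xs (Unique.filter⁺ chosen? (Unique.allFin⁺ n)) (subst (2 ≤_) (sym size-xs) 2≤W)

    R : Rule I
    R = proj₁ result

    size-R : countTo W n ≡ ruleSize R
    size-R = trans (sym size-xs) (trans (sym (length-map atom xs))
      (trans (cong length (sym (proj₂ result))) (length-++ (atoms (body R)))))

    missing : ∀ i → W (toℕ i) ≡ true → ∃[ j ] List.lookup ts j i ≡ nothing
    missing i Wi with forallTo-elim {n = n} W-nontrivial (toℕ i) (toℕ<n i)
    ... | h rewrite Wi with existsTo-elim (length ts) h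
    ... | j , j< , e = fromℕ< j< , is-nothing (trans (sym (agrees (fromℕ< j<) i))
          (trans (cong (λ j → nonnull j (toℕ i)) (toℕ-fromℕ< j<)) (not-true e)))
      where
      not-true : ∀ {b} → not b ≡ true → b ≡ false
      not-true {false} _ = refl

      is-nothing : ∀ {X : Set} {x : Maybe X} → is-just x ≡ false → x ≡ nothing
      is-nothing {x = nothing} _ = refl

    -- An attribute of `W` is null in some tuple, hence there is a tuple. This rules out the case in
    -- which `sup` takes its default value.
    tuples-nonempty : 1 ≤ length ts
    tuples-nonempty with existsTo-elim {W} n (positive (≤-trans (s≤s z≤n) 2≤W))
      where
      positive : ∀ {m} → 1 ≤ m → (0 <ᵇ m) ≡ true
      positive (s≤s _) = refl
    ... | i , i<n , Wi with missing (fromℕ< i<n) (trans (cong W (toℕ-fromℕ< i<n)) Wi)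
    ... | j , _ = ≤-trans (s≤s z≤n) (toℕ<n j)

    ¬trivial : ¬ Trivial R ts
    ¬trivial trivial with Any.map⁻ (subst (Any (λ a → _⟦_⟧ {I} ts (a ∷ []) ↭ ts)) (proj₂ result) trivial)
    ... | any with find any
    ... | i , i∈ , perm with missing i (proj₂ (∈-filter⁻ chosen? {xs = allFin n} i∈))
    ... | j , null-ji =
      -- A permutation preserves the length, whereas the selection drops tuple `j`.
      <-irrefl (↭-length perm) (filter-notAll (satisfies? {I} (atom i ∷ [])) ts
        (lose (∈-lookup j) λ { (h ∷ []) → unsatisfied (List.lookup ts j) null-ji h }))
      where
      unsatisfied : ∀ (t : Tuple I) → t i ≡ nothing → ¬ SatisfiesAtom {I} t (atom i)
      unsatisfied t e h with t i
      unsatisfied t refl () | nothing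

    support≤count : support W ≤ length (_⟦_⟧ {I} ts (conjunction R))
    support≤count = countTo≤filter (satisfies? {I} (conjunction R)) ts (covered W) λ j cov →
      subst (Satisfies {I} (List.lookup ts j)) (sym (proj₂ result))
        (All.map⁺ (All.tabulate λ {i} i∈ → present (List.lookup ts j) i
          (covered-elim {W} j cov i (proj₂ (∈-filter⁻ chosen? {xs = allFin n} i∈)))))
      where
      present : ∀ (t : Tuple I) i → is-just (t i) ≡ true → SatisfiesAtom {I} t (atom i)
      present t i h with t i
      ... | just v = presence-fulfilled (attribute I i) (boolean T i) v

  module _ {s : ℚ} {p : ℕ} (0<s : 0ℚ <ℚ s) (p≡ : ↥ s ≡ ℤ.+ p) where

    sup-elim : ∀ us R → s ≤ℚ sup {I} R us →
               1 ≤ length us × length us * p ≤ length (_⟦_⟧ {I} us (conjunction R)) * ↧ₙ s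
    -- The default value 0 of `sup` lies below the positive threshold.
    sup-elim [] R s≤ = contradiction (ℚ.<-≤-trans 0<s s≤) (ℚ.<-irrefl refl)
    sup-elim (u ∷ us) R s≤ = s≤s z≤n , Equivalence.to (≤/-⇔ s (length (_⟦_⟧ {I} (u ∷ us) (conjunction R))) (length us) p≡) s≤

    sup-intro : ∀ us R → 1 ≤ length us → length us * p ≤ length (_⟦_⟧ {I} us (conjunction R)) * ↧ₙ s →
                s ≤ℚ sup {I} R us
    sup-intro (u ∷ us) R _ h = Equivalence.from (≤/-⇔ s (length (_⟦_⟧ {I} (u ∷ us) (conjunction R))) (length us) p≡) h

    satisfying : ∀ R → s ≤ℚ sup {I} R ts → ∃[ t ] Satisfies {I} t (conjunction R)
    satisfying R s≤ with sup-elim ts R s≤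
    ... | 1≤ts , h with member (_⟦_⟧ {I} ts (conjunction R))
      (left-positive _ (↧ₙ s) (≤-trans (*-mono-≤ 1≤ts (numerator-positive s 0<s p≡)) h))
      where
      member : ∀ us → 1 ≤ length us → ∃[ u ] u ∈ us
      member (u ∷ us) _ = u , here refl
    ... | t , t∈ = t , proj₂ (∈-filter⁻ (satisfies? {I} (conjunction R)) {xs = ts} t∈)

    rules⇔ : ∀ k → ⟨ I , ts , sup , k , s ⟩ ⇔ (∃[ W ] Accepted k p (↧ₙ s) W)
    rules⇔ k = mk⇔
      (λ (R , ¬triv , k≤ , s≤) → let open FromRule R ¬triv in
        W , ≤-trans 2≤ruleSize ruleSize≤ , ≤-trans k≤ ruleSize≤ , nontrivial-W {proj₁ (satisfying R s≤)} (proj₂ (satisfying R s≤))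
        , ≤-trans (proj₂ (sup-elim ts R s≤)) (*-monoˡ-≤ (↧ₙ s) count≤support))
      (λ (W , 2≤W , k≤ , triv , freq) → let open FromAttributes W 2≤W triv in
        R , ¬trivial , ≤-trans k≤ (≤-reflexive size-R)
        , sup-intro ts R tuples-nonempty (≤-trans freq (*-monoˡ-≤ (↧ₙ s) support≤count)))

-- The encoding of inputs

weight-suc : ∀ f n → weight f (suc n) ≡ bit (f 0) + 2 * weight (f ∘ suc) n
weight-suc f zero    = base (bit (f 0))
  where
  base : ∀ b → 0 + b * 1 ≡ b + 2 * 0
  base = solve-∀
weight-suc f (suc n) = trans (cong (_+ bit (f (suc n)) * (2 * 2 ^ n)) (weight-suc f n))
  (rearrange (bit (f 0)) (weight (f ∘ suc) n) (bit (f (suc n))) (2 ^ n))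
  where
  rearrange : ∀ b v c t → b + 2 * v + c * (2 * t) ≡ b + 2 * (v + c * t)
  rearrange = solve-∀

weight-zero : ∀ f n → (∀ i → f i ≡ false) → weight f n ≡ 0
weight-zero f zero    e = refl
weight-zero f (suc n) e rewrite weight-zero f n e | e n = refl

weight-one : ∀ n → 1 ≤ n → weight (λ i → not (0 <ᵇ i)) n ≡ 1
weight-one (suc n) _ = trans (weight-suc (λ i → not (0 <ᵇ i)) n)
  (cong (λ v → 1 + 2 * v) (weight-zero (λ _ → false) n (λ _ → refl)))

weight-digits : ∀ (ds : Expansion 2) n → length ds ≤ n →
                weight (λ i → is isBit1 (nth (map encodeBit ds) i)) n ≡ fromDigits ds
weight-digits []       n       _       = weight-zero _ n λ _ → refl
weight-digits (d ∷ ds) (suc n) (s≤s p) =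
  trans (weight-suc (λ i → is isBit1 (nth (map encodeBit (d ∷ ds)) i)) n)
    (cong₂ _+_ (digit-value d) (trans (cong (2 *_) (weight-digits ds n p)) (*-comm 2 (fromDigits ds))))
  where
  digit-value : ∀ (d : Bit) → bit (isBit1 (encodeBit d)) ≡ toℕ d
  digit-value zero       = refl
  digit-value (suc zero) = refl

weight-encodeℕ : ∀ m n → length (encodeℕ m) ≤ n → weight (λ i → is isBit1 (nth (encodeℕ m) i)) n ≡ m
weight-encodeℕ m n p = trans
  (weight-digits (proj₁ (toDigits 2 m)) n (subst (_≤ n) (length-map encodeBit (proj₁ (toDigits 2 m))) p))
  (proj₂ (toDigits 2 m))

-- The remaining four symbols occur only as delimiters, never inside a name, value or number, so the
-- parts of the input can be located by counting them.
data Plain : Symbol → Set where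
  bit0 : Plain bit0
  bit1 : Plain bit1
  plus : Plain plus
  minus : Plain minus
  over : Plain over
  null : Plain null
  cat : Plain cat
  num : Plain num

Structural : (Symbol → Bool) → Set
Structural p = ∀ {a} → Plain a → p a ≡ false

attr-structural : Structural isAttr
attr-structural bit0 = refl
attr-structural bit1 = refl
attr-structural plus = refl
attr-structural minus = refl
attr-structural over = refl
attr-structural null = refl
attr-structural cat = refl
attr-structural num = refl

tuple-structural : Structural isTuple
tuple-structural bit0 = refl
tuple-structural bit1 = refl
tuple-structural plus = refl
tuple-structural minus = refl
tuple-structural over = refl
tuple-structural null = refl
tuple-structural cat = refl
tuple-structural num = refl

cell-structural : Structural isCell
cell-structural bit0 = refl
cell-structural bit1 = refl
cell-structural plus = refl
cell-structural minus = refl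
cell-structural over = refl
cell-structural null = refl
cell-structural cat = refl
cell-structural num = refl

param-structural : Structural isParam
param-structural bit0 = refl
param-structural bit1 = refl
param-structural plus = refl
param-structural minus = refl
param-structural over = refl
param-structural null = refl
param-structural cat = refl
param-structural num = refl

plain-word : ∀ u → All Plain (encodeWord u)
plain-word []          = []
plain-word (true ∷ u)  = bit1 ∷ plain-word u
plain-word (false ∷ u) = bit0 ∷ plain-word u

plain-ℕ : ∀ m → All Plain (encodeℕ m)
plain-ℕ m = all (proj₁ (toDigits 2 m))
  where
  all : ∀ ds → All Plain (map encodeBit ds)
  all []              = []
  all (zero ∷ ds)     = bit0 ∷ all ds
  all (suc zero ∷ ds) = bit1 ∷ all ds

plain-ℤ : ∀ z → All Plain (encodeℤ z)
plain-ℤ (ℤ.+ m)    = plus ∷ plain-ℕ m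
plain-ℤ ℤ.-[1+ m ] = minus ∷ plain-ℕ (suc m)

plain-ℚ : ∀ q → All Plain (encodeℚ q)
plain-ℚ q = All.++⁺ (plain-ℤ (↥ q)) (over ∷ plain-ℕ (↧ₙ q))

plain-constant : ∀ κ c → All Plain (encodeConstant κ c)
plain-constant categorical = plain-word
plain-constant numeric     = plain-ℚ

plain-kind : ∀ κ → Plain (encodeKind κ)
plain-kind categorical = cat
plain-kind numeric     = num

plain-value : ∀ A v → All Plain (encodeValue A v)
plain-value A nothing        = null ∷ []
plain-value A (just (v , _)) = plain-constant (kind A) v

no-overs : ∀ m → occurrences isOver (encodeℕ m) ≡ 0
no-overs m = all (proj₁ (toDigits 2 m))
  where
  all : ∀ ds → occurrences isOver (map encodeBit ds) ≡ 0
  all []              = refl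
  all (zero ∷ ds)     = all ds
  all (suc zero ∷ ds) = all ds

-- The symbol after an entry is not mistaken for a null value, even if the
-- encoding of the entry is empty.
NotNull : List Symbol → Set
NotNull u = is isNull (nth u 0) ≡ false

notNull-concatMap : ∀ {X : Set} (F : X → List Symbol) → (∀ x v → NotNull (F x ++ v)) →
                    ∀ xs {v} → NotNull v → NotNull (concatMap F xs ++ v)
notNull-concatMap F h []       e = e
notNull-concatMap F h (x ∷ xs) {v} e =
  subst NotNull (sym (++-assoc (F x) (concatMap F xs) v)) (h x (concatMap F xs ++ v))

null-value : ∀ A v {u} → NotNull u → is isNull (nth (encodeValue A v ++ u) 0) ≡ not (is-just v)
null-value A nothing e = refl
null-value record { kind = categorical } (just ([] , _))        e = e
null-value record { kind = categorical } (just (true ∷ _ , _))  e = refl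
null-value record { kind = categorical } (just (false ∷ _ , _)) e = refl
null-value record { kind = numeric } (just (mkℚ (ℤ.+ _) _ _ , _))    e = refl
null-value record { kind = numeric } (just (mkℚ ℤ.-[1+ _ ] _ _ , _)) e = refl

-- Counting delimiters in the encoding

module Occurrences (p : Symbol → Bool) (structural : Structural p) where

  occurrences-plain : ∀ {u} → All Plain u → occurrences p u ≡ 0
  occurrences-plain []       = refl
  occurrences-plain (a ∷ as) rewrite structural a = occurrences-plain as

  occurrences-concatMap : ∀ {X : Set} (F : X → List Symbol) c → (∀ x → occurrences p (F x) ≡ c) →
                          ∀ xs → occurrences p (concatMap F xs) ≡ length xs * c
  occurrences-concatMap F c h []       = refl
  occurrences-concatMap F c h (x ∷ xs) =
    trans (occurrences-++ p (F x) (concatMap F xs)) (cong₂ _+_ (h x) (occurrences-concatMap F c h xs))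

  occurrences-attribute : ∀ A b → occurrences p (encodeAttribute A b) ≡ bit (p attr)
  occurrences-attribute A (c , _) = trans
    (cong (bit (p attr) +_) (occurrences-plain
      (All.++⁺ (plain-word (name A)) (plain-kind (kind A) ∷ plain-constant (kind A) c))))
    (+-identityʳ _)

  encodeCell : ∀ I → Tuple I → Fin ∣ I ∣ᴬ → List Symbol
  encodeCell I t i = cell ∷ encodeValue (attribute I i) (t i)

  occurrences-cell : ∀ I t i → occurrences p (encodeCell I t i) ≡ bit (p cell)
  occurrences-cell I t i =
    trans (cong (bit (p cell) +_) (occurrences-plain (plain-value (attribute I i) (t i)))) (+-identityʳ _)

  occurrences-tuple : ∀ I t → occurrences p (encodeTuple I t) ≡ bit (p tuple) + ∣ I ∣ᴬ * bit (p cell)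
  occurrences-tuple I t = cong (bit (p tuple) +_)
    (trans (occurrences-concatMap (encodeCell I t) (bit (p cell)) (occurrences-cell I t) (allFin ∣ I ∣ᴬ))
      (cong (_* bit (p cell)) (length-tabulate {n = ∣ I ∣ᴬ} id)))

  -- Every item before number i contributes `c` occurrences, so the count in `l` locates the item.
  -- `NotNull` passes from `v` to `r` because what follows the item is either another item or `v`.
  split : ∀ {X : Set} {n} (F : X → List Symbol) (g : Fin n → X) {v} c →
          (∀ x → occurrences p (F x) ≡ c) → (∀ x v → NotNull (F x ++ v)) → NotNull v → ∀ i →
          ∃[ l ] ∃[ r ] concatMap F (tabulate g) ++ v ≡ l ++ F (g i) ++ r
                      × occurrences p l ≡ toℕ i * c × NotNull r
  split F g {v} c h h′ e zero =
    [] , concatMap F (tabulate (g ∘ suc)) ++ v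
    , ++-assoc (F (g zero)) _ v , refl , notNull-concatMap F h′ (tabulate (g ∘ suc)) e
  split F g {v} c h h′ e (suc i) with split F (g ∘ suc) c h h′ e i
  ... | l , r , eq , o , nn =
    F (g zero) ++ l , r
    , trans (++-assoc (F (g zero)) _ v) (trans (cong (F (g zero) ++_) eq) (sym (++-assoc (F (g zero)) l _)))
    , trans (occurrences-++ p (F (g zero)) l) (cong₂ _+_ (h (g zero)) o) , nn

module InputFacts {ℓ} {S : Family ℓ} (x : Input S) where

  open Input x
  open BooleanDatabase T using () renaming (attributes to I; boolean to b; tuples to ts)

  n = ∣ I ∣ᴬ

  w attributePart tuplePart paramPart : List Symbol
  w = encodeInput x
  attributePart = concatMap (λ i → encodeAttribute (attribute I i) (b i)) (allFin n)
  tuplePart     = concatMap (encodeTuple I) ts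
  paramPart     = param ∷ encodeℕ k ++ param ∷ encodeℚ s

  module _ (p : Symbol → Bool) (structural : Structural p) where

    open Occurrences p structural

    occurrences-attributes : occurrences p attributePart ≡ n * bit (p attr)
    occurrences-attributes = trans
      (occurrences-concatMap _ (bit (p attr)) (λ i → occurrences-attribute (attribute I i) (b i)) (allFin n))
      (cong (_* bit (p attr)) (length-tabulate {n = n} id))

    occurrences-tuples : occurrences p tuplePart ≡ length ts * (bit (p tuple) + n * bit (p cell))
    occurrences-tuples = occurrences-concatMap (encodeTuple I) _ (occurrences-tuple I) ts

    occurrences-params : occurrences p paramPart ≡ bit (p param) + bit (p param)
    occurrences-params = cong (bit (p param) +_) (trans
      (occurrences-++ p (encodeℕ k) _)
      (cong₂ _+_ (occurrences-plain (plain-ℕ k))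
        (trans (cong (bit (p param) +_) (occurrences-plain (plain-ℚ s))) (+-identityʳ _))))

    occurrences-input : occurrences p w ≡ n * bit (p attr) + length ts * (bit (p tuple) + n * bit (p cell))
                                          + (bit (p param) + bit (p param))
    occurrences-input = trans (occurrences-++ p (attributePart ++ tuplePart) paramPart)
      (cong₂ _+_ (trans (occurrences-++ p attributePart tuplePart) (cong₂ _+_ occurrences-attributes occurrences-tuples))
        occurrences-params)

  attrs≡ : occurrences isAttr w ≡ n
  attrs≡ = trans (occurrences-input isAttr attr-structural) (simplify n (length ts))
    where
    simplify : ∀ n t → n * 1 + t * (0 + n * 0) + 0 ≡ n
    simplify = solve-∀

  tuples≡ : occurrences isTuple w ≡ length ts
  tuples≡ = trans (occurrences-input isTuple tuple-structural) (simplify n (length ts))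
    where
    simplify : ∀ n t → n * 0 + t * (1 + n * 0) + 0 ≡ t
    simplify = solve-∀

  params≡ : occurrences isParam (attributePart ++ tuplePart) ≡ 0
  params≡ = trans (occurrences-++ isParam attributePart tuplePart)
    (trans (cong₂ _+_ (occurrences-attributes isParam param-structural) (occurrences-tuples isParam param-structural))
      (simplify n (length ts)))
    where
    simplify : ∀ n t → n * 0 + t * (0 + n * 0) ≡ 0
    simplify = solve-∀

  no-param : ∀ m → occurrences isParam (encodeℕ m) ≡ 0
  no-param m = Occurrences.occurrences-plain isParam param-structural (plain-ℕ m)

  input≡ : ∀ {p} → ↥ s ≡ ℤ.+ p →
           w ≡ (attributePart ++ tuplePart) ++ param ∷ encodeℕ k ++ param ∷ plus ∷ encodeℕ p ++ over ∷ encodeℕ (↧ₙ s)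
  input≡ e = cong (λ z → (attributePart ++ tuplePart) ++ param ∷ encodeℕ k ++ param ∷ encodeℤ z ++ over ∷ encodeℕ (↧ₙ s)) e

  open Evaluate w using (nonnull)

  -- Two applications of `split`: at tuple `j`, where each earlier tuple contributes n symbols
  -- `cell`, and inside it at entry `i`.
  cell-at : ∀ j i → ∃[ l ] ∃[ r ] w ≡ l ++ cell ∷ encodeValue (attribute I i) (List.lookup ts j i) ++ r
                                × occurrences isCell l ≡ toℕ j * n + toℕ i × NotNull r
  cell-at j i
    with Occurrences.split isCell cell-structural (encodeTuple I) (List.lookup ts) {paramPart}
           (0 + n * 1) (Occurrences.occurrences-tuple isCell cell-structural I) (λ _ _ → refl) refl j
  ... | l , r , eq , o , nn
    with Occurrences.split isCell cell-structural
           (λ i → cell ∷ encodeValue (attribute I i) (List.lookup ts j i)) id {r}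
           1 (Occurrences.occurrences-cell isCell cell-structural I (List.lookup ts j)) (λ _ _ → refl) nn i
  ... | l′ , r′ , eq′ , o′ , nn′ =
    attributePart ++ l ++ tuple ∷ l′ , r′
    , trans (++-assoc attributePart tuplePart paramPart)
        (trans (cong (attributePart ++_) (trans (cong (λ us → concatMap (encodeTuple I) us ++ paramPart) (sym (tabulate-lookup ts)))
          (trans eq (trans (cong (λ u → l ++ tuple ∷ u) eq′) (sym (++-assoc l (tuple ∷ l′) _))))))
          (sym (++-assoc attributePart (l ++ tuple ∷ l′) _)))
    , trans (occurrences-++ isCell attributePart _)
        (trans (cong₂ _+_ (occurrences-attributes isCell cell-structural)
            (trans (occurrences-++ isCell l (tuple ∷ l′)) (cong₂ _+_ o o′)))
          (simplify n (toℕ j) (toℕ i)))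
    , nn′
    where
    simplify : ∀ n j i → n * 0 + (j * (0 + n * 1) + i * 1) ≡ j * n + i
    simplify = solve-∀

  agrees : ∀ j i → nonnull n (toℕ j) (toℕ i) ≡ is-just (List.lookup ts j i)
  agrees j i with cell-at j i
  ... | l , r , eq , o , nn = trans
    (cong not (trans
      (cong (λ k → is isNull (nth w (suc k))) (trans (cong₂ (position isCell) eq (sym o)) (position-occurrence isCell l cell _ refl)))
      (trans (cong (λ u → is isNull (nth u (suc (length l)))) eq)
        (trans (cong (is isNull) (trans (cong (nth (l ++ v)) (+-comm 1 (length l))) (nth-++ l v 1)))
          (null-value (attribute I i) (List.lookup ts j i) {r} nn)))))
    (not-involutive _)
    where
    v = cell ∷ encodeValue (attribute I i) (List.lookup ts j i) ++ r

-- Correctness of the search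

2^⌊log₂⌋≤ : ∀ n → 1 ≤ n → 2 ^ ⌊log₂ n ⌋ ≤ n
2^⌊log₂⌋≤ = <-rec _ λ where
  (suc zero)        _ _ → ≤-refl
  n@(suc (suc n-2)) smaller _ →
    let h = ⌊ n /2⌋
        1≤log : 1 ≤ ⌊log₂ n ⌋
        1≤log = subst (_≤ ⌊log₂ n ⌋) (⌊log₂[2^n]⌋≡n 1) (⌊log₂⌋-mono-≤ {2} {n} (s≤s (s≤s z≤n)))
        log≡ : suc ⌊log₂ h ⌋ ≡ ⌊log₂ n ⌋
        log≡ = trans (cong suc (⌊log₂⌊n/2⌋⌋≡⌊log₂n⌋∸1 n)) (m+[n∸m]≡n 1≤log)
    in subst (λ l → 2 ^ l ≤ n) log≡
      (≤-trans (*-monoʳ-≤ 2 (smaller (⌊n/2⌋<n (suc n-2)) (s≤s z≤n)))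
        (≤-trans (≤-reflexive (cong (h +_) (+-identityʳ h)))
          (≤-trans (+-monoʳ-≤ h (⌊n/2⌋≤⌈n/2⌉ n)) (≤-reflexive (⌊n/2⌋+⌈n/2⌉≡n n)))))

half-digit : ∀ b e → ⌊ bit b + (e + e) /2⌋ ≡ e
half-digit true  e = sym (n≡⌈n+n/2⌉ e)
half-digit false e = sym (n≡⌊n+n/2⌋ e)

odd-digit : ∀ b e → odd (bit b + (e + e)) ≡ b
odd-digit b e rewrite half-digit b e | m+n∸n≡m (bit b) (e + e) with b
... | true  = refl
... | false = refl

countTo≤ : ∀ p n → countTo p n ≤ n
countTo≤ p zero = z≤n
countTo≤ p (suc n) with p n
... | true  = s≤s (countTo≤ p n)
... | false = m≤n⇒m≤1+n (countTo≤ p n)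

positive : ∀ {m} → 1 ≤ m → (0 <ᵇ m) ≡ true
positive (s≤s _) = refl

-- The inverse of `selected`: only the non-null positions of the row receive a binary digit, so the
-- number of possible codes is 2 to the size of the row rather than 2ⁿ.
encodeSubset : (row V : ℕ → Bool) → ℕ → ℕ
encodeSubset row V zero    = 0
encodeSubset row V (suc n) =
  let e = encodeSubset (row ∘ suc) (V ∘ suc) n in if row 0 then bit (V 0) + (e + e) else e

encodeSubset< : ∀ row V n → encodeSubset row V n < 2 ^ countTo row n
encodeSubset< row V zero = s≤s z≤n
encodeSubset< row V (suc n) rewrite countTo-suc {A = ℕ} row n with row 0
... | false = encodeSubset< (row ∘ suc) (V ∘ suc) n
... | true  = ≤-trans (carry-digit (V 0)) (≤-trans (+-mono-≤ e< e<) (≤-reflexive (cong (2 ^ countTo (row ∘ suc) n +_) (sym (+-identityʳ _)))))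
  where
  e = encodeSubset (row ∘ suc) (V ∘ suc) n
  e< = encodeSubset< (row ∘ suc) (V ∘ suc) n

  carry-digit : ∀ b → suc (bit b + (e + e)) ≤ suc e + suc e
  carry-digit true  = s≤s (≤-reflexive (sym (+-suc e e)))
  carry-digit false = s≤s (+-monoʳ-≤ e (n≤1+n e))

-- `unread` recurses on the last attribute and `encodeSubset` on the first; this brings the two into
-- step.
unread-suc : ∀ row m i → unread row m (suc i) ≡ unread (row ∘ suc) (unread row m 1) i
unread-suc row m zero = refl
unread-suc row m (suc i) rewrite unread-suc row m i = refl

selected-encodeSubset : ∀ row V n i → i < n → selected row (encodeSubset row V n) i ≡ (row i ∧ V i)
selected-encodeSubset row V (suc n) zero _ with row 0
... | false = refl
... | true  = odd-digit (V 0) (encodeSubset (row ∘ suc) (V ∘ suc) n)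
selected-encodeSubset row V (suc n) (suc i) (s≤s i<n) = trans
  (cong (λ m → row (suc i) ∧ odd m) (trans (unread-suc row _ i) (cong (λ m → unread (row ∘ suc) m i) first)))
  (selected-encodeSubset (row ∘ suc) (V ∘ suc) n i i<n)
  where
  first : unread row (encodeSubset row V (suc n)) 1 ≡ encodeSubset (row ∘ suc) (V ∘ suc) n
  first with row 0
  ... | true  = half-digit (V 0) _
  ... | false = refl

∧-≡true : ∀ {a b} → (a ∧ b) ≡ true ⇔ (a ≡ true × b ≡ true)
∧-≡true {true}  = mk⇔ (refl ,_) proj₂
∧-≡true {false} = mk⇔ (λ ()) λ ()

≤ᵇ-≡true : ∀ {a b} → (a ≤ᵇ b) ≡ true ⇔ a ≤ b
≤ᵇ-≡true {a} {b} = mk⇔ (λ e → ≤ᵇ⇒≤ a b (Equivalence.from T-≡ e)) (λ p → Equivalence.to T-≡ (≤⇒≤ᵇ p))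

module _ (nonnull : ℕ → ℕ → Bool) (n T : ℕ) where

  open Search nonnull n T

  acceptable⇔ : ∀ k p q A → acceptable k 1 p q A ≡ true ⇔ Accepted k p q A
  acceptable⇔ k p q A rewrite *-identityʳ (countTo A n) | +-identityʳ k = mk⇔
    (λ e → let 2≤A , e₁ = Equivalence.to ∧-≡true e
               long , e₂ = Equivalence.to ∧-≡true e₁
               triv , freq = Equivalence.to ∧-≡true e₂
           in Equivalence.to ≤ᵇ-≡true 2≤A , Equivalence.to ≤ᵇ-≡true long , triv , Equivalence.to ≤ᵇ-≡true freq)
    (λ (2≤A , long , triv , freq) → Equivalence.from ∧-≡true (Equivalence.from ≤ᵇ-≡true 2≤A
      , Equivalence.from ∧-≡true (Equivalence.from ≤ᵇ-≡true long
      , Equivalence.from ∧-≡true (triv , Equivalence.from ≤ᵇ-≡true freq))))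

  acceptable-cong : ∀ k p q {A B} → (∀ i → i < n → A i ≡ B i) → acceptable k 1 p q A ≡ acceptable k 1 p q B
  acceptable-cong k p q {A} {B} e rewrite countTo-cong n e
    | forallTo-cong {λ i → implies (A i) (existsTo (λ j → not (nonnull j i)) T)} n
        (λ i i<n → cong (λ b → implies b (existsTo (λ j → not (nonnull j i)) T)) (e i i<n))
    | countTo-cong {λ j → forallTo (λ i → implies (A i) (nonnull j i)) n} T
        (λ j _ → forallTo-cong n λ i i<n → cong (λ b → implies b (nonnull j i)) (e i i<n)) = refl

  -- From right to left: T and p are positive, so the frequency inequality forces positive support
  -- and some row `j` contains A. Restricting A to that row changes nothing, and so its code
  -- relative to the row, which is less than 2 to the size of the row and hence than d, selects A
  -- itself.
  found⇔ : ∀ k p q d → 1 ≤ p → (∀ j → j < T → 2 ^ countTo (nonnull j) n ≤ d) →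
           found k 1 p q d ≡ true ⇔ (∃[ A ] Accepted k p q A)
  found⇔ k p q d 1≤p rows≤ = mk⇔ fwd bwd
    where
    fwd : found k 1 p q d ≡ true → ∃[ A ] Accepted k p q A
    fwd e = let j , _ , e′ = existsTo-elim T e
                m , _ , e″ = existsTo-elim d e′
            in selected (nonnull j) m , Equivalence.to (acceptable⇔ k p q (selected (nonnull j) m)) e″

    1≤T : ∀ {A} → 2 ≤ countTo A n → nontrivial A ≡ true → 1 ≤ T
    1≤T {A} 2≤A triv with existsTo-elim {A} n (positive (<⇒≤ 2≤A))
    ... | i , i<n , Ai with forallTo-elim {n = n} triv i i<n
    ... | h rewrite Ai with existsTo-elim T h
    ... | j , j<T , _ = ≤-trans (s≤s z≤n) j<T

    bwd : ∃[ A ] Accepted k p q A → found k 1 p q d ≡ true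
    bwd (A , acc@(2≤A , _ , triv , freq)) =
      let j , j< , covering = existsTo-elim {λ j → forallTo (λ i → implies (A i) (nonnull j i)) n} T
            (positive (left-positive (support A) q (≤-trans (*-mono-≤ (1≤T 2≤A triv) 1≤p) freq)))
          m = encodeSubset (nonnull j) A n
      in existsTo-intro j j< (existsTo-intro m (≤-trans (encodeSubset< (nonnull j) A n) (rows≤ j j<))
        (trans (acceptable-cong k p q λ i i<n → trans (selected-encodeSubset (nonnull j) A n i i<n)
            (absorb (forallTo-elim {λ i → implies (A i) (nonnull j i)} {n} covering i i<n)))
          (Equivalence.from (acceptable⇔ k p q A) acc)))
      where
      absorb : ∀ {a b} → implies a b ≡ true → (b ∧ a) ≡ a
      absorb {true}  {true}  _ = refl
      absorb {false} {true}  _ = refl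
      absorb {false} {false} _ = refl

positive-numerator : ∀ s → 0ℚ <ℚ s → ∃[ p ] ↥ s ≡ ℤ.+ p
positive-numerator (mkℚ (ℤ.+ p) _ _) _ = p , refl
positive-numerator (mkℚ ℤ.-[1+ _ ] _ _) (*<* ())

module _ (w X : List Symbol) (k p q n T : ℕ)
  (w≡ : w ≡ X ++ param ∷ encodeℕ k ++ param ∷ plus ∷ encodeℕ p ++ over ∷ encodeℕ q)
  (X-params : occurrences isParam X ≡ 0) (k-params : occurrences isParam (encodeℕ k) ≡ 0)
  (n≡ : occurrences isAttr w ≡ n) (T≡ : occurrences isTuple w ≡ T) where

  open Evaluate w
  open Search (nonnull n) n T
  open Parameters X (encodeℕ k) (encodeℕ p) (encodeℕ q) w≡ X-params k-params (no-overs q)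

  private
    K = length (encodeℕ k)
    P = length (encodeℕ p)
    Q = length (encodeℕ q)

  length-input : length w ≡ length X + suc (K + suc (suc (P + suc Q)))
  length-input = trans (cong length w≡) (trans (length-++ X)
    (cong (λ l → length X + suc l) (trans (length-++ (encodeℕ k))
      (cong (λ l → K + suc (suc l)) (length-++ (encodeℕ p))))))

  inside : ∀ {l} → l ≤ suc (K + suc (suc (P + suc Q))) → l ≤ length w
  inside h = ≤-trans (≤-trans h (m≤n+m _ (length X))) (≤-reflexive (sym length-input))

  -- Comparisons run over as many bits as the input has symbols. That is enough because the digits
  -- are part of the input, and zeros are read beyond their end.
  weight-k : weight (digitOf (encodeℕ k)) (length w) ≡ k
  weight-k = weight-encodeℕ k (length w) (inside (m≤n⇒m≤1+n (m≤m+n K _)))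

  weight-p : weight (digitOf (encodeℕ p)) (length w) ≡ p
  weight-p = weight-encodeℕ p (length w) (inside
    (m≤n⇒m≤1+n (≤-trans (m≤n⇒m≤1+n (m≤n⇒m≤1+n (m≤m+n P (suc Q)))) (m≤n+m _ K))))

  weight-q : weight (digitOf (encodeℕ q)) (length w) ≡ q
  weight-q = weight-encodeℕ q (length w) (inside
    (m≤n⇒m≤1+n (≤-trans (m≤n⇒m≤1+n (m≤n⇒m≤1+n (≤-trans (n≤1+n Q) (m≤n+m (suc Q) P)))) (m≤n+m _ K))))

  problem⇔ : ∀ c₀ c → 1 ≤ p → (∀ j → j < T → 2 ^ countTo (nonnull n j) n ≤ c₀ * n ^ c) →
             (0 <ᵇ eval w (problemᵗ c₀ c) (length w ∷ [])) ≡ true ⇔ (∃[ A ] Accepted k p q A)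
  problem⇔ c₀ c 1≤p rows≤ = subst (λ b → b ≡ true ⇔ (∃[ A ] Accepted k p q A)) (sym eval≡)
    (found⇔ (nonnull n) n T k p q (c₀ * n ^ c) 1≤p rows≤)
    where
    eval≡ : (0 <ᵇ eval w (problemᵗ c₀ c) (length w ∷ [])) ≡ found k 1 p q (c₀ * n ^ c)
    eval≡ = trans (holds-problem n T n≡ T≡ c₀ c)
      (trans (cong₂ (λ a b → found a b (weight (digitOf (encodeℕ p)) (length w)) (weight (digitOf (encodeℕ q)) (length w)) (c₀ * n ^ c))
          weight-k (weight-one (length w) (inside (s≤s z≤n))))
        (cong₂ (λ a b → found k 1 a b (c₀ * n ^ c)) weight-p weight-q))

module _ {ℓ} (S : Family ℓ) (f : ℕ → ℕ) (c n₀ : ℕ) (f≤ : ∀ n → n₀ ≤ n → f n ≤ c * ⌊log₂ n ⌋)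
  (sizes≤ : ∀ T → S T → maxTupleSize (attributes T) (tuples T) ≤ f ∣ attributes T ∣ᴬ) (x : Input S) where

  open Input x
  open InputFacts x

  private
    ts = tuples T
    p  = proj₁ (positive-numerator s 0<s)
    p≡ = proj₂ (positive-numerator s 0<s)
    q  = ↧ₙ s

  open Evaluate w
  open Rules T (nonnull n) agrees

  1≤n : 1 ≤ n
  1≤n = ≤-trans 1≤k k≤∣I∣

  rowSize≤f : ∀ j → j < length ts → countTo (nonnull n j) n ≤ f n
  rowSize≤f j j< = ≤-trans
    (countTo≤filter-allFin n (λ i → T? (is-just (t i))) (nonnull n j) λ i e →
      Equivalence.from T-≡ (trans (sym (agrees (fromℕ< j<) i)) (trans (cong (λ j → nonnull n j (toℕ i)) (toℕ-fromℕ< j<)) e)))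
    (≤-trans (All.lookup (xs≤max 0 (map (tupleSize I) ts)) (∈-map⁺ (tupleSize I) (∈-lookup (fromℕ< j<))))
      (sizes≤ T T∈S))
    where
    I = attributes T
    t = List.lookup ts (fromℕ< j<)

  -- From n₀ on, a row has at most c·log n non-null entries, and 2^(c·log n) is at most n^c. For
  -- smaller n the trivial bound n on the size of a row is enough, which explains the factor 2^n₀.
  rowSize≤ : ∀ j → j < length ts → 2 ^ countTo (nonnull n j) n ≤ 2 ^ n₀ * n ^ c
  rowSize≤ j j< with n₀ ≤? n
  ... | yes n₀≤n = begin
    2 ^ countTo (nonnull n j) n ≤⟨ ^-monoʳ-≤ 2 (≤-trans (rowSize≤f j j<) (f≤ n n₀≤n)) ⟩
    2 ^ (c * ⌊log₂ n ⌋)         ≡⟨ cong (2 ^_) (*-comm c ⌊log₂ n ⌋) ⟩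
    2 ^ (⌊log₂ n ⌋ * c)         ≡⟨ sym (^-*-assoc 2 ⌊log₂ n ⌋ c) ⟩
    (2 ^ ⌊log₂ n ⌋) ^ c         ≤⟨ ^-monoˡ-≤ c (2^⌊log₂⌋≤ n 1≤n) ⟩
    n ^ c                       ≤⟨ m≤n*m (n ^ c) (2 ^ n₀) {{m^n≢0 2 n₀}} ⟩
    2 ^ n₀ * n ^ c              ∎
    where open ≤-Reasoning
  ... | no n₀≰n = begin
    2 ^ countTo (nonnull n j) n ≤⟨ ^-monoʳ-≤ 2 (≤-trans (countTo≤ (nonnull n j) n) (<⇒≤ (≰⇒> n₀≰n))) ⟩
    2 ^ n₀                      ≤⟨ m≤m*n (2 ^ n₀) (n ^ c) {{m^n≢0 n c {{>-nonZero 1≤n}}}} ⟩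
    2 ^ n₀ * n ^ c              ∎
    where open ≤-Reasoning

  problem-correct : (0 <ᵇ eval w (problemᵗ (2 ^ n₀) c) (length w ∷ [])) ≡ true
                    ⇔ ⟨ attributes T , ts , sup , k , s ⟩
  problem-correct = ⇔-sym (rules⇔ 0<s p≡ k) ⇔-∘
    problem⇔ w (attributePart ++ tuplePart) k p q n (length ts) (input≡ p≡) params≡ (no-param k) attrs≡ tuples≡
      (2 ^ n₀) c (numerator-positive s 0<s p≡) rowSize≤

theorem4p1 : ∀ {ℓ} (S : Family ℓ) → Sparse S →
    InL finiteSymbol (encodeInput {S = S})
    (λ x → let open Input x in ⟨ attributes T , tuples T , sup , k , s ⟩)
theorem4p1 S (f , (c , n₀ , f≤) , sizes≤) = Decider.inL (problemᵗ (2 ^ n₀) c) finiteSymbol encodeInput _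
  (problem-correct S f c n₀ f≤ sizes≤)
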